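{- Let $\Gamma$ be a bipartite distance-balanced graph for which there exists a $2$-cut $\{a,b\}$ with $d(a,b)=3$. Then either $\Gamma$ is a cycle, or there exist an integer $m\ge 2$ and an odd integer $\ell\ge 3$ such that $\Gamma$ is isomorphic to $W(m,\ell)$.
   Context: All graphs are finite, simple, undirected, connected; $d$ denotes distance. For $u,v$ let $W_{uv}=\{z: d(u,z)<d(v,z)\}$; a connected graph is distance-balanced if $|W_{uv}|=|W_{vu}|$ for all adjacent $u,v$. A $2$-cut is a set of two vertices whose removal disconnects the graph. For $m\ge2$, $\ell\ge3$ and $0\le i\le 4\ell-1$ let $f(i)=1$ if $i\equiv 0$ or $3\pmod 4$ and $f(i)=m$ otherwise; $W(m,\ell)$ is the graph with vertex set $\{(i,j):0\le i\le 4\ell-1,\ 1\le j\le f(i)\}$ in which $(i_1,j_1)\sim(i_2,j_2)$ iff $i_2-i_1\equiv\pm1\pmod{4\ell}$. -}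

module Defs where

open import Data.Bool using (Bool; true; false; not; _∧_; _∨_; if_then_else_)
open import Data.Nat using (ℕ; zero; suc; _≤_; _<ᵇ_; _≡ᵇ_; _*_; _%_)
open import Data.Fin using (Fin; toℕ)
open import Data.Fin.Properties using (_≟_)
open import Data.List using (List; length; filterᵇ; upTo; allFin)
open import Data.Bool.ListAction using (any)
open import Data.Product using (Σ; ∃; ∃-syntax; _×_)
open import Relation.Nullary.Decidable using (⌊_⌋)
open import Relation.Binary.PropositionalEquality using (_≡_)
open import Function.Bundles using (_↔_; Inverse)

record Graph : Set where
  field
    n         : ℕ
    adj       : Fin n → Fin n → Bool
    adj-sym   : ∀ u v → adj u v ≡ adj v u
    adj-irr   : ∀ u → adj u u ≡ false
open Graph public

_==_ : ∀ {n} → Fin n → Fin n → Bool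
u == v = ⌊ u ≟ v ⌋

reachIn : (G : Graph) → (Fin (n G) → Bool) → ℕ → Fin (n G) → Fin (n G) → Bool
reachIn G A zero    u v = u == v
reachIn G A (suc k) u v =
  reachIn G A k u v ∨ any (λ w → adj G u w ∧ (A w ∧ reachIn G A k w v)) (allFin (n G))

reach : (G : Graph) → ℕ → Fin (n G) → Fin (n G) → Bool
reach G = reachIn G (λ _ → true)

Connected : Graph → Set
Connected G = ∀ u v → ∃[ k ] reach G k u v ≡ true

-- Distance: the number of k ∈ {0,…,n-1} such that v is not reachable from u
-- by a walk of length ≤ k.  In a connected graph on n vertices this is
-- exactly the least k with a walk of length k, i.e. the usual distance d(u,v).
dist : (G : Graph) → Fin (n G) → Fin (n G) → ℕ
dist G u v = length (filterᵇ (λ k → not (reach G k u v)) (upTo (n G)))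

card : ∀ {n} → (Fin n → Bool) → ℕ
card {n} p = length (filterᵇ p (allFin n))

W : (G : Graph) → Fin (n G) → Fin (n G) → ℕ
W G u v = card (λ z → dist G u z <ᵇ dist G v z)

DistanceBalanced : Graph → Set
DistanceBalanced G = ∀ u v → adj G u v ≡ true → W G u v ≡ W G v u

Bipartite : Graph → Set
Bipartite G = Σ (Fin (n G) → Bool) λ c → ∀ u v → adj G u v ≡ true → c u ≡ not (c v)

TwoCut : (G : Graph) → Fin (n G) → Fin (n G) → Set
TwoCut G a b =
  (a == b) ≡ false ×
  ∃[ x ] ∃[ y ] (allowed x ≡ true × allowed y ≡ true ×
                 (∀ k → reachIn G allowed k x y ≡ false))
  where
  allowed : Fin (n G) → Bool
  allowed z = not ((z == a) ∨ (z == b))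

IsoTo : (G : Graph) → (V : Set) → (V → V → Bool) → Set
IsoTo G V R = Σ (Fin (n G) ↔ V) λ φ →
  ∀ u v → adj G u v ≡ R (Inverse.to φ u) (Inverse.to φ v)

succMod : ℕ → ℕ → ℕ → Bool
succMod N a b = (suc a ≡ᵇ b) ∨ ((suc a ≡ᵇ N) ∧ (b ≡ᵇ 0))

cycAdjℕ : ℕ → ℕ → ℕ → Bool
cycAdjℕ N a b = succMod N a b ∨ succMod N b a

cycAdj : (N : ℕ) → Fin N → Fin N → Bool
cycAdj N i j = cycAdjℕ N (toℕ i) (toℕ j)

IsCycle : Graph → Set
IsCycle G = 3 ≤ n G × IsoTo G (Fin (n G)) (cycAdj (n G))

fW : ℕ → ℕ → ℕ
fW m i with i % 4
... | 0 = 1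
... | 3 = 1
... | _ = m

-- vertex (i,j) with 0 ≤ i ≤ 4ℓ-1 and j ranging over f(i) values (Fin (f i) ≅ {1,…,f(i)})
WV : ℕ → ℕ → Set
WV m ℓ = Σ (Fin (4 * ℓ)) λ i → Fin (fW m (toℕ i))

Wadj : (m ℓ : ℕ) → WV m ℓ → WV m ℓ → Bool
Wadj m ℓ (i₁ Data.Product., _) (i₂ Data.Product., _) = cycAdjℕ (4 * ℓ) (toℕ i₁) (toℕ i₂)

{-# OPTIONS --safe #-}
module Submission where

-- In a bipartite distance-balanced graph the transmission T(v) = Σ_z d(v,z) is
-- constant.  Comparing T on suitably chosen vertices forces equality in
-- pointwise estimates of distances, and everything follows from this.
--
-- * If {a,c} cuts off a set P of fewer than half of the vertices, then all of P
--   lies on geodesics from a to c.  Hence the small side A of the cut {a,b} with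
--   d(a,b) = 3 consists of neighbours of a and neighbours of b.
-- * Outside A, d(a,·) - d(b,·) is ±1 or ±3.  From T(a) + T(b) = T(x) + T(y), for
--   an edge x y of A, the two parts of A are completely joined and the values
--   ±1 are attained at exactly one vertex c and one vertex e, which are adjacent.
-- * The cuts {a,c} and {b,e} then arrange all vertices in 2h cyclic layers.  If
--   layer k is at cyclic distance from everything and the opposite layer k + h
--   is a single vertex, then comparing T on layers k+1, k+2, k+h, k+h+1 shows
--   that layers k+1 and k+h+1 have the same property and layer k+2 is a single
--   vertex.  Going around the cycle gives the layer sizes 1, m, m, 1, 1, m, m, …

open import Defs
open import Data.Nat using (ℕ; _≤_; _%_)
open import Data.Product using (∃; ∃-syntax; _×_)
open import Data.Sum using (_⊎_)
open import Relation.Binary.PropositionalEquality using (_≡_)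

import Algebra.Properties.CommutativeMonoid.Sum as Sum
open import Data.Bool using (Bool; true; false; _∧_; T; not; _∨_)
open import Data.Bool.ListAction using (any)
open import Data.Bool.Properties using (T-≡; not-¬; ∨-zeroʳ; ∧-zeroʳ) renaming (_≟_ to _≟ᵇ_)
open import Data.Empty using (⊥; ⊥-elim)
open import Data.Fin using (Fin; zero; suc; _↑ʳ_; toℕ; fromℕ<; cast)
open import Data.Fin.Permutation using (↔⇒≡)
open import Data.Fin.Properties using (_≟_; injective⇒≤; toℕ-injective; toℕ≤pred[n]; any?; toℕ-fromℕ<; toℕ<n; cast-is-id; cast-trans)
open import Data.List using (List; []; _∷_; length; filterᵇ; tabulate; applyUpTo; allFin)
open import Data.List.Relation.Unary.Any.Properties using (any⁺; any⁻; tabulate⁺; tabulate⁻)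
open import Data.Nat using (zero; suc; _+_; _*_; _≤ᵇ_; z≤n; s≤s; _<_; _<ᵇ_; _∸_; _≡ᵇ_; _≤?_; _<?_; _/_)
open import Data.Nat.DivMod using (m≡m%n+[m/n]*n; m%n<n; [m+kn]%n≡m%n)
open import Data.Nat.Properties using (+-mono-≤; *-mono-≤; ≤-refl; ≤-trans; ≤-reflexive; +-cancelʳ-≤; +-identityʳ; *-identityˡ; ≤ᵇ⇒≤; +-monoʳ-≤; ≤-antisym; +-0-commutativeMonoid; +-suc; +-comm; 1+n≰n; ≤-pred; n≤1+n; suc-injective; +-cancelʳ-≡; m≤n⇒m≤1+n; ≤∧≢⇒<; <⇒≤; m≤n⇒m<n∨m≡n; m≤n⇒∃[o]m+o≡n; ≰⇒>; ≮⇒≥; <-irrefl; <-asym; m≤n+m; m≤m+n; <⇒≱; m+[n∸m]≡n; ∸-monoˡ-≤; n≢0⇒n>0; +-assoc; +-cancelˡ-≡; ≡ᵇ⇒≡; ≡⇒≡ᵇ; m∸n≤m; +-∸-assoc; n∸n≡0; m∸n+n≡m; *-comm; *-identityʳ) renaming (_≟_ to _≟ℕ_)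
open import Data.Nat.Tactic.RingSolver using (solve-∀)
open import Data.Product using (_,_; proj₁; proj₂; Σ)
open import Data.Sum using (inj₁; inj₂; [_,_]′)
open import Data.Vec using (Vec; []; _∷_; lookup; zipWith; replicate)
open import Function using (_∘_; id)
open import Function.Bundles using (Equivalence; _↔_; mk↔ₛ′)
open import Function.Construct.Composition using (_↔-∘_)
open import Relation.Binary.PropositionalEquality using (refl; sym; trans; cong; _≢_; cong₂; subst; module ≡-Reasoning; subst₂)
open import Relation.Nullary using (¬_; yes; no; contradiction; Dec; _×-dec_)
open import Relation.Nullary.Decidable using (⌊_⌋; ¬?)
open Sum +-0-commutativeMonoid using (sum; ∑-distrib-+; sum-cong-≗; sum-replicate-zero)

-- Constant transmission only compares sums, so every comparison is balanced beforehand: indicator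
-- functions of equal mass are added to the two sides where the plain estimate fails or has slack.
-- Once the corrected inequality holds at each vertex, the equal totals make it an equality
-- everywhere, and this yields distances for which no path is ever exhibited.
--
-- The obstacle on the cycle is that a comparison at layer k consumes a single layer at k + h but
-- produces one at k + 2. The induction closes by changing sides. With layer k flat and the two
-- layers k + h, k + h + 1 single, two comparisons make layer k + h + 2 flat and layers k + 2, k + 3
-- single, which is the same situation seen from k + h + 2. Two changes of side lead from k to k +
-- 4: this is the origin of the period 4.
--
-- Sizes come last. Opposite layers have constant total size, which gives the value m to two of four
-- consecutive layers. If m ≥ 2, the single layers h + 1 and h + 2 must be numbered 3 and 0 modulo
-- 4; hence h is 2 modulo 4, and 2h = 4ℓ makes ℓ odd.

∧-true : ∀ {p q} → p ∧ q ≡ true → p ≡ true × q ≡ true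
∧-true {true} {true} refl = refl , refl

-- Linear inequalities over ℕ: the goal follows by adding up the hypotheses,
-- each used exactly once, and comparing coefficients.

module Linear where

  infixl 7 _:+_
  infix  6 _:≤_ _:=_
  infix  4 _⊢_≤_

  data Term (k : ℕ) : Set where
    var  : Fin k → Term k
    con  : ℕ → Term k
    _:+_ : Term k → Term k → Term k

  -- A hypothesis `:=` takes an equation but uses it only as ≤ from left to right, so its
  -- orientation matters. A hypothesis needed with coefficient 2 is listed twice.
  data Hyp (k : ℕ) : Set where
    _:≤_ _:=_ : Term k → Term k → Hyp k

  record Problem (k : ℕ) : Set where
    constructor _⊢_≤_
    field
      hyps    : List (Hyp k)
      lhs rhs : Term k

  module _ {k : ℕ} (ρ : Vec ℕ k) where

    ⟦_⟧ : Term k → ℕ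
    ⟦ var i ⟧  = lookup ρ i
    ⟦ con c ⟧  = c
    ⟦ s :+ t ⟧ = ⟦ s ⟧ + ⟦ t ⟧

    Goal : List (Hyp k) → Set → Set
    Goal []              G = G
    Goal ((s :≤ t) ∷ hs) G = ⟦ s ⟧ ≤ ⟦ t ⟧ → Goal hs G
    Goal ((s := t) ∷ hs) G = ⟦ s ⟧ ≡ ⟦ t ⟧ → Goal hs G

  left right : ∀ {k} → List (Hyp k) → Term k
  left  []              = con 0
  left  ((s :≤ t) ∷ hs) = s :+ left hs
  left  ((s := t) ∷ hs) = s :+ left hs
  right []              = con 0
  right ((s :≤ t) ∷ hs) = t :+ right hs
  right ((s := t) ∷ hs) = t :+ right hs

  Coeffs : ℕ → Set
  Coeffs k = ℕ × Vec ℕ k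

  unit : ∀ {k} → Fin k → Vec ℕ k
  unit zero    = 1 ∷ replicate _ 0
  unit (suc i) = 0 ∷ unit i

  coeffs : ∀ {k} → Term k → Coeffs k
  coeffs (var i)  = 0 , unit i
  coeffs (con c)  = c , replicate _ 0
  coeffs (s :+ t) = proj₁ (coeffs s) + proj₁ (coeffs t) , zipWith _+_ (proj₂ (coeffs s)) (proj₂ (coeffs t))

  dot : ∀ {k} → Vec ℕ k → Vec ℕ k → ℕ
  dot []       []       = 0
  dot (c ∷ cs) (x ∷ xs) = c * x + dot cs xs

  dot-zero : ∀ {k} (ρ : Vec ℕ k) → dot (replicate k 0) ρ ≡ 0
  dot-zero []      = refl
  dot-zero (x ∷ ρ) = dot-zero ρ

  dot-unit : ∀ {k} (i : Fin k) (ρ : Vec ℕ k) → dot (unit i) ρ ≡ lookup ρ i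
  dot-unit zero    (x ∷ ρ) rewrite dot-zero ρ = trans (+-identityʳ _) (*-identityˡ x)
  dot-unit (suc i) (x ∷ ρ) = dot-unit i ρ

  dot-+ : ∀ {k} (cs ds ρ : Vec ℕ k) → dot (zipWith _+_ cs ds) ρ ≡ dot cs ρ + dot ds ρ
  dot-+ []       []       []      = refl
  dot-+ (c ∷ cs) (d ∷ ds) (x ∷ ρ) rewrite dot-+ cs ds ρ = lemma c d x (dot cs ρ) (dot ds ρ)
    where
    lemma : ∀ c d x y z → (c + d) * x + (y + z) ≡ c * x + y + (d * x + z)
    lemma = solve-∀

  value : ∀ {k} → Coeffs k → Vec ℕ k → ℕ
  value (c , cs) ρ = c + dot cs ρ

  coeffs-sound : ∀ {k} (t : Term k) (ρ : Vec ℕ k) → ⟦_⟧ ρ t ≡ value (coeffs t) ρ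
  coeffs-sound (var i)  ρ = sym (dot-unit i ρ)
  coeffs-sound (con c)  ρ rewrite dot-zero ρ = sym (+-identityʳ c)
  coeffs-sound (s :+ t) ρ
    rewrite coeffs-sound s ρ | coeffs-sound t ρ
          | dot-+ (proj₂ (coeffs s)) (proj₂ (coeffs t)) ρ =
    lemma (proj₁ (coeffs s)) (proj₁ (coeffs t)) (dot (proj₂ (coeffs s)) ρ) (dot (proj₂ (coeffs t)) ρ)
    where
    lemma : ∀ a b x y → a + x + (b + y) ≡ a + b + (x + y)
    lemma = solve-∀

  _≤ᵛ_ : ∀ {k} → Vec ℕ k → Vec ℕ k → Bool
  []       ≤ᵛ []       = true
  (c ∷ cs) ≤ᵛ (d ∷ ds) = (c ≤ᵇ d) ∧ (cs ≤ᵛ ds)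

  ≤ᵇ-true : ∀ m n → (m ≤ᵇ n) ≡ true → m ≤ n
  ≤ᵇ-true m n eq = ≤ᵇ⇒≤ m n (≡true⇒T eq)
    where
    ≡true⇒T : ∀ {b} → b ≡ true → T b
    ≡true⇒T refl = _

  dot-mono : ∀ {k} (cs ds ρ : Vec ℕ k) → (cs ≤ᵛ ds) ≡ true → dot cs ρ ≤ dot ds ρ
  dot-mono []       []       []      _  = z≤n
  dot-mono (c ∷ cs) (d ∷ ds) (x ∷ ρ) eq with ∧-true {c ≤ᵇ d} eq
  ... | c≤d , cs≤ds = +-mono-≤ (*-mono-≤ (≤ᵇ-true c d c≤d) ≤-refl) (dot-mono cs ds ρ cs≤ds)

  _≤ᶜ_ : ∀ {k} → Coeffs k → Coeffs k → Bool
  (c , cs) ≤ᶜ (d , ds) = (c ≤ᵇ d) ∧ (cs ≤ᵛ ds)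

  term-mono : ∀ {k} (s t : Term k) (ρ : Vec ℕ k) → (coeffs s ≤ᶜ coeffs t) ≡ true → ⟦_⟧ ρ s ≤ ⟦_⟧ ρ t
  term-mono s t ρ eq rewrite coeffs-sound s ρ | coeffs-sound t ρ
    with ∧-true {proj₁ (coeffs s) ≤ᵇ proj₁ (coeffs t)} eq
  ... | p , q = +-mono-≤ (≤ᵇ-true (proj₁ (coeffs s)) (proj₁ (coeffs t)) p) (dot-mono (proj₂ (coeffs s)) (proj₂ (coeffs t)) ρ q)

  -- Comparing coefficients of s + Σ right and t + Σ left suffices: the hypotheses give Σ left ≤ Σ
  -- right, and then Σ right cancels.
  valid : ∀ {k} → Problem k → Bool
  valid (hs ⊢ s ≤ t) = coeffs (s :+ right hs) ≤ᶜ coeffs (t :+ left hs)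

  assume : ∀ {k} (ρ : Vec ℕ k) hs {G : Set} → (⟦_⟧ ρ (left hs) ≤ ⟦_⟧ ρ (right hs) → G) → Goal ρ hs G
  assume ρ []              g = g z≤n
  assume ρ ((s :≤ t) ∷ hs) g = λ p → assume ρ hs (λ q → g (+-mono-≤ p q))
  assume ρ ((s := t) ∷ hs) g = λ p → assume ρ hs (λ q → g (+-mono-≤ (≤-reflexive p) q))

  prove : ∀ {k} (P : Problem k) → valid P ≡ true → (ρ : Vec ℕ k) →
          Goal ρ (Problem.hyps P) (⟦_⟧ ρ (Problem.lhs P) ≤ ⟦_⟧ ρ (Problem.rhs P))
  prove (hs ⊢ s ≤ t) eq ρ = assume ρ hs λ l≤r →
    +-cancelʳ-≤ (⟦_⟧ ρ (right hs)) _ _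
      (≤-trans (term-mono (s :+ right hs) (t :+ left hs) ρ eq) (+-monoʳ-≤ (⟦_⟧ ρ t) l≤r))

  -- `Terms` and `Values` let a problem be stated as a function of named variables rather than by
  -- indices into a vector.
  Terms : ℕ → ℕ → Set → Set
  Terms k zero    R = R
  Terms k (suc j) R = Term k → Terms k j R

  apply : ∀ {k} j → (Fin j → Fin k) → ∀ {R} → Terms k j R → R
  apply zero    ι f = f
  apply (suc j) ι f = apply j (ι ∘ suc) (f (var (ι zero)))

  Values : ∀ {k} j → (Vec ℕ j → Vec ℕ k) → (Vec ℕ k → Set) → Set
  Values zero    ι R = R (ι [])
  Values (suc j) ι R = (x : ℕ) → Values j (ι ∘ (x ∷_)) R

  curry : ∀ {k} j (ι : Vec ℕ j → Vec ℕ k) {R : Vec ℕ k → Set} → ((ρ : Vec ℕ k) → R ρ) → Values j ι R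
  curry zero    ι f = f (ι [])
  curry (suc j) ι f = λ x → curry j (ι ∘ (x ∷_)) f

  linear : ∀ k (P : Terms k k (Problem k)) → let Q = apply k (λ i → i) P in valid Q ≡ true →
           Values k (λ ρ → ρ) (λ ρ → Goal ρ (Problem.hyps Q) (⟦_⟧ ρ (Problem.lhs Q) ≤ ⟦_⟧ ρ (Problem.rhs Q)))
  linear k P eq = curry k (λ ρ → ρ) (prove (apply k (λ i → i) P) eq)

open Linear using (linear; con; _:+_; _:≤_; _:=_; _⊢_≤_)

-- Finite sums and counting

sum-mono : ∀ {n} {f g : Fin n → ℕ} → (∀ i → f i ≤ g i) → sum f ≤ sum g
sum-mono {zero}  f≤g = z≤n
sum-mono {suc n} f≤g = +-mono-≤ (f≤g zero) (sum-mono (f≤g ∘ suc))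

-- The totals leave no slack, so no summand can have any. This is how equal transmissions become
-- exact distances.
sum-squeeze : ∀ {n} {f g : Fin n → ℕ} → (∀ i → f i ≤ g i) → sum g ≤ sum f → ∀ i → g i ≤ f i
sum-squeeze {suc n} {f} {g} f≤g Σ≤ zero =
  linear 4 (λ a b c d → (b :+ d :≤ a :+ c) ∷ (c :≤ d) ∷ [] ⊢ b ≤ a) refl
    (f zero) (g zero) (sum (f ∘ suc)) (sum (g ∘ suc)) Σ≤ (sum-mono (f≤g ∘ suc))
sum-squeeze {suc n} {f} {g} f≤g Σ≤ (suc i) = sum-squeeze (f≤g ∘ suc)
  (linear 4 (λ a b c d → (b :+ d :≤ a :+ c) ∷ (a :≤ b) ∷ [] ⊢ d ≤ c) refl
    (f zero) (g zero) (sum (f ∘ suc)) (sum (g ∘ suc)) Σ≤ (f≤g zero)) i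

sum-const : ∀ n c → sum {n} (λ _ → c) ≡ n * c
sum-const zero    c = refl
sum-const (suc n) c = cong (c +_) (sum-const n c)

𝟙 : Bool → ℕ
𝟙 true  = 1
𝟙 false = 0

count : ∀ {n} → (Fin n → Bool) → ℕ
count p = sum (𝟙 ∘ p)

length-filterᵇ-tabulate : ∀ {A : Set} {n} (p : A → Bool) (f : Fin n → A) →
                          length (filterᵇ p (tabulate f)) ≡ count (p ∘ f)
length-filterᵇ-tabulate {n = zero}  p f = refl
length-filterᵇ-tabulate {n = suc n} p f with p (f zero)
... | true  = cong suc (length-filterᵇ-tabulate p (f ∘ suc))
... | false = length-filterᵇ-tabulate p (f ∘ suc)

card≡count : ∀ {n} (p : Fin n → Bool) → card p ≡ count p
card≡count p = length-filterᵇ-tabulate p id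

==-refl : ∀ {n} (u : Fin n) → (u == u) ≡ true
==-refl u with u ≟ u
... | yes _   = refl
... | no  u≢u = contradiction refl u≢u

==⇒≡ : ∀ {n} {u v : Fin n} → (u == v) ≡ true → u ≡ v
==⇒≡ {u = u} {v} eq with u ≟ v
... | yes u≡v = u≡v

≢⇒== : ∀ {n} {u v : Fin n} → u ≢ v → (u == v) ≡ false
≢⇒== {u = u} {v} u≢v with u ≟ v
... | yes u≡v = contradiction u≡v u≢v
... | no  _   = refl

δ : ∀ {n} → Fin n → Fin n → ℕ
δ u z = 𝟙 (z == u)

δ-same : ∀ {n} (u : Fin n) → δ u u ≡ 1
δ-same u = cong 𝟙 (==-refl u)

δ-diff : ∀ {n} {u z : Fin n} → z ≢ u → δ u z ≡ 0
δ-diff z≢u = cong 𝟙 (≢⇒== z≢u)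

sum-δ : ∀ {n} (u : Fin n) → sum (δ u) ≡ 1
sum-δ {suc n} zero    = cong suc (trans (sum-cong-≗ {n} λ i → δ-diff {u = zero} {suc i} λ ()) (sum-replicate-zero n))
sum-δ {suc n} (suc u) = trans (sum-cong-≗ {n} λ i → shift i) (sum-δ u)
  where
  shift : ∀ i → δ (suc u) (suc i) ≡ δ u i
  shift i with i ≟ u
  ... | yes _ = refl
  ... | no  _ = refl

¬true⇒false : ∀ {b} → b ≢ true → b ≡ false
¬true⇒false {true}  b≢ = contradiction refl b≢
¬true⇒false {false} b≢ = refl

bool-cases : ∀ b → b ≡ true ⊎ b ≡ false
bool-cases true  = inj₁ refl
bool-cases false = inj₂ refl

true≢false : ∀ {b} → b ≡ true → b ≢ false
true≢false refl ()

-- Numbering the elements of a decidable subset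

first : ∀ {b k} → b ≡ true → Fin (𝟙 b + k)
first refl = zero

later : ∀ b {k} → Fin k → Fin (𝟙 b + k)
later b = 𝟙 b ↑ʳ_

-- `𝟙 b` is stuck for an open `b`. With `first`, `later` and `split` the type `Fin (𝟙 b + k)`
-- behaves like a sum type, and `rank` and `select` need no case distinction on `p zero`.
split : ∀ b {k} → Fin (𝟙 b + k) → b ≡ true ⊎ Fin k
split true  zero    = inj₁ refl
split true  (suc i) = inj₂ i
split false i       = inj₂ i

split-first : ∀ {b k} (e : b ≡ true) → split b {k} (first e) ≡ inj₁ e
split-first refl = refl

split-later : ∀ b {k} (i : Fin k) → split b (later b i) ≡ inj₂ i
split-later true  i = refl
split-later false i = refl

split⁻¹ : ∀ b {k} (i : Fin (𝟙 b + k)) → [ first , later b ]′ (split b i) ≡ i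
split⁻¹ true  zero    = refl
split⁻¹ true  (suc i) = refl
split⁻¹ false i       = refl

rank : ∀ {n} (p : Fin n → Bool) (z : Fin n) → p z ≡ true → Fin (count p)
rank p zero    pz = first pz
rank p (suc z) pz = later (p zero) (rank (p ∘ suc) z pz)

select : ∀ {n} (p : Fin n → Bool) → Fin (count p) → ∃[ z ] p z ≡ true
select-split : ∀ {n} (p : Fin (suc n) → Bool) → p zero ≡ true ⊎ Fin (count (p ∘ suc)) → ∃[ z ] p z ≡ true

select {suc n} p i = select-split p (split (p zero) i)
select-split p (inj₁ p0) = zero , p0
select-split p (inj₂ i)  = let z , pz = select (p ∘ suc) i in suc z , pz

select-rank : ∀ {n} (p : Fin n → Bool) z (pz : p z ≡ true) → proj₁ (select p (rank p z pz)) ≡ z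
select-rank {suc n} p zero    pz = cong (proj₁ ∘ select-split p) (split-first pz)
select-rank {suc n} p (suc z) pz =
  trans (cong (proj₁ ∘ select-split p) (split-later (p zero) _)) (cong suc (select-rank (p ∘ suc) z pz))

rank-select : ∀ {n} (p : Fin n → Bool) i → rank p (proj₁ (select p i)) (proj₂ (select p i)) ≡ i
rank-select {suc n} p i = trans (ranked (split (p zero) i)) (split⁻¹ (p zero) i)
  where
  ranked : ∀ s → rank p (proj₁ (select-split p s)) (proj₂ (select-split p s)) ≡ [ first , later (p zero) ]′ s
  ranked (inj₁ _) = refl
  ranked (inj₂ j) = cong (later (p zero)) (rank-select (p ∘ suc) j)

-- Distance and transmission

any-true : ∀ {n} (p : Fin n → Bool) i → p i ≡ true → any p (allFin n) ≡ true
any-true p i pi = Equivalence.to T-≡ (any⁺ p (tabulate⁺ i (Equivalence.from T-≡ pi)))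

any-witness : ∀ {n} (p : Fin n → Bool) → any p (allFin n) ≡ true → ∃[ i ] p i ≡ true
any-witness p e = let i , pi = tabulate⁻ (any⁻ p _ (Equivalence.from T-≡ e)) in i , Equivalence.to T-≡ pi

module Walks (G : Graph) (A : Fin (n G) → Bool) where

  reachIn-mono : ∀ k {u v} → reachIn G A k u v ≡ true → reachIn G A (suc k) u v ≡ true
  reachIn-mono k e rewrite e = refl

  reachIn-step : ∀ k {u w v} → adj G u w ≡ true → A w ≡ true → reachIn G A k w v ≡ true →
                 reachIn G A (suc k) u v ≡ true
  reachIn-step k {u} {w} {v} u~w Aw e =
    trans (cong (reachIn G A k u v ∨_) (any-true _ w edge)) (∨-zeroʳ _)
    where
    edge : adj G u w ∧ (A w ∧ reachIn G A k w v) ≡ true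
    edge rewrite u~w | Aw = e

  reachIn-inv : ∀ k {u v} → reachIn G A (suc k) u v ≡ true →
                reachIn G A k u v ≡ true ⊎ ∃[ w ] (adj G u w ≡ true × A w ≡ true × reachIn G A k w v ≡ true)
  reachIn-inv k {u} {v} e with reachIn G A k u v
  ... | true  = inj₁ refl
  ... | false with any-witness _ e
  ...   | w , p with ∧-true {adj G u w} p
  ...     | u~w , q = inj₂ (w , u~w , ∧-true {A w} q)

Least : (ℕ → Bool) → ℕ → Set
Least f k = f k ≡ true × (∀ j → f j ≡ true → k ≤ j)

least : ∀ f k → f k ≡ true → ∃ (Least f)
least f k fk with f zero in f0
... | true = zero , f0 , λ _ _ → z≤n
least f zero    fk | false = contradiction f0 (true≢false fk)
least f (suc k) fk | false =
  let j , fj , min = least (f ∘ suc) k fk in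
  suc j , fj , λ { zero e → contradiction f0 (true≢false e) ; (suc i) e → s≤s (min i e) }

length-filterᵇ-applyUpTo : ∀ {A : Set} (p : A → Bool) (g : ℕ → A) n k → k ≤ n →
  (∀ j → j < k → p (g j) ≡ true) → (∀ j → k ≤ j → p (g j) ≡ false) →
  length (filterᵇ p (applyUpTo g n)) ≡ k
length-filterᵇ-applyUpTo p g zero    zero    _ below above = refl
length-filterᵇ-applyUpTo p g (suc n) zero    _ below above rewrite above 0 z≤n =
  length-filterᵇ-applyUpTo p (g ∘ suc) n zero z≤n (λ _ ()) (λ j _ → above (suc j) z≤n)
length-filterᵇ-applyUpTo p g (suc n) (suc k) (s≤s k≤n) below above rewrite below 0 (s≤s z≤n) =
  cong suc (length-filterᵇ-applyUpTo p (g ∘ suc) n k k≤n (λ j j<k → below (suc j) (s≤s j<k)) (λ j k≤j → above (suc j) (s≤s k≤j)))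

-- The interface through which distances are used from here on. `d-pred` provides the first step of
-- a geodesic; inductions along geodesics recurse on a number k with `d u z ≡ k`.
record Metric (n : ℕ) (_~_ : Fin n → Fin n → Set) : Set where
  field
    ~-sym  : ∀ {u v} → u ~ v → v ~ u
    d      : Fin n → Fin n → ℕ
    d-refl : ∀ u → d u u ≡ 0
    d-sep  : ∀ {u v} → d u v ≡ 0 → u ≡ v
    d-sym  : ∀ u v → d u v ≡ d v u
    d-step : ∀ {u w} → u ~ w → ∀ z → d u z ≤ suc (d w z)
    d-pred : ∀ {u z k} → d u z ≡ suc k → ∃[ w ] (u ~ w × d w z ≡ k)

  d-triangle : ∀ u w z → d u z ≤ d u w + d w z
  d-triangle u w z = go (d u w) u refl
    where
    go : ∀ k u → d u w ≡ k → d u z ≤ k + d w z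
    go zero    u e = ≤-reflexive (cong (λ y → d y z) (d-sep e))
    go (suc k) u e = let v , u~v , e′ = d-pred e in ≤-trans (d-step u~v z) (s≤s (go k v e′))

  d-pos : ∀ {u v} → u ≢ v → 1 ≤ d u v
  d-pos {u} {v} u≢v with d u v in e
  ... | zero  = contradiction (d-sep e) u≢v
  ... | suc _ = s≤s z≤n

  d-predʳ : ∀ {z u k} → d z u ≡ suc k → ∃[ w ] (u ~ w × d z w ≡ k)
  d-predʳ {z} {u} e =
    let w , u~w , e′ = d-pred (trans (d-sym u z) e) in w , u~w , trans (d-sym z w) e′

  ~⇒d≤1 : ∀ {u v} → u ~ v → d u v ≤ 1
  ~⇒d≤1 {u} {v} u~v = subst (λ k → d u v ≤ suc k) (d-refl v) (d-step u~v v)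

  d≤1⇒~ : ∀ {u v} → u ≢ v → d u v ≤ 1 → u ~ v
  d≤1⇒~ {u} {v} u≢v le =
    let w , u~w , e = d-pred (≤-antisym le (d-pos u≢v)) in subst (u ~_) (d-sep e) u~w

module _ (G : Graph) (connected : Connected G) where
  private
    V = Fin (n G)
    _~_ : V → V → Set
    u ~ v = adj G u v ≡ true
    open Walks G (λ _ → true)

  ~-symmetric : ∀ {u v} → u ~ v → v ~ u
  ~-symmetric {u} {v} e = trans (adj-sym G v u) e

  private
    walk-least : ∀ u v → ∃ (Least (λ k → reach G k u v))
    walk-least u v = let k , e = connected u v in least _ k e

    D : V → V → ℕ
    D u v = proj₁ (walk-least u v)

    D-reach : ∀ u v → reach G (D u v) u v ≡ true
    D-reach u v = proj₁ (proj₂ (walk-least u v))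

    D-min : ∀ {u v} j → reach G j u v ≡ true → D u v ≤ j
    D-min {u} {v} = proj₂ (proj₂ (walk-least u v))

    D-refl : ∀ u → D u u ≡ 0
    D-refl u = ≤-antisym (D-min 0 (==-refl u)) z≤n

    D-sep : ∀ {u v} → D u v ≡ 0 → u ≡ v
    D-sep {u} {v} e = ==⇒≡ (subst (λ k → reach G k u v ≡ true) e (D-reach u v))

    D-step : ∀ {u w} → u ~ w → ∀ z → D u z ≤ suc (D w z)
    D-step {u} {w} u~w z = D-min (suc (D w z)) (reachIn-step (D w z) u~w refl (D-reach w z))

    D-pred : ∀ {u z k} → D u z ≡ suc k → ∃[ w ] (u ~ w × D w z ≡ k)
    D-pred {u} {z} {k} e with reachIn-inv k (subst (λ k → reach G k u z ≡ true) e (D-reach u z))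
    ... | inj₁ r = contradiction (≤-trans (≤-reflexive (sym e)) (D-min k r)) 1+n≰n
    ... | inj₂ (w , u~w , _ , r) =
      w , u~w , ≤-antisym (D-min k r) (≤-pred (≤-trans (≤-reflexive (sym e)) (D-step u~w z)))

    -- `reachIn` lengthens walks at their start only; reversing a walk needs lengthening at the end.
    reach-snoc : ∀ k {u v w} → reach G k u v ≡ true → v ~ w → reach G (suc k) u w ≡ true
    reach-snoc zero    {u} {v} {w} e v~w =
      subst (λ y → reach G 1 y w ≡ true) (sym (==⇒≡ e)) (reachIn-step 0 v~w refl (==-refl w))
    reach-snoc (suc k) e v~w with reachIn-inv k e
    ... | inj₁ r                    = reachIn-mono (suc k) (reach-snoc k r v~w)
    ... | inj₂ (w′ , u~w′ , _ , r) = reachIn-step (suc k) u~w′ refl (reach-snoc k r v~w)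

    reach-sym : ∀ k {u v} → reach G k u v ≡ true → reach G k v u ≡ true
    reach-sym zero    {u} e = subst (λ y → (y == u) ≡ true) (==⇒≡ e) (==-refl u)
    reach-sym (suc k) e with reachIn-inv k e
    ... | inj₁ r                 = reachIn-mono k (reach-sym k r)
    ... | inj₂ (w , u~w , _ , r) = reach-snoc k (reach-sym k r) (~-symmetric u~w)

    D-sym : ∀ u v → D u v ≡ D v u
    D-sym u v = ≤-antisym (D-min (D v u) (reach-sym (D v u) (D-reach v u)))
                          (D-min (D u v) (reach-sym (D u v) (D-reach u v)))

    -- The vertices of a geodesic have distinct distances from its end, so D < n;
    -- hence the counting definition of dist is not truncated.
    D-value : ∀ k u v → D u v ≡ k → ∀ i → i ≤ k → ∃[ w ] D w v ≡ i
    D-value k u v e i i≤k with k ≟ℕ i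
    ... | yes refl = u , e
    D-value zero    u v e zero i≤k | no k≢i = contradiction refl k≢i
    D-value (suc k) u v e i i≤k | no k≢i =
      let w , _ , e′ = D-pred {u} {v} e in D-value k w v e′ i (≤-pred (≤∧≢⇒< i≤k (k≢i ∘ sym)))

    D<n : ∀ u v → D u v < n G
    D<n u v = injective⇒≤ {f = proj₁ ∘ at} λ {i} {j} e →
      toℕ-injective (trans (sym (proj₂ (at i))) (trans (cong (λ y → D y v) e) (proj₂ (at j))))
      where
      at : (i : Fin (suc (D u v))) → ∃[ w ] D w v ≡ toℕ i
      at i = D-value (D u v) u v refl (toℕ i) (toℕ≤pred[n] i)

    reach-≤ : ∀ {j k u v} → j ≤ k → reach G j u v ≡ true → reach G k u v ≡ true
    reach-≤ {j} {k} j≤k e with m≤n⇒∃[o]m+o≡n j≤k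
    ... | o , refl = go o
      where
      go : ∀ o → reach G (j + o) _ _ ≡ true
      go zero    rewrite +-identityʳ j = e
      go (suc o) rewrite +-suc j o = reachIn-mono (j + o) (go o)

    dist≡D : ∀ u v → dist G u v ≡ D u v
    dist≡D u v = length-filterᵇ-applyUpTo (λ k → not (reach G k u v)) id (n G) (D u v)
      (<⇒≤ (D<n u v)) below above
      where
      below : ∀ j → j < D u v → not (reach G j u v) ≡ true
      below j j<D with reach G j u v in e
      ... | true  = contradiction (≤-trans j<D (D-min j e)) 1+n≰n
      ... | false = refl
      above : ∀ j → D u v ≤ j → not (reach G j u v) ≡ false
      above j D≤j rewrite reach-≤ D≤j (D-reach u v) = refl

  graphMetric : Metric (n G) _~_
  graphMetric = record
    { ~-sym  = ~-symmetric
    ; d      = dist G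
    ; d-refl = λ u → trans (dist≡D u u) (D-refl u)
    ; d-sep  = λ {u} {v} e → D-sep (trans (sym (dist≡D u v)) e)
    ; d-sym  = λ u v → trans (dist≡D u v) (trans (D-sym u v) (sym (dist≡D v u)))
    ; d-step = λ {u} {w} u~w z → subst₂ _≤_ (sym (dist≡D u z)) (cong suc (sym (dist≡D w z))) (D-step u~w z)
    ; d-pred = λ {u} {z} e → let w , u~w , e′ = D-pred {u} {z} (trans (sym (dist≡D u z)) e) in w , u~w , trans (dist≡D w z) e′
    }

-- For bipartite graphs, constant transmission is equivalent to being
-- distance-balanced: along an edge all distances change by exactly one.
record Regular (n : ℕ) (_~_ : Fin n → Fin n → Set) : Set where
  field
    metric   : Metric n _~_
  open Metric metric public
  field
    d-parity : ∀ {u w} → u ~ w → ∀ z → d u z ≢ d w z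
    regular  : ∀ u v → sum (d u) ≡ sum (d v)

  d-edge : ∀ {u w} → u ~ w → ∀ z → d u z ≡ suc (d w z) ⊎ d w z ≡ suc (d u z)
  d-edge {u} {w} u~w z with m≤n⇒m<n∨m≡n (d-step u~w z)
  ... | inj₂ e         = inj₁ e
  ... | inj₁ (s≤s u≤w) = inj₂ (≤-antisym (d-step (~-sym u~w) z) (≤∧≢⇒< u≤w (d-parity u~w z)))

  d-edgeʳ : ∀ {u w} → u ~ w → ∀ z → d z u ≡ suc (d z w) ⊎ d z w ≡ suc (d z u)
  d-edgeʳ {u} {w} u~w z rewrite d-sym z u | d-sym z w = d-edge u~w z

  -- Two sums of two transmissions agree, so a pointwise inequality is an equality.
  squeeze : ∀ (u v u′ v′ : Fin n) {f g : Fin n → ℕ} → sum f ≡ sum g →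
            (∀ z → d u z + d v z + f z ≤ d u′ z + d v′ z + g z) →
            ∀ z → d u′ z + d v′ z + g z ≤ d u z + d v z + f z
  squeeze u v u′ v′ {f} {g} e le = sum-squeeze le (≤-reflexive (begin
    sum (λ z → d u′ z + d v′ z + g z)  ≡⟨ expand u′ v′ g ⟩
    sum (d u′) + sum (d v′) + sum g    ≡⟨ cong₂ _+_ (cong₂ _+_ (regular u′ u) (regular v′ v)) (sym e) ⟩
    sum (d u) + sum (d v) + sum f      ≡⟨ sym (expand u v f) ⟩
    sum (λ z → d u z + d v z + f z)    ∎))
    where
    open ≡-Reasoning
    expand : ∀ u v (f : Fin n → ℕ) → sum (λ z → d u z + d v z + f z) ≡ sum (d u) + sum (d v) + sum f
    expand u v f = trans (∑-distrib-+ (λ z → d u z + d v z) f) (cong (_+ sum f) (∑-distrib-+ (d u) (d v)))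

  -- The one-sided companion of `squeeze`: the corrections may have different totals, and the
  -- transmissions cancel to leave an inequality between these.
  compare : ∀ (u v : Fin n) {f g : Fin n → ℕ} →
            (∀ z → d u z + f z ≤ d v z + g z) → sum f ≤ sum g
  compare u v {f} {g} le = linear 4 (λ a b p q → (a :+ p :≤ b :+ q) ∷ (b := a) ∷ [] ⊢ p ≤ q) refl
    (sum (d u)) (sum (d v)) (sum f) (sum g)
    (subst₂ _≤_ (∑-distrib-+ (d u) f) (∑-distrib-+ (d v) g) (sum-mono le)) (regular v u)

module _ (G : Graph) (connected : Connected G) (bipartite : Bipartite G) (balanced : DistanceBalanced G) where
  private
    V = Fin (n G)
    open Metric (graphMetric G connected)
    colour = proj₁ bipartite

    alternate : ℕ → Bool → Bool
    alternate zero    b = b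
    alternate (suc k) b = not (alternate k b)

    colour-d : ∀ k u z → d u z ≡ k → colour u ≡ alternate k (colour z)
    colour-d zero    u z e = cong colour (d-sep e)
    colour-d (suc k) u z e =
      let w , u~w , e′ = d-pred e in trans (proj₂ bipartite u w u~w) (cong not (colour-d k w z e′))

    parity : ∀ {u w} → adj G u w ≡ true → ∀ z → d u z ≢ d w z
    parity {u} {w} u~w z e =
      not-¬ (trans (colour-d _ u z refl) (sym (colour-d _ w z (sym e)))) (proj₂ bipartite u w u~w)

    -- Summed over z for the distances from the ends of an edge u v, this reads T(u) + |W_uv| = T(v)
    -- + |W_vu|, which is the link between balance and transmission.
    closer : ∀ i j → i ≤ suc j → j ≤ suc i → i ≢ j → i + 𝟙 (i <ᵇ j) ≡ j + 𝟙 (j <ᵇ i)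
    closer zero    zero          _ _ i≢j = contradiction refl i≢j
    closer zero    (suc zero)    _ _ i≢j = refl
    closer zero    (suc (suc j)) _ (s≤s ()) _
    closer (suc zero) zero       _ _ i≢j = refl
    closer (suc (suc i)) zero (s≤s ()) _ _
    closer (suc i) (suc j) (s≤s p) (s≤s q) i≢j = cong suc (closer i j p q (i≢j ∘ cong suc))

    edge-regular : ∀ {u v} → adj G u v ≡ true → sum (d u) ≡ sum (d v)
    edge-regular {u} {v} u~v = +-cancelʳ-≡ _ _ _ (begin
      sum (d u) + count (λ z → d u z <ᵇ d v z)       ≡⟨ sym (∑-distrib-+ (d u) _) ⟩
      sum (λ z → d u z + 𝟙 (d u z <ᵇ d v z))         ≡⟨ sum-cong-≗ (λ z → closer (d u z) (d v z) (d-step u~v z) (d-step (~-sym u~v) z) (parity u~v z)) ⟩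
      sum (λ z → d v z + 𝟙 (d v z <ᵇ d u z))         ≡⟨ ∑-distrib-+ (d v) _ ⟩
      sum (d v) + count (λ z → d v z <ᵇ d u z)       ≡⟨ cong (sum (d v) +_) (trans (sym (card≡count (λ z → d v z <ᵇ d u z))) (trans (sym (balanced u v u~v)) (card≡count (λ z → d u z <ᵇ d v z)))) ⟩
      sum (d v) + count (λ z → d u z <ᵇ d v z)       ∎)
      where open ≡-Reasoning

    transmission : ∀ k u v → d u v ≡ k → sum (d u) ≡ sum (d v)
    transmission zero    u v e = cong (sum ∘ d) (d-sep e)
    transmission (suc k) u v e =
      let w , u~w , e′ = d-pred e in trans (edge-regular u~w) (transmission k w v e′)

  graphRegular : Regular (n G) (λ u v → adj G u v ≡ true)
  graphRegular = record
    { metric   = graphMetric G connected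
    ; d-parity = parity
    ; regular  = λ u v → transmission _ u v refl
    }

-- Cuts

module Interval {n : ℕ} {_~_ : Fin n → Fin n → Set} (R : Regular n _~_) where
  open Regular R

  -- P is a union of components of the graph without {a,c}
  record Piece (a c : Fin n) (P : Fin n → Bool) : Set where
    field
      a∉P       : P a ≡ false
      c∉P       : P c ≡ false
      separated : ∀ {u v} → P u ≡ true → u ~ v → P v ≡ true ⊎ v ≡ a ⊎ v ≡ c

    -- A geodesic from inside `P` to outside has a first vertex not in `P`, and `separated` says
    -- that it is `a` or `c`.
    through : ∀ {u z} → P u ≡ true → P z ≡ false → d u a + d a z ≤ d u z ⊎ d u c + d c z ≤ d u z
    through {u} {z} Pu Pz = go (d u z) u refl Pu
      where
      go : ∀ k u → d u z ≡ k → P u ≡ true → d u a + d a z ≤ k ⊎ d u c + d c z ≤ k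
      go zero    u e Pu = contradiction (trans (sym (cong P (d-sep e))) Pu) (λ e → true≢false e Pz)
      go (suc k) u e Pu with d-pred e
      ... | w , u~w , e′ with separated Pu u~w
      ...   | inj₂ (inj₁ refl) = inj₁ (subst₂ (λ x y → d u w + x ≤ suc y) (sym e′) refl (+-mono-≤ (~⇒d≤1 u~w) ≤-refl))
      ...   | inj₂ (inj₂ refl) = inj₂ (subst₂ (λ x y → d u w + x ≤ suc y) (sym e′) refl (+-mono-≤ (~⇒d≤1 u~w) ≤-refl))
      ...   | inj₁ Pw with go k w e′ Pw
      ...     | inj₁ le = inj₁ (≤-trans (+-mono-≤ (d-step u~w a) ≤-refl) (s≤s le))
      ...     | inj₂ le = inj₂ (≤-trans (+-mono-≤ (d-step u~w c) ≤-refl) (s≤s le))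

  module _ {a c P} (piece : Piece a c P) (small : count P < count (not ∘ P)) where
    open Piece piece

    -- An edge leading away from both a and c would leave every vertex outside P behind.
    no-escape : ∀ {q r} → q ~ r → P r ≡ true → d r a ≡ suc (d q a) → d r c ≡ suc (d q c) → ⊥
    no-escape {q} {r} q~r Pr ea ec = <-irrefl refl (≤-trans small (compare q r pointwise))
      where
      pointwise : ∀ z → d q z + 𝟙 (not (P z)) ≤ d r z + 𝟙 (P z)
      pointwise z with P z in Pz
      ... | true = linear 2 (λ x y →
            (x :≤ con 1 :+ y) ∷ [] ⊢ x :+ con 0 ≤ y :+ con 1) refl
              (d q z) (d r z) (d-step q~r z)
      ... | false with through Pr Pz
      ...   | inj₁ le = linear 5 (λ qz ra qa az rz →
            (ra :+ az :≤ rz) ∷ (con 1 :+ qa := ra) ∷ (qz :≤ qa :+ az) ∷ []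
            ⊢ qz :+ con 1 ≤ rz :+ con 0) refl
                     (d q z) (d r a) (d q a) (d a z) (d r z) le (sym ea) (d-triangle q a z)
      ...   | inj₂ le = linear 5 (λ qz ra qa az rz →
            (ra :+ az :≤ rz) ∷ (con 1 :+ qa := ra) ∷ (qz :≤ qa :+ az) ∷ []
            ⊢ qz :+ con 1 ≤ rz :+ con 0) refl
                     (d q z) (d r c) (d q c) (d c z) (d r z) le (sym ec) (d-triangle q c z)

    Between : Fin n → Set
    Between z = d z a + d z c ≡ d a c

    between-a : Between a
    between-a rewrite d-refl a = refl

    between-c : Between c
    between-c rewrite d-refl c = trans (+-identityʳ _) (d-sym c a)

    between-step : ∀ {q r} → Between q → q ~ r → P r ≡ true → Between r
    between-step {q} {r} eq q~r Pr with d-edge (~-sym q~r) a | d-edge (~-sym q~r) c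
    ... | inj₁ ea | inj₁ ec = ⊥-elim (no-escape q~r Pr ea ec)
    ... | inj₁ ea | inj₂ ec = trans (trans (cong (_+ d r c) ea) (trans (sym (+-suc (d q a) (d r c))) (cong (d q a +_) (sym ec)))) eq
    ... | inj₂ ea | inj₁ ec = trans (trans (cong (d r a +_) ec) (trans (+-suc (d r a) (d q c)) (cong (_+ d q c) (sym ea)))) eq
    -- Coming closer to both ends at once would violate the triangle inequality for `d a c`.
    ... | inj₂ ea | inj₂ ec = contradiction
      (linear 5 (λ qa qc ra rc ac →
            (ac :≤ ra :+ rc) ∷ (qa :+ qc := ac) ∷ (con 1 :+ ra := qa) ∷ (con 1 :+ rc := qc) ∷ []
            ⊢ con 1 ≤ con 0) refl
        (d q a) (d q c) (d r a) (d r c) (d a c) (subst (λ x → d a c ≤ x + d r c) (d-sym a r) (d-triangle a r c)) eq (sym ea) (sym ec))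
      λ ()

    -- Follow a geodesic from `z` towards `a` until it meets `a` or `c`, where betweenness is
    -- trivial. On the way back each step trades distance to one end for distance to the other:
    -- gaining on both is excluded by the triangle inequality, losing on both by `no-escape`.
    interval : ∀ z → P z ≡ true → Between z
    interval z Pz = go (d z a) z refl Pz
      where
      go : ∀ k z → d z a ≡ k → P z ≡ true → Between z
      go zero    z e Pz = contradiction a∉P (true≢false (subst (λ y → P y ≡ true) (d-sep e) Pz))
      go (suc k) z e Pz with d-pred e
      ... | w , z~w , e′ with separated Pz z~w
      ...   | inj₁ Pw          = between-step (go k w e′ Pw) (~-sym z~w) Pz
      ...   | inj₂ (inj₁ refl) = between-step between-a (~-sym z~w) Pz
      ...   | inj₂ (inj₂ refl) = between-step between-c (~-sym z~w) Pz

⌊⌋-true : ∀ {P : Set} (P? : Dec P) → P → ⌊ P? ⌋ ≡ true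
⌊⌋-true (yes _) p = refl
⌊⌋-true (no ¬p) p = contradiction p ¬p

⌊⌋-false : ∀ {P : Set} (P? : Dec P) → ¬ P → ⌊ P? ⌋ ≡ false
⌊⌋-false (yes p) ¬p = contradiction p ¬p
⌊⌋-false (no _)  ¬p = refl

⌊⌋-witness : ∀ {P : Set} (P? : Dec P) → ⌊ P? ⌋ ≡ true → P
⌊⌋-witness (yes p) _ = p

same? : ∀ {n} (u v : Fin n) → u ≡ v ⊎ u ≢ v
same? u v with u ≟ v
... | yes u≡v = inj₁ u≡v
... | no  u≢v = inj₂ u≢v

-- The weight is 2 because a vertex is at distance 0 from itself, whereas distance 2 is the typical
-- value to other vertices of its layer.
spike : ∀ {n} → Fin n → Fin n → ℕ
spike u z = δ u z + δ u z

spike-same : ∀ {n} {u z : Fin n} → z ≡ u → spike u z ≡ 2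
spike-same {u = u} refl = cong₂ _+_ (δ-same u) (δ-same u)

spike-diff : ∀ {n} {u z : Fin n} → z ≢ u → spike u z ≡ 0
spike-diff z≢u = cong₂ _+_ (δ-diff z≢u) (δ-diff z≢u)

sum-spike : ∀ {n} (u : Fin n) → sum (spike u) ≡ 2
sum-spike u = trans (∑-distrib-+ (δ u) (δ u)) (cong₂ _+_ (sum-δ u) (sum-δ u))

-- Three steps of ±1 have an odd sum, hence a nonzero one. Applied to distances along a path a, x,
-- y, b.
odd-gap : ∀ {i j k l : ℕ} → i ≡ suc j ⊎ j ≡ suc i → j ≡ suc k ⊎ k ≡ suc j → k ≡ suc l ⊎ l ≡ suc k → i < l ⊎ l < i
odd-gap (inj₁ refl) (inj₁ refl) (inj₁ refl) = inj₂ (m≤n+m _ 2)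
odd-gap (inj₁ refl) (inj₁ refl) (inj₂ refl) = inj₂ ≤-refl
odd-gap (inj₁ refl) (inj₂ refl) (inj₁ refl) = inj₂ ≤-refl
odd-gap (inj₁ refl) (inj₂ refl) (inj₂ refl) = inj₁ ≤-refl
odd-gap (inj₂ refl) (inj₁ refl) (inj₁ refl) = inj₂ ≤-refl
odd-gap (inj₂ refl) (inj₁ refl) (inj₂ refl) = inj₁ ≤-refl
odd-gap (inj₂ refl) (inj₂ refl) (inj₁ refl) = inj₁ ≤-refl
odd-gap (inj₂ refl) (inj₂ refl) (inj₂ refl) = inj₁ (m≤n+m _ 2)

-- The small side of the cut and the edge that closes the cycle

module Cuts {n : ℕ} {_~_ : Fin n → Fin n → Set} (R : Regular n _~_) where
  open Regular R
  open Interval R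

  -- Moving from `u` to `v` loses 1 at every vertex of `P` and at `w`. Equal transmissions require
  -- as many gains, at most 1 each, and these occur outside `P`; the extra vertex `w` makes the
  -- inequality strict.
  behind : ∀ {u v w} (P : Fin n → Bool) → u ~ v → P w ≡ false → d v w ≡ suc (d u w) →
           (∀ z → P z ≡ true → d v z ≡ suc (d u z)) → count P < count (not ∘ P)
  behind {u} {v} {w} P u~v w∉P ew eP =
    subst (_≤ count (not ∘ P)) (trans (∑-distrib-+ (𝟙 ∘ P) (δ w)) (trans (cong (count P +_) (sum-δ w)) (+-comm (count P) 1)))
      (compare u v pointwise)
    where
    pointwise : ∀ z → d u z + (𝟙 (P z) + δ w z) ≤ d v z + 𝟙 (not (P z))
    pointwise z with z ≟ w
    ... | yes refl rewrite w∉P | ew =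
      linear 1 (λ x → [] ⊢ x :+ con 1 ≤ con 1 :+ x :+ con 1) refl (d u z)
    ... | no z≢w with P z in Pz
    ...   | true rewrite eP z Pz = linear 1 (λ x → [] ⊢ x :+ con 1 ≤ con 1 :+ x :+ con 0) refl (d u z)
    ...   | false = linear 2 (λ x y →
          (x :≤ con 1 :+ y) ∷ [] ⊢ x :+ con 0 ≤ y :+ con 1) refl
            (d u z) (d v z) (d-step u~v z)

  -- `small` counts `a` and `b` among the vertices outside `A`, so of two disjoint sides avoiding
  -- `a` and `b` one always qualifies.
  record Cut (a b : Fin n) : Set where
    field
      A        : Fin n → Bool
      piece    : Piece a b A
      small    : count A < count (not ∘ A)
      ab≡3     : d a b ≡ 3
      inside   : ∃[ z ] A z ≡ true
      outside  : ∃[ z ] (A z ≡ false × z ≢ a × z ≢ b)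

  flip-piece : ∀ {a b A} → Piece a b A → Piece b a A
  flip-piece piece = record
    { a∉P = c∉P
    ; c∉P = a∉P
    ; separated = λ Pu u~v → [ inj₁ , inj₂ ∘ [ inj₂ , inj₁ ]′ ]′ (separated Pu u~v)
    }
    where open Piece piece

  flip : ∀ {a b} → Cut a b → Cut b a
  flip {a} {b} cut = record
    { A       = A
    ; piece   = flip-piece piece
    ; small   = small
    ; ab≡3    = trans (d-sym b a) ab≡3
    ; inside  = inside
    ; outside = let z , z∉A , z≢a , z≢b = outside in z , z∉A , z≢b , z≢a
    }
    where open Cut cut

  -- Everything below is symmetric under exchanging a and b; the other half of
  -- each statement is obtained from flip cut.
  module Core {a b : Fin n} (cut : Cut a b) where
    open Cut cut public
    open Piece piece using (separated) renaming (a∉P to a∉A; c∉P to b∉A) public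

    α β : Fin n → ℕ
    α z = d a z
    β z = d b z

    β-a : β a ≡ 3
    β-a = trans (d-sym b a) ab≡3

    α≤3+β : ∀ z → α z ≤ 3 + β z
    α≤3+β z = subst (λ k → α z ≤ k + β z) ab≡3 (d-triangle a b z)

    β≤3+α : ∀ z → β z ≤ 3 + α z
    β≤3+α z = subst (λ k → β z ≤ k + α z) β-a (d-triangle b a z)

    A-sum : ∀ {z} → A z ≡ true → α z + β z ≡ 3
    A-sum {z} Az = trans (cong₂ _+_ (d-sym a z) (d-sym b z)) (trans (interval piece small z Az) ab≡3)

    A-side : ∀ {z} → A z ≡ true → (α z ≡ 1 × β z ≡ 2) ⊎ (α z ≡ 2 × β z ≡ 1)
    A-side {z} Az with α z in ea | β z in eb | A-sum Az
    ... | 0 | _ | _ = contradiction (subst (λ y → A y ≡ true) (sym (d-sep ea)) Az) (λ e → true≢false e a∉A)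
    ... | 1 | 2 | _ = inj₁ (refl , refl)
    ... | 2 | 1 | _ = inj₂ (refl , refl)
    ... | 3 | 0 | _ = contradiction (subst (λ y → A y ≡ true) (sym (d-sep eb)) Az) (λ e → true≢false e b∉A)

    -- The middle edge of a geodesic a, x, y, b through `A`.
    record Rung (x y : Fin n) : Set where
      field
        x∈A : A x ≡ true
        y∈A : A y ≡ true
        x~y : x ~ y
        αx  : α x ≡ 1
        βx  : β x ≡ 2
        αy  : α y ≡ 2
        βy  : β y ≡ 1

      a~x : a ~ x
      a~x = d≤1⇒~ (λ { refl → contradiction (trans (sym (d-refl a)) αx) λ () }) (≤-reflexive αx)

      b~y : b ~ y
      b~y = d≤1⇒~ (λ { refl → contradiction (trans (sym (d-refl b)) βy) λ () }) (≤-reflexive βy)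

    rung-from : ∀ {x} → A x ≡ true → α x ≡ 1 → ∃[ y ] Rung x y
    rung-from {x} x∈A αx with A-side x∈A
    ... | inj₂ (e , _) = contradiction (trans (sym αx) e) λ ()
    ... | inj₁ (_ , βx) with d-predʳ {b} βx
    ...   | y , x~y , βy with separated x∈A x~y
    ...     | inj₂ (inj₁ refl) = contradiction (trans (sym βy) β-a) λ ()
    ...     | inj₂ (inj₂ refl) = contradiction (trans (sym βy) (d-refl b)) λ ()
    ...     | inj₁ y∈A with A-side y∈A
    ...       | inj₁ (_ , e) = contradiction (trans (sym βy) e) λ ()
    ...       | inj₂ (αy , _) = y , record
      { x∈A = x∈A ; y∈A = y∈A ; x~y = x~y ; αx = αx ; βx = βx ; αy = αy ; βy = βy }

    -- Leaving `A` through `b` costs 2 + β z, too much when `α z < β z`; so the exit `a` decides the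
    -- distance.
    x-near : ∀ {x z} → A x ≡ true → α x ≡ 1 → A z ≡ false → α z < β z → d x z ≡ suc (α z)
    x-near {x} {z} x∈A αx z∉A α<β with A-side x∈A
    ... | inj₂ (e , _) = contradiction (trans (sym αx) e) λ ()
    ... | inj₁ (_ , βx) = ≤-antisym upper lower
      where
      upper : d x z ≤ suc (α z)
      upper = subst (λ k → d x z ≤ k + α z) (trans (d-sym x a) αx) (d-triangle x a z)
      lower : suc (α z) ≤ d x z
      lower with Piece.through piece x∈A z∉A
      ... | inj₁ le = subst (λ k → k + α z ≤ d x z) (trans (d-sym x a) αx) le
      ... | inj₂ le = ≤-trans α<β (≤-trans (n≤1+n _) (≤-trans (n≤1+n _)
                        (subst (λ k → k + β z ≤ d x z) (trans (d-sym x b) βx) le)))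

    -- From `y` the exit `b` costs 1 + β z, and the strict inequality between α and β makes even
    -- this at least 2 + α z.
    y-near : ∀ {x y z} → Rung x y → A z ≡ false → α z < β z → d y z ≡ 2 + α z
    y-near {x} {y} {z} rung z∉A α<β = ≤-antisym upper lower
      where
      open Rung rung
      upper : d y z ≤ 2 + α z
      upper = subst (λ k → d y z ≤ suc k) (x-near x∈A αx z∉A α<β) (d-step (~-sym x~y) z)
      lower : 2 + α z ≤ d y z
      lower with Piece.through piece y∈A z∉A
      ... | inj₁ le = subst (λ k → k + α z ≤ d y z) (trans (d-sym y a) αy) le
      ... | inj₂ le = ≤-trans (s≤s α<β) (subst (λ k → k + β z ≤ d y z) (trans (d-sym y b) βy) le)

    -- The edge closing the cycle on the far side of `A`. Since α and β change by at most 1 along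
    -- it, all four values are determined by t = α c: the pair (α, β) is (t, t + 1) at `c` and (t +
    -- 1, t) at `e`.
    record Crossing (c e : Fin n) : Set where
      field
        c∉A : A c ≡ false
        e∉A : A e ≡ false
        c~e : c ~ e
        c-a : α c < β c
        e-b : β e < α e

      α-e : α e ≡ suc (α c)
      α-e = ≤-antisym (subst₂ (λ x y → x ≤ suc y) (d-sym e a) (d-sym c a) (d-step (~-sym c~e) a))
        (linear 4 (λ ac bc ae be →
              (con 1 :+ ac :≤ bc) ∷ (con 1 :+ be :≤ ae) ∷ (bc :≤ con 1 :+ be) ∷ []
              ⊢ con 1 :+ ac ≤ ae) refl
          (α c) (β c) (α e) (β e) c-a e-b (subst₂ (λ x y → x ≤ suc y) (d-sym c b) (d-sym e b) (d-step c~e b)))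

      β-c : β c ≡ suc (α c)
      β-c = ≤-antisym
        (linear 4 (λ ac bc ae be →
              (con 1 :+ be :≤ ae) ∷ (bc :≤ con 1 :+ be) ∷ (ae := con 1 :+ ac) ∷ []
              ⊢ bc ≤ con 1 :+ ac) refl
          (α c) (β c) (α e) (β e) e-b (subst₂ (λ x y → x ≤ suc y) (d-sym c b) (d-sym e b) (d-step c~e b)) α-e)
        c-a

      β-e : β e ≡ α c
      β-e = ≤-antisym (≤-pred (≤-trans e-b (≤-reflexive α-e)))
        (≤-pred (≤-trans c-a (subst₂ (λ x y → x ≤ suc y) (d-sym c b) (d-sym e b) (d-step c~e b))))

    gap-from : ∀ {x y} → Rung x y → ∀ z → α z < β z ⊎ β z < α z
    gap-from rung z = odd-gap (d-edge a~x z) (d-edge x~y z) (d-edge (~-sym b~y) z)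
      where open Rung rung

    NearA : Fin n → Set
    NearA z = A z ≡ false × α z < β z

    nearA-a : NearA a
    nearA-a = a∉A , subst₂ _<_ (sym (d-refl a)) (sym β-a) (s≤s z≤n)

    nearA≢b : ∀ {z} → NearA z → z ≢ b
    nearA≢b (_ , lt) refl = contradiction (subst (α b <_) (d-refl b) lt) λ ()

    nearA-edge : ∀ {u v} → NearA u → u ~ v → A v ≡ false ⊎ u ≡ a
    nearA-edge {u} {v} near u~v with A v in Av
    ... | false = inj₁ refl
    ... | true with separated Av (~-sym u~v)
    ...   | inj₁ Au        = contradiction (proj₁ near) (true≢false Au)
    ...   | inj₂ (inj₁ e)  = inj₂ e
    ...   | inj₂ (inj₂ e)  = contradiction e (nearA≢b near)

    rung-exists : ∃[ x ] ∃[ y ] Rung x y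
    rung-exists with inside
    ... | z , z∈A with A-side z∈A
    ...   | inj₁ (αz , _) = z , rung-from z∈A αz
    ...   | inj₂ (αz , βz) with d-predʳ {a} αz
    ...     | x , z~x , αx with separated z∈A z~x
    ...       | inj₂ (inj₁ refl) = contradiction (trans (sym αx) (d-refl a)) λ ()
    ...       | inj₂ (inj₂ refl) = contradiction (trans (sym αx) ab≡3) λ ()
    ...       | inj₁ x∈A with A-side x∈A
    ...         | inj₂ (e , _)  = contradiction (trans (sym αx) e) λ ()
    ...         | inj₁ (_ , βx) = x , z , record
      { x∈A = x∈A ; y∈A = z∈A ; x~y = ~-sym z~x ; αx = αx ; βx = βx ; αy = αz ; βy = βz }

    gap : ∀ z → α z < β z ⊎ β z < α z
    gap = gap-from (proj₂ (proj₂ rung-exists))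

    -- Without a crossing, the vertices nearer to `a`, apart from `a` itself, form a piece of the
    -- cut, small by comparison along the edge a x. By `interval` such a vertex has α = 1 and β = 2.
    -- Its neighbour towards `b` has β = 1 and is again nearer to `a`, so it equals `a`; but β a =
    -- 3.
    module NoCrossing (none : ∀ {c e} → ¬ Crossing c e) where

      U? : ∀ z → Dec (A z ≡ false × α z < β z × z ≢ a)
      U? z = (A z ≟ᵇ false) ×-dec (α z <? β z) ×-dec ¬? (z ≟ a)

      U : Fin n → Bool
      U z = ⌊ U? z ⌋

      stays : ∀ {u v} → NearA u → u ≢ a → u ~ v → NearA v
      stays {u} {v} near u≢a u~v with nearA-edge near u~v
      ... | inj₂ u≡a = contradiction u≡a u≢a
      ... | inj₁ v∉A with gap v
      ...   | inj₁ lt = v∉A , lt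
      ...   | inj₂ gt = ⊥-elim (none (record
                { c∉A = proj₁ near ; e∉A = v∉A ; c~e = u~v ; c-a = proj₂ near ; e-b = gt }))

      U-piece : Piece a b U
      U-piece = record
        { a∉P = ⌊⌋-false (U? a) (λ (_ , _ , a≢a) → a≢a refl)
        ; c∉P = ⌊⌋-false (U? b) (λ (b∉A , lt , _) → nearA≢b (b∉A , lt) refl)
        ; separated = λ {u} {v} Uu u~v →
            let u∉A , lt , u≢a = ⌊⌋-witness (U? u) Uu
                v∉A , lt′ = stays (u∉A , lt) u≢a u~v
            in case-a v λ v≢a → ⌊⌋-true (U? v) (v∉A , lt′ , v≢a)
        }
        where
        case-a : ∀ v → (v ≢ a → U v ≡ true) → U v ≡ true ⊎ v ≡ a ⊎ v ≡ b
        case-a v f with v ≟ a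
        ... | yes e = inj₂ (inj₁ e)
        ... | no ne = inj₁ (f ne)

      U-small : count U < count (not ∘ U)
      U-small = let x , y , rung = rung-exists
                    open Rung rung
                    near : ∀ z → NearA z → d x z ≡ suc (α z)
                    near z (z∉A , lt) = x-near x∈A αx z∉A lt
                in behind U a~x (Piece.a∉P U-piece) (near a nearA-a)
                     (λ z Uz → let z∉A , lt , _ = ⌊⌋-witness (U? z) Uz in near z (z∉A , lt))

      impossible : ∀ {z} → NearA z → z ≢ a → ⊥
      impossible {z} near z≢a with d-predʳ {b} βz
        where
        sum≡3 : α z + β z ≡ 3
        sum≡3 = trans (cong₂ _+_ (d-sym a z) (d-sym b z))
                  (trans (interval U-piece U-small z (⌊⌋-true (U? z) (proj₁ near , proj₂ near , z≢a))) ab≡3)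
        βz : β z ≡ 2
        βz with α z | d-pos (z≢a ∘ sym) | β z | sum≡3 | proj₂ near
        ... | 1 | _ | 2 | _ | _ = refl
        ... | 2 | _ | 1 | _ | s≤s ()
        ... | 3 | _ | 0 | _ | ()
      ... | w , z~w , βw with stays near z≢a z~w
      ...   | w∉A , lt = contradiction (trans (sym βw) (trans (cong β w≡a) β-a)) λ ()
        where
        w≡a : w ≡ a
        w≡a = sym (d-sep (≤-antisym (≤-pred (subst (α w <_) βw lt)) z≤n))

  flip-rung : ∀ {a b} (cut : Cut a b) {x y} → Core.Rung cut x y → Core.Rung (flip cut) y x
  flip-rung cut rung = record
    { x∈A = y∈A ; y∈A = x∈A ; x~y = ~-sym x~y ; αx = βy ; βx = αy ; αy = βx ; βy = αx }
    where open Core.Rung rung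

  flip-crossing : ∀ {a b} (cut : Cut a b) {c e} → Core.Crossing cut c e → Core.Crossing (flip cut) e c
  flip-crossing cut crossing = record
    { c∉A = e∉A ; e∉A = c∉A ; c~e = ~-sym c~e ; c-a = e-b ; e-b = c-a }
    where open Core.Crossing crossing

  unflip-rung : ∀ {a b} (cut : Cut a b) {x y} → Core.Rung (flip cut) y x → Core.Rung cut x y
  unflip-rung cut rung = record
    { x∈A = y∈A ; y∈A = x∈A ; x~y = ~-sym x~y ; αx = βy ; βx = αy ; αy = βx ; βy = αx }
    where open Core.Rung rung

  unflip-crossing : ∀ {a b} (cut : Cut a b) {c e} → Core.Crossing (flip cut) e c → Core.Crossing cut c e
  unflip-crossing cut crossing = record
    { c∉A = e∉A ; e∉A = c∉A ; c~e = ~-sym c~e ; c-a = e-b ; e-b = c-a }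
    where open Core.Crossing crossing

  crossing-exists : ∀ {a b} (cut : Cut a b) → ∃[ c ] ∃[ e ] Core.Crossing cut c e
  crossing-exists {a} {b} cut
    -- The relation `_~_` is abstract, so the search tests adjacency as distance 1.
    with any? (λ c → any? (λ e → (A c ≟ᵇ false) ×-dec (A e ≟ᵇ false) ×-dec (d c e ≟ℕ 1) ×-dec (α c <? β c) ×-dec (β e <? α e)))
    where open Core cut
  ... | yes (c , e , c∉A , e∉A , ce≡1 , lt , gt) = c , e , record
    { c∉A = c∉A ; e∉A = e∉A ; c~e = d≤1⇒~ (λ { refl → <-asym lt gt }) (≤-reflexive ce≡1) ; c-a = lt ; e-b = gt }
  ... | no ¬crossing = ⊥-elim (absurd (gap z))
    where
    open Core cut
    z   = proj₁ outside
    z∉A = proj₁ (proj₂ outside)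
    none : ∀ {c e} → ¬ Crossing c e
    none {c} {e} cr = ¬crossing (c , e , c∉A , e∉A , ≤-antisym (~⇒d≤1 c~e) (d-pos λ { refl → <-asym c-a e-b }) , c-a , e-b)
      where open Crossing cr
    absurd : ¬ (α z < β z ⊎ β z < α z)
    absurd (inj₁ lt) = NoCrossing.impossible none (z∉A , lt) (proj₁ (proj₂ (proj₂ outside)))
    absurd (inj₂ gt) = Core.NoCrossing.impossible (flip cut) (none ∘ unflip-crossing cut) (z∉A , gt) (proj₂ (proj₂ (proj₂ outside)))

  -- With a rung x y and a crossing c e, compare T(a) + T(b) with T(x) + T(y).
  module Balance {a b} (cut : Cut a b) {c e} (crossing : Core.Crossing cut c e) where
    open Core cut
    open Crossing crossing

    module F = Core (flip cut)

    -- By `d-parity`, adjacent vertices cannot be equally far from `a`.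
    off-x : ∀ {x z} → A x ≡ true → α x ≡ 1 → α z ≡ 1 → z ≢ x → 2 ≤ d x z
    off-x {x} {z} x∈A αx αz z≢x with 2 ≤? d x z
    ... | yes p = p
    ... | no ¬p = contradiction (trans (d-sym x a) (trans (trans αx (sym αz)) (d-sym a z)))
                    (d-parity (d≤1⇒~ (z≢x ∘ sym) (≤-pred (≰⇒> ¬p))) a)

    module _ {x y} (rung : Rung x y) where
      open Rung rung

      -- The bound α + β ≤ d x + d y fails by 2 at `x` and at `y`, where one distance is 0, and has
      -- slack 2 at `c` and at `e`. Both corrections have mass 4.
      excess gain : Fin n → ℕ
      excess z = spike c z + spike e z
      gain   z = spike x z + spike y z

      c≢e : c ≢ e
      c≢e refl = <-asym c-a e-b

      excess-off : ∀ {z} → z ≢ c → z ≢ e → excess z ≡ 0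
      excess-off z≢c z≢e = cong₂ _+_ (spike-diff z≢c) (spike-diff z≢e)

      rung-sum : ∀ {z} → A z ≡ true → z ≢ x → z ≢ y → 3 ≤ d x z + d y z
      rung-sum {z} z∈A z≢x z≢y with A-side z∈A
      ... | inj₁ (αz , _) = +-mono-≤ (off-x x∈A αx αz z≢x) (d-pos (z≢y ∘ sym))
      ... | inj₂ (_ , βz) = +-mono-≤ (d-pos (z≢x ∘ sym)) off-y
        where
        off-y : 2 ≤ d y z
        off-y with 2 ≤? d y z
        ... | yes p = p
        ... | no ¬p = contradiction (trans (d-sym y b) (trans (trans βy (sym βz)) (d-sym b z)))
                        (d-parity (d≤1⇒~ (z≢y ∘ sym) (≤-pred (≰⇒> ¬p))) b)

      near-b : ∀ {z} → A z ≡ false → β z < α z → d y z ≡ suc (β z) × d x z ≡ 2 + β z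
      near-b z∉A gt = F.x-near y∈A βy z∉A gt , F.y-near (flip-rung cut rung) z∉A gt

      pointwise : ∀ z → α z + β z + excess z ≤ d x z + d y z + gain z
      pointwise z with bool-cases (A z)
      ... | inj₁ z∈A = subst (λ k → k ≤ d x z + d y z + gain z)
              (sym (trans (cong₂ _+_ (A-sum z∈A) (excess-off {z} (λ { refl → true≢false z∈A c∉A }) (λ { refl → true≢false z∈A e∉A }))) refl))
              inA
        where
        inA : 3 ≤ d x z + d y z + gain z
        inA with same? z x
        ... | inj₁ refl = linear 3 (λ p q r → (con 1 :≤ q) ∷ (con 2 :≤ r) ∷ [] ⊢ con 3 ≤ p :+ q :+ r) refl
                (d x z) (d y z) (gain z) (d-pos λ { refl → contradiction (trans (sym αy) αx) λ () })
                (≤-trans (≤-reflexive (sym (spike-same {u = x} refl))) (m≤m+n _ _))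
        ... | inj₂ z≢x with same? z y
        ...   | inj₁ refl = linear 3 (λ p q r → (con 1 :≤ p) ∷ (con 2 :≤ r) ∷ [] ⊢ con 3 ≤ p :+ q :+ r) refl
                (d x z) (d y z) (gain z) (d-pos λ { refl → contradiction (trans (sym αy) αx) λ () })
                (≤-trans (≤-reflexive (sym (spike-same {u = y} refl))) (m≤n+m _ (spike x z)))
        ...   | inj₂ z≢y = ≤-trans (rung-sum z∈A z≢x z≢y) (m≤m+n _ _)
      ... | inj₂ z∉A = ≤-trans out (m≤m+n _ _)
        where
        out : α z + β z + excess z ≤ d x z + d y z
        out with same? z c
        ... | inj₁ refl rewrite x-near x∈A αx z∉A c-a | y-near rung z∉A c-a | spike-same {u = c} refl | spike-diff c≢e | β-c =
          linear 1 (λ p → [] ⊢ p :+ (con 1 :+ p) :+ con 2 ≤ con 1 :+ p :+ (con 2 :+ p)) refl (α c)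
        ... | inj₂ z≢c with same? z e
        ...   | inj₁ refl rewrite proj₁ (near-b z∉A e-b) | proj₂ (near-b z∉A e-b) | spike-same {u = e} refl | spike-diff (c≢e ∘ sym) | α-e | β-e =
          linear 1 (λ p → [] ⊢ con 1 :+ p :+ p :+ con 2 ≤ con 2 :+ p :+ (con 1 :+ p)) refl (α c)
        ...   | inj₂ z≢e rewrite excess-off z≢c z≢e with gap z
        ...     | inj₁ lt rewrite x-near x∈A αx z∉A lt | y-near rung z∉A lt =
          linear 2 (λ p q →
                (q :≤ con 3 :+ p) ∷ [] ⊢ p :+ q :+ con 0 ≤ con 1 :+ p :+ (con 2 :+ p)) refl
                  (α z) (β z) (β≤3+α z)
        ...     | inj₂ gt rewrite proj₁ (near-b z∉A gt) | proj₂ (near-b z∉A gt) =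
          linear 2 (λ p q →
                (p :≤ con 3 :+ q) ∷ [] ⊢ p :+ q :+ con 0 ≤ con 2 :+ q :+ (con 1 :+ q)) refl
                  (α z) (β z) (α≤3+β z)

      tight : ∀ z → d x z + d y z + gain z ≤ α z + β z + excess z
      tight = squeeze a b x y {excess} {gain} (trans (four c e) (sym (four x y))) pointwise
        where
        four : ∀ u v → sum (λ z → spike u z + spike v z) ≡ 4
        four u v = trans (∑-distrib-+ (spike u) (spike v)) (cong₂ _+_ (sum-spike u) (sum-spike v))

      -- For z ≠ x the total `d x z + d y z` is at most 3 by tightness, and parity makes `d x z` at
      -- least 2.
      complete-at : ∀ {z} → A z ≡ true → α z ≡ 1 → z ~ y
      complete-at {z} z∈A αz with z ≟ x
      ... | yes refl = x~y
      ... | no z≢x = ~-sym (d≤1⇒~ (λ { refl → contradiction (trans (sym αy) αz) λ () })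
              (linear 5 (λ p q g s ex →
                    (p :+ q :+ g :≤ s :+ ex) ∷ (s := con 3) ∷ (ex := con 0) ∷ (con 2 :≤ p) ∷ []
                    ⊢ q ≤ con 1) refl
                (d x z) (d y z) (gain z) (α z + β z) (excess z) (tight z) (A-sum z∈A)
                (excess-off {z} (λ { refl → true≢false z∈A c∉A }) (λ { refl → true≢false z∈A e∉A }))
                (off-x x∈A αx αz z≢x)))

      -- On the side of `a` the sum `d x z + d y z` is 3 + 2 α z, so tightness forces β z = 3 + α z,
      -- except at `c`, where the spike has used up the slack.
      unique-at : ∀ {z} → NearA z → β z ≡ suc (α z) → z ≡ c
      unique-at {z} (z∉A , lt) βz with z ≟ c
      ... | yes z≡c = z≡c
      ... | no z≢c = contradiction
              (linear 6 (λ p q g s t ex →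
                    (p :+ q :+ g :≤ s :+ t :+ ex) ∷ (t := con 1 :+ s) ∷ (ex := con 0) ∷ (con 1 :+ s := p) ∷ (con 2 :+ s := q) ∷ []
                    ⊢ con 2 ≤ con 0) refl
                (d x z) (d y z) (gain z) (α z) (β z) (excess z) (tight z) βz
                (excess-off z≢c (λ { refl → <-asym lt e-b })) (sym (x-near x∈A αx z∉A lt)) (sym (y-near rung z∉A lt)))
              λ ()

    complete : ∀ {x y} → A x ≡ true → α x ≡ 1 → A y ≡ true → α y ≡ 2 → x ~ y
    complete {x} {y} x∈A αx y∈A αy with A-side y∈A
    ... | inj₁ (αy′ , _) = contradiction (trans (sym αy) αy′) λ ()
    -- In the flipped cut every such `y` starts a rung, so `y` may be arbitrary.
    ... | inj₂ (_ , βy) with F.rung-from y∈A βy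
    ...   | x′ , rung = complete-at (unflip-rung cut rung) x∈A αx

    unique : ∀ {z} → NearA z → β z ≡ suc (α z) → z ≡ c
    unique = unique-at (proj₂ (proj₂ rung-exists))

suc-form : ∀ {k} → 1 ≤ k → ∃[ j ] k ≡ suc j
suc-form {suc j} _ = j , refl

-- The two halves outside the small side

module Halves {n : ℕ} {_~_ : Fin n → Fin n → Set} (R : Regular n _~_) where
  open Regular R
  open Interval R
  open Cuts R

  module Half {a b} (cut : Cut a b) {c e} (crossing : Core.Crossing cut c e) where
    open Core cut
    open Crossing crossing
    open Balance cut crossing

    nearA-c : NearA c
    nearA-c = c∉A , c-a

    c≢a : c ≢ a
    c≢a refl = contradiction (trans (sym β-a) (trans β-c (cong suc (d-refl a)))) λ ()

    data Neighbour (u v : Fin n) : Set where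
      stay  : NearA v → Neighbour u v
      enter : A v ≡ true → u ≡ a → Neighbour u v
      cross : u ≡ c → Crossing u v → Neighbour u v

    -- A crossing starts at a vertex with β = 1 + α, and `unique` leaves only `c` for this. Thus the
    -- vertices nearer to `a` are left only through `a` and `c`.
    neighbour : ∀ {u v} → NearA u → u ~ v → Neighbour u v
    neighbour {u} {v} near u~v with bool-cases (A v)
    ... | inj₁ v∈A = enter v∈A ([ (λ v∉A → contradiction v∉A (true≢false v∈A)) , id ]′ (nearA-edge near u~v))
    ... | inj₂ v∉A with gap v
    ...   | inj₁ lt = stay (v∉A , lt)
    ...   | inj₂ gt = cross (unique near (Crossing.β-c cr)) cr
      where
      cr : Crossing u v
      cr = record { c∉A = proj₁ near ; e∉A = v∉A ; c~e = u~v ; c-a = proj₂ near ; e-b = gt }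

    Q? : ∀ z → Dec (A z ≡ false × α z < β z × z ≢ a × z ≢ c)
    Q? z = (A z ≟ᵇ false) ×-dec (α z <? β z) ×-dec ¬? (z ≟ a) ×-dec ¬? (z ≟ c)

    Q : Fin n → Bool
    Q z = ⌊ Q? z ⌋

    Q-intro : ∀ {z} → NearA z → Q z ≡ true ⊎ z ≡ a ⊎ z ≡ c
    Q-intro {z} (z∉A , lt) with same? z a | same? z c
    ... | inj₁ z≡a | _        = inj₂ (inj₁ z≡a)
    ... | inj₂ _   | inj₁ z≡c = inj₂ (inj₂ z≡c)
    ... | inj₂ z≢a | inj₂ z≢c = inj₁ (⌊⌋-true (Q? z) (z∉A , lt , z≢a , z≢c))

    Q-piece : Piece a c Q
    Q-piece = record
      { a∉P = ⌊⌋-false (Q? a) (λ (_ , _ , a≢a , _) → a≢a refl)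
      ; c∉P = ⌊⌋-false (Q? c) (λ (_ , _ , _ , c≢c) → c≢c refl)
      ; separated = sep
      }
      where
      sep : ∀ {u v} → Q u ≡ true → u ~ v → Q v ≡ true ⊎ v ≡ a ⊎ v ≡ c
      sep {u} Qu u~v with ⌊⌋-witness (Q? u) Qu
      ... | u∉A , lt , u≢a , u≢c with neighbour (u∉A , lt) u~v
      ...   | stay near     = Q-intro near
      ...   | enter _ u≡a   = contradiction u≡a u≢a
      ...   | cross u≡c _   = contradiction u≡c u≢c

    -- A rung is the edge to compare along: all vertices nearer to `a` are one step farther from `y`
    -- than from `x`, and `a` itself is the extra vertex outside `Q`.
    Q-small : count Q < count (not ∘ Q)
    Q-small with rung-exists
    ... | x , y , rung = behind Q x~y (Piece.a∉P Q-piece) (away a nearA-a)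
            (λ z Qz → let z∉A , lt , _ = ⌊⌋-witness (Q? z) Qz in away z (z∉A , lt))
      where
      open Rung rung
      away : ∀ z → NearA z → d y z ≡ suc (d x z)
      away z (z∉A , lt) = trans (y-near rung z∉A lt) (cong suc (sym (x-near x∈A αx z∉A lt)))

    on-geodesic : ∀ {z} → NearA z → α z + d z c ≡ α c
    on-geodesic {z} near with Q-intro near
    ... | inj₁ Qz          = trans (cong (_+ d z c) (d-sym a z)) (interval Q-piece Q-small z Qz)
    ... | inj₂ (inj₁ refl) = cong (_+ d z c) (d-refl z)
    ... | inj₂ (inj₂ refl) = trans (cong (α z +_) (d-refl z)) (+-identityʳ _)

    α≤t : ∀ {z} → NearA z → α z ≤ α c
    α≤t {z} near = subst (α z ≤_) (on-geodesic near) (m≤m+n _ _)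

    α≡t⇒c : ∀ {z} → NearA z → α z ≡ α c → z ≡ c
    α≡t⇒c {z} near αz = d-sep (≤-antisym
      (linear 3 (λ p q r →
            (p :+ q := r) ∷ (r := p) ∷ [] ⊢ q ≤ con 0) refl
              (α z) (d z c) (α c) (on-geodesic near) (sym αz)) z≤n)

    toward-a : ∀ {z} → NearA z → z ≢ a → ∃[ w ] (z ~ w × NearA w × α z ≡ suc (α w))
    toward-a {z} near z≢a with suc-form (d-pos (z≢a ∘ sym))
    ... | k , αz with d-predʳ {a} αz
    ...   | w , z~w , αw with neighbour near z~w
    ...     | stay near′  = w , z~w , near′ , trans αz (cong suc (sym αw))
    ...     | enter _ z≡a = contradiction z≡a z≢a
    ...     | cross _ cr  = contradiction (≤-trans (n≤1+n _) (≤-reflexive (trans (cong suc (sym αz)) (trans (sym (Crossing.α-e cr)) αw)))) 1+n≰n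

    -- With `toward-a` this supplies neighbours in both adjacent layers. The step towards `c` cannot
    -- enter `A`, whose vertices next to `a` are farther from `c`; and by the triangle inequality it
    -- cannot approach `a` as well.
    toward-c : ∀ {z} → NearA z → z ≢ c → ∃[ w ] (z ~ w × NearA w × α w ≡ suc (α z))
    toward-c {z} near z≢c with suc-form (d-pos z≢c)
    ... | k , zc with d-pred {z} {c} zc
    ...   | w , z~w , wc with neighbour near z~w
    ...     | cross z≡c _ = contradiction z≡c z≢c
    ...     | enter w∈A refl = contradiction
      (linear 3 (λ k t wc → (con 1 :+ k := t) ∷ (wc := k) ∷ (con 1 :+ t := wc) ∷ [] ⊢ con 1 ≤ con 0) refl
        k (α c) (d w c) (sym zc) wc (sym (x-near w∈A αw c∉A c-a)))
      λ ()
      where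
      αw : α w ≡ 1
      αw = ≤-antisym (~⇒d≤1 z~w) (d-pos λ { refl → true≢false w∈A a∉A })
    ...     | stay near′ with d-edgeʳ z~w a
    ...       | inj₂ up   = w , z~w , near′ , up
    ...       | inj₁ down = contradiction
      (linear 6 (λ k t wc zc az aw →
            (az :+ zc := t) ∷ (con 1 :+ k := zc) ∷ (wc := k) ∷ (t :≤ aw :+ wc) ∷ (con 1 :+ aw := az) ∷ []
            ⊢ con 1 ≤ con 0) refl
        k (α c) (d w c) (d z c) (α z) (α w) (on-geodesic near) (sym zc) wc (d-triangle a w c) (sym down))
      λ ()

-- Cyclic layers

Next : ℕ → ℕ → ℕ → Set
Next N i j = j ≡ suc i ⊎ (suc i ≡ N × j ≡ 0)

-- renumbers the positions so that position 1 becomes position 0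
rot : ℕ → ℕ → ℕ
rot N zero    = N ∸ 1
rot N (suc i) = i

rots : ℕ → ℕ → ℕ → ℕ
rots N zero    i = i
rots N (suc k) i = rot N (rots N k i)

rot-< : ∀ {N i} → i < N → rot N i < N
rot-< {suc N} {zero}  _   = ≤-refl
rot-< {N}     {suc i} i<N = <⇒≤ i<N

rot-Next : ∀ {N i j} → i < N → 2 ≤ N → Next N i j → Next N (rot N i) (rot N j)
rot-Next {suc zero} _ (s≤s ()) _
rot-Next {suc (suc N)} {zero}  _ _ (inj₁ refl)          = inj₂ (refl , refl)
rot-Next               {i = suc i} _ _ (inj₁ refl)      = inj₁ refl
rot-Next {suc (suc N)} {zero}  _ _ (inj₂ (() , _))
rot-Next               {i = suc i} _ _ (inj₂ (refl , refl)) = inj₁ refl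

rot-zero : ∀ {N i} → 2 ≤ N → rot N i ≡ 0 → i ≡ 1
rot-zero {suc zero}    {zero}  (s≤s ()) _
rot-zero {suc (suc N)} {zero}  _ ()
rot-zero {i = suc i}           _ e = cong suc e

-- The two alternatives say that the result is i - k or N + i - k: reduction modulo N without
-- subtraction.
rots-value : ∀ N k i → i < N → k ≤ N →
             (i ≡ k + rots N k i) ⊎ (i < k × N + i ≡ k + rots N k i)
rots-value N zero    i i<N k≤N = inj₁ refl
rots-value N (suc k) i i<N k<N with rots N k i in e | rots-value N k i i<N (<⇒≤ k<N)
rots-value (suc N) (suc k) i i<N k<N | zero  | inj₁ v = inj₂ (s≤s (≤-reflexive i≡k) , cong suc (trans (+-comm N i) (cong (_+ N) i≡k)))
  where
  i≡k : i ≡ k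
  i≡k = trans v (+-identityʳ k)
... | suc r | inj₁ v = inj₁ (trans v (+-suc k r))
... | zero  | inj₂ (lt , v) = contradiction
  (linear 3 (λ N k i → (con 1 :+ k :≤ N) ∷ (N :+ i := k :+ con 0) ∷ [] ⊢ con 1 ≤ con 0) refl N k i k<N v) λ ()
... | suc r | inj₂ (lt , v) = inj₂ (m≤n⇒m≤1+n lt , trans v (+-suc k r))

module Layers {n : ℕ} {_~_ : Fin n → Fin n → Set} (R : Regular n _~_) (h : ℕ) (2≤h : 2 ≤ h) where
  open Regular R

  N : ℕ
  N = h + h

  2≤N : 2 ≤ N
  2≤N = ≤-trans 2≤h (m≤m+n h h)

  -- A map to the cycle of length N that sends edges to edges and is locally onto. Neither layer
  -- sizes nor complete joins are assumed; both are to be derived.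
  record Layering : Set where
    field
      pos         : Fin n → ℕ
      pos<N       : ∀ z → pos z < N
      consecutive : ∀ {u v} → u ~ v → Next N (pos u) (pos v) ⊎ Next N (pos v) (pos u)
      next        : ∀ u → ∃[ v ] (u ~ v × Next N (pos u) (pos v))
      prev        : ∀ u → ∃[ v ] (u ~ v × Next N (pos v) (pos u))

  rotate : Layering → Layering
  rotate L = record
    { pos         = λ z → rot N (pos z)
    ; pos<N       = λ z → rot-< (pos<N z)
    ; consecutive = λ {u} {v} u~v → [ inj₁ ∘ rot-Next (pos<N u) 2≤N , inj₂ ∘ rot-Next (pos<N v) 2≤N ]′ (consecutive u~v)
    ; next        = λ u → let v , u~v , nx = next u in v , u~v , rot-Next (pos<N u) 2≤N nx
    ; prev        = λ u → let v , u~v , nx = prev u in v , u~v , rot-Next (pos<N v) 2≤N nx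
    }
    where open Layering L

  rotated : ℕ → Layering → Layering
  rotated zero    L = L
  rotated (suc k) L = rotate (rotated k L)

  Single : (Fin n → ℕ) → ℕ → Set
  Single pos j = ∀ {z z′} → pos z ≡ j → pos z′ ≡ j → z ≡ z′

  -- layer 0 realises all cyclic distances, and 2 within itself
  record Flat (pos : Fin n → ℕ) : Set where
    field
      same  : ∀ {u z} → pos u ≡ 0 → pos z ≡ 0 → d u z ≤ 2
      ahead : ∀ {u z} → pos u ≡ 0 → 1 ≤ pos z → pos z ≤ h → d u z ≤ pos z
      back  : ∀ {u z} → pos u ≡ 0 → h ≤ pos z → d u z + pos z ≤ N

  module Positions (L : Layering) where
    open Layering L

    -- k is at least the cyclic distance of i and j, stated without subtraction
    Far : ℕ → ℕ → ℕ → Set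
    Far i j k = (j ≤ i + k × i ≤ j + k) ⊎ N + i ≤ j + k ⊎ N + j ≤ i + k

    far-step : ∀ {i j j′ k} → i < N → Far i j k → Next N j j′ ⊎ Next N j′ j → Far i j′ (suc k)
    far-step {i} {j} {_} {k} _ (inj₁ (p , q)) (inj₁ (inj₁ refl)) = inj₁
      ( linear 3 (λ i j k → (j :≤ i :+ k) ∷ [] ⊢ con 1 :+ j ≤ i :+ (con 1 :+ k)) refl i j k p
      , linear 3 (λ i j k → (i :≤ j :+ k) ∷ [] ⊢ i ≤ con 1 :+ j :+ (con 1 :+ k)) refl i j k q )
    far-step {i} {j} {_} {k} _ (inj₂ (inj₁ p)) (inj₁ (inj₁ refl)) = inj₂ (inj₁
      (linear 4 (λ N i j k → (N :+ i :≤ j :+ k) ∷ [] ⊢ N :+ i ≤ con 1 :+ j :+ (con 1 :+ k)) refl N i j k p))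
    far-step {i} {j} {_} {k} _ (inj₂ (inj₂ p)) (inj₁ (inj₁ refl)) = inj₂ (inj₂
      (linear 4 (λ N i j k → (N :+ j :≤ i :+ k) ∷ [] ⊢ N :+ (con 1 :+ j) ≤ i :+ (con 1 :+ k)) refl N i j k p))
    far-step {i} {_} {j} {k} _ (inj₁ (p , q)) (inj₂ (inj₁ refl)) = inj₁
      ( linear 3 (λ i j k → (con 1 :+ j :≤ i :+ k) ∷ [] ⊢ j ≤ i :+ (con 1 :+ k)) refl i j k p
      , linear 3 (λ i j k → (i :≤ con 1 :+ j :+ k) ∷ [] ⊢ i ≤ j :+ (con 1 :+ k)) refl i j k q )
    far-step {i} {_} {j} {k} _ (inj₂ (inj₁ p)) (inj₂ (inj₁ refl)) = inj₂ (inj₁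
      (linear 4 (λ N i j k → (N :+ i :≤ con 1 :+ j :+ k) ∷ [] ⊢ N :+ i ≤ j :+ (con 1 :+ k)) refl N i j k p))
    far-step {i} {_} {j} {k} _ (inj₂ (inj₂ p)) (inj₂ (inj₁ refl)) = inj₂ (inj₂
      (linear 4 (λ N i j k → (N :+ (con 1 :+ j) :≤ i :+ k) ∷ [] ⊢ N :+ j ≤ i :+ (con 1 :+ k)) refl N i j k p))
    far-step {i} {j} {_} {k} _ (inj₁ (p , q)) (inj₁ (inj₂ (e , refl))) = inj₂ (inj₂
      (linear 4 (λ N i j k →
            (N := con 1 :+ j) ∷ (j :≤ i :+ k) ∷ [] ⊢ N :+ con 0 ≤ i :+ (con 1 :+ k)) refl
              N i j k (sym e) p))
    far-step {i} {j} {_} {k} _ (inj₂ (inj₁ p)) (inj₁ (inj₂ (e , refl))) = inj₁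
      ( z≤n
      , linear 4 (λ N i j k →
            (con 1 :+ j := N) ∷ (N :+ i :≤ j :+ k) ∷ [] ⊢ i ≤ con 0 :+ (con 1 :+ k)) refl
              N i j k e p )
    far-step {i} {j} {_} {k} _ (inj₂ (inj₂ p)) (inj₁ (inj₂ (e , refl))) = inj₂ (inj₂
      (linear 4 (λ N i j k → (N :+ j :≤ i :+ k) ∷ [] ⊢ N :+ con 0 ≤ i :+ (con 1 :+ k)) refl N i j k p))
    far-step {i} {_} {j} {k} _ (inj₁ (p , q)) (inj₂ (inj₂ (e , refl))) = inj₂ (inj₁
      (linear 4 (λ N i j k →
            (N := con 1 :+ j) ∷ (i :≤ con 0 :+ k) ∷ [] ⊢ N :+ i ≤ j :+ (con 1 :+ k)) refl
              N i j k (sym e) q))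
    far-step {i} {_} {j} {k} _ (inj₂ (inj₁ p)) (inj₂ (inj₂ (e , refl))) = inj₂ (inj₁
      (linear 4 (λ N i j k → (N :+ i :≤ con 0 :+ k) ∷ [] ⊢ N :+ i ≤ j :+ (con 1 :+ k)) refl N i j k p))
    far-step {i} {_} {j} {k} i<N (inj₂ (inj₂ p)) (inj₂ (inj₂ (e , refl))) = inj₁
      ( linear 4 (λ N i j k →
            (con 1 :+ j := N) ∷ (N :+ con 0 :≤ i :+ k) ∷ [] ⊢ j ≤ i :+ (con 1 :+ k)) refl
              N i j k e p
      , linear 4 (λ N i j k →
            (N := con 1 :+ j) ∷ (con 1 :+ i :≤ N) ∷ [] ⊢ i ≤ j :+ (con 1 :+ k)) refl
              N i j k (sym e) i<N )

    far : ∀ u z → Far (pos u) (pos z) (d u z)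
    far u z = go (d u z) z refl
      where
      go : ∀ k z → d u z ≡ k → Far (pos u) (pos z) k
      go zero    z e rewrite d-sep e = inj₁ (m≤m+n _ 0 , m≤m+n _ 0)
      go (suc k) z e = let w , z~w , e′ = d-predʳ e in
        far-step (pos<N u) (go k w e′) (consecutive (~-sym z~w))

    apart : ∀ {u z} → pos u ≡ pos z → u ≢ z → 2 ≤ d u z
    apart {u} {z} e u≢z with 2 ≤? d u z
    ... | yes p = p
    ... | no ¬p = ⊥-elim (twice (consecutive (d≤1⇒~ u≢z (≤-pred (≰⇒> ¬p)))))
      where
      irr : ∀ {i j} → i ≡ j → ¬ Next N i j
      irr refl (inj₁ p)          = 1+n≰n (≤-reflexive (sym p))
      irr refl (inj₂ (p , refl)) = contradiction 2≤N (<⇒≱ (≤-reflexive (cong suc (sym p))))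
      twice : ¬ (Next N (pos u) (pos z) ⊎ Next N (pos z) (pos u))
      twice (inj₁ p) = irr e p
      twice (inj₂ p) = irr (sym e) p

    climb : ∀ k u → pos u + k < N → ∃[ w ] (pos w ≡ pos u + k × d u w ≤ k)
    climb zero    u lt = u , sym (+-identityʳ _) , ≤-reflexive (d-refl u)
    climb (suc k) u lt with next u
    ... | v , u~v , inj₂ (e , _) = contradiction
      (linear 3 (λ p k N →
            (con 1 :+ (p :+ (con 1 :+ k)) :≤ N) ∷ (N := con 1 :+ p) ∷ [] ⊢ con 1 ≤ con 0) refl
              (pos u) k N lt (sym e)) λ ()
    ... | v , u~v , inj₁ e with climb k v (subst (_< N) (trans (+-suc _ k) (cong (_+ k) (sym e))) lt)
    ...   | w , pw , le = w , trans pw (trans (cong (_+ k) e) (sym (+-suc _ k))) , ≤-trans (d-step u~v w) (s≤s le)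

    descend : ∀ k u → k ≤ pos u → ∃[ w ] (pos w + k ≡ pos u × d u w ≤ k)
    descend zero    u le = u , +-identityʳ _ , ≤-reflexive (d-refl u)
    descend (suc k) u le with prev u
    ... | v , u~v , inj₂ (_ , e) = contradiction (subst (suc k ≤_) e le) λ ()
    ... | v , u~v , inj₁ e with descend k v (≤-pred (subst (suc k ≤_) e le))
    ...   | w , pw , le′ = w , trans (+-suc _ k) (trans (cong suc pw) (sym e)) , ≤-trans (d-step u~v w) (s≤s le′)

    climb-to : ∀ j u → pos u ≤ j → j < N → ∃[ w ] (pos w ≡ j × d u w + pos u ≤ j)
    climb-to j u le lt with m≤n⇒∃[o]m+o≡n le
    ... | k , refl = let w , pw , dw = climb k u lt in
          w , pw , ≤-trans (+-mono-≤ dw ≤-refl) (≤-reflexive (+-comm k (pos u)))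

    descend-to : ∀ j u → j ≤ pos u → ∃[ w ] (pos w ≡ j × d u w + j ≤ pos u)
    descend-to j u le with m≤n⇒∃[o]m+o≡n le
    ... | k , e = let w , pw , dw = descend k u (subst (k ≤_) e (m≤n+m k j)) in
          w , +-cancelʳ-≡ k _ _ (trans pw (sym e)) , ≤-trans (+-mono-≤ dw ≤-refl) (≤-reflexive (trans (+-comm k j) e))

    -- Descending from `z` ends somewhere in layer j, and `w` is the only vertex there.
    single-above : ∀ {j w z} → Single pos j → pos w ≡ j → j ≤ pos z → d w z + j ≤ pos z
    single-above {j} {w} {z} single pw le with descend-to j z le
    ... | w′ , pw′ , dw rewrite single pw pw′ | d-sym w′ z = dw

    single-below : ∀ {j w z} → Single pos j → pos w ≡ j → pos z ≤ j → d w z + pos z ≤ j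
    single-below {j} {w} {z} single pw le with climb-to j z le (subst (_< N) pw (pos<N w))
    ... | w′ , pw′ , dw rewrite single pw pw′ | d-sym w′ z = dw

-- One comparison around the cycle

module Steps {n : ℕ} {_~_ : Fin n → Fin n → Set} (R : Regular n _~_) (h : ℕ) (2≤h : 2 ≤ h) where
  open Regular R
  open Layers R h 2≤h

  data Region (q : ℕ) : Set where
    at-0    : q ≡ 0 → Region q
    at-1    : q ≡ 1 → Region q
    front   : 2 ≤ q → q ≤ h → Region q
    at-1+h  : q ≡ suc h → Region q
    rear    : 2 + h ≤ q → Region q

  region : ∀ q → Region q
  region 0 = at-0 refl
  region 1 = at-1 refl
  region q@(suc (suc _)) with q ≤? h
  ... | yes q≤h = front (s≤s (s≤s z≤n)) q≤h
  ... | no  q≰h with m≤n⇒m<n∨m≡n (≰⇒> q≰h)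
  ...   | inj₁ lt = rear lt
  ...   | inj₂ e  = at-1+h (sym e)

  -- If layer 0 is flat and its opposite layer h is a single vertex, compare
  -- T(u) + T(w) with T(v) + T(s) for u, v, w, s in layers 1, 2, h, h + 1.
  module Step (L : Layering) (flat : Flat (Layering.pos L)) (single : Single (Layering.pos L) h) where
    open Layering L
    open Positions L
    open Flat flat

    h<N : h < N
    h<N = linear 1 (λ h → (con 2 :≤ h) ∷ [] ⊢ con 1 :+ h ≤ h :+ h) refl h 2≤h

    1+h<N : suc h < N
    1+h<N = linear 1 (λ h → (con 2 :≤ h) ∷ [] ⊢ con 2 :+ h ≤ h :+ h) refl h 2≤h

    prev-at : ∀ {u j} → pos u ≡ suc j → ∃[ w ] (u ~ w × pos w ≡ j)
    prev-at {u} pu with prev u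
    ... | w , u~w , inj₁ e       = w , u~w , suc-injective (trans (sym e) pu)
    ... | w , u~w , inj₂ (_ , e) = contradiction (trans (sym pu) e) λ ()

    differ : ∀ {u z j k} → pos u ≡ j → pos z ≡ k → j ≢ k → z ≢ u
    differ pu pz j≢k refl = j≢k (trans (sym pu) pz)

    module _ {u} (pu : pos u ≡ 1) where

      one-zero : ∀ {z} → pos z ≡ 0 → d u z ≤ 1
      one-zero {z} pz = subst₂ _≤_ (d-sym z u) pu
        (ahead pz (≤-reflexive (sym pu)) (subst (_≤ h) (sym pu) (<⇒≤ 2≤h)))

      one-back : ∀ {z} → h ≤ pos z → d u z + pos z ≤ 1 + N
      one-back {z} le = let w , u~w , pw = prev-at pu in
        ≤-trans (+-mono-≤ (d-step u~w z) ≤-refl) (s≤s (back pw le))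

      one-one : ∀ {z} → pos z ≡ 1 → d u z ≤ 2
      one-one {z} pz = let w , u~w , pw = prev-at pu in
        ≤-trans (d-step u~w z) (s≤s (subst (d w z ≤_) pz
          (ahead pw (≤-reflexive (sym pz)) (subst (_≤ h) (sym pz) (<⇒≤ 2≤h)))))

    module Compare {u v w s} (pu : pos u ≡ 1) (pv : pos v ≡ 2) (u~v : u ~ v) (pw : pos w ≡ h) (ps : pos s ≡ suc h) where

      w-low : ∀ {z} → pos z ≤ h → d w z + pos z ≤ h
      w-low = single-below single pw

      w-high : ∀ {z} → h ≤ pos z → d w z + h ≤ pos z
      w-high = single-above single pw

      v-zero : ∀ {z} → pos z ≡ 0 → 2 ≤ d v z
      v-zero {z} pz with far v z
      ... | far-vz rewrite pv | pz with far-vz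
      ...   | inj₁ (_ , p) = p
      ...   | inj₂ (inj₁ p) = linear 2 (λ h k → (h :+ h :+ con 2 :≤ k) ∷ [] ⊢ con 2 ≤ k) refl h (d v z) p
      ...   | inj₂ (inj₂ p) = linear 2 (λ h k →
            (h :+ h :+ con 0 :≤ con 2 :+ k) ∷ (con 2 :≤ h) ∷ (con 2 :≤ h) ∷ [] ⊢ con 2 ≤ k) refl
              h (d v z) p 2≤h 2≤h

      v-1+h : ∀ {z} → pos z ≡ suc h → h ≤ 1 + d v z
      v-1+h {z} pz with far v z
      ... | far-vz rewrite pv | pz with far-vz
      ...   | inj₁ (p , _) = ≤-pred p
      ...   | inj₂ (inj₁ p) = linear 2 (λ h k →
            (h :+ h :+ con 2 :≤ con 1 :+ h :+ k) ∷ [] ⊢ h ≤ con 1 :+ k) refl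
              h (d v z) p
      ...   | inj₂ (inj₂ p) = linear 2 (λ h k →
            (h :+ h :+ (con 1 :+ h) :≤ con 2 :+ k) ∷ [] ⊢ h ≤ con 1 :+ k) refl
              h (d v z) p

      v-rear : ∀ {z} → 2 + h ≤ pos z → N + 2 ≤ pos z + d v z
      v-rear {z} le with far v z
      ... | far-vz rewrite pv with far-vz
      ...   | inj₁ (p , _) = linear 3 (λ h q k →
            (con 2 :+ h :≤ q) ∷ (con 2 :+ h :≤ q) ∷ (q :≤ con 2 :+ k) ∷ []
            ⊢ h :+ h :+ con 2 ≤ q :+ k) refl
              h (pos z) (d v z) le le p
      ...   | inj₂ (inj₁ p) = p
      ...   | inj₂ (inj₂ p) = linear 3 (λ h q k →
            (con 2 :+ h :≤ q) ∷ (con 2 :+ h :≤ q) ∷ (h :+ h :+ q :≤ con 2 :+ k) ∷ []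
            ⊢ h :+ h :+ con 2 ≤ q :+ k) refl
              h (pos z) (d v z) le le p

      s-zero : ∀ {z} → pos z ≡ 0 → h ≤ 1 + d s z
      s-zero {z} pz with far s z
      ... | far-sz rewrite ps | pz with far-sz
      ...   | inj₁ (_ , p) = ≤-trans (n≤1+n h) (≤-trans p (n≤1+n _))
      ...   | inj₂ (inj₁ p) = linear 2 (λ h k →
            (h :+ h :+ (con 1 :+ h) :≤ k) ∷ [] ⊢ h ≤ con 1 :+ k) refl
              h (d s z) p
      ...   | inj₂ (inj₂ p) = linear 2 (λ h k →
            (h :+ h :+ con 0 :≤ con 1 :+ h :+ k) ∷ [] ⊢ h ≤ con 1 :+ k) refl
              h (d s z) p

      s-front : ∀ {z} → 1 ≤ pos z → pos z ≤ h → suc h ≤ pos z + d s z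
      s-front {z} 1≤q q≤h with far s z
      ... | far-sz rewrite ps with far-sz
      ...   | inj₁ (_ , p) = p
      ...   | inj₂ (inj₁ p) = linear 3 (λ h q k →
            (h :+ h :+ (con 1 :+ h) :≤ q :+ k) ∷ [] ⊢ con 1 :+ h ≤ q :+ k) refl
              h (pos z) (d s z) p
      ...   | inj₂ (inj₂ p) = linear 3 (λ h q k →
            (h :+ h :+ q :≤ con 1 :+ h :+ k) ∷ (con 1 :≤ q) ∷ (con 1 :≤ q) ∷ []
            ⊢ con 1 :+ h ≤ q :+ k) refl
              h (pos z) (d s z) p 1≤q 1≤q

      s-rear : ∀ {z} → pos z ≤ suc h + d s z
      s-rear {z} with far s z
      ... | far-sz rewrite ps with far-sz
      ...   | inj₁ (p , _) = p
      ...   | inj₂ (inj₁ p) = linear 3 (λ h q k →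
            (h :+ h :+ (con 1 :+ h) :≤ q :+ k) ∷ (con 1 :+ q :≤ h :+ h) ∷ (con 1 :+ q :≤ h :+ h) ∷ []
            ⊢ q ≤ con 1 :+ h :+ k) refl
              h (pos z) (d s z) p (pos<N z) (pos<N z)
      ...   | inj₂ (inj₂ p) = linear 3 (λ h q k →
            (h :+ h :+ q :≤ con 1 :+ h :+ k) ∷ [] ⊢ q ≤ con 1 :+ h :+ k) refl
              h (pos z) (d s z) p

      -- Upper bounds for `u`, through layer 0, and for `w`, through the single layer h, meet lower
      -- bounds for `v` and `s` that come mostly from cyclic distance. In layer 1 the vertex `u` has
      -- distance 0 from itself where 2 is allowed, so a spike fits; in layer h + 1 the vertex `s`
      -- has 0 where 2 is needed, and its own spike repairs this.
      pointwise : ∀ z → d u z + d w z + spike u z ≤ d v z + d s z + spike s z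
      pointwise z with region (pos z)
      ... | at-0 pz = linear 7 (λ h u w v s i j →
            (u :≤ con 1) ∷ (w :+ con 0 :≤ h) ∷ (con 2 :≤ v) ∷ (h :≤ con 1 :+ s) ∷ (i := con 0) ∷ []
            ⊢ u :+ w :+ i ≤ v :+ s :+ j) refl
              h (d u z) (d w z) (d v z) (d s z) (spike u z) (spike s z)
              (one-zero pu pz) (subst (λ q → d w z + q ≤ h) pz (w-low (subst (_≤ h) (sym pz) z≤n)))
              (v-zero pz) (s-zero pz) (spike-diff (differ pu pz λ ()))
      ... | front 2≤q q≤h = linear 8 (λ h u w v s i j q →
            (u :≤ con 1 :+ v) ∷ (w :+ q :≤ h) ∷ (con 1 :+ h :≤ q :+ s) ∷ (i := con 0) ∷ []
            ⊢ u :+ w :+ i ≤ v :+ s :+ j) refl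
              h (d u z) (d w z) (d v z) (d s z) (spike u z) (spike s z) (pos z)
              (d-step u~v z) (w-low q≤h) (s-front (<⇒≤ 2≤q) q≤h) (spike-diff {u = u} {z} (λ { refl → contradiction (subst (2 ≤_) pu 2≤q) 1+n≰n }))
      ... | rear le = linear 8 (λ h u w v s i j q →
            (u :+ q :≤ con 1 :+ (h :+ h)) ∷ (w :+ h :≤ q) ∷ (h :+ h :+ con 2 :≤ q :+ v) ∷ (q :≤ con 1 :+ h :+ s) ∷ (i := con 0) ∷ []
            ⊢ u :+ w :+ i ≤ v :+ s :+ j) refl
              h (d u z) (d w z) (d v z) (d s z) (spike u z) (spike s z) (pos z)
              (one-back pu h≤q) (w-high h≤q) (v-rear le) (s-rear {z})
              (spike-diff {u = u} {z} (λ { refl → contradiction (≤-trans 2≤h (subst (h ≤_) pu h≤q)) 1+n≰n }))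
        where
        h≤q : h ≤ pos z
        h≤q = <⇒≤ (<⇒≤ le)
      ... | at-1 pz = on-1 (same? z u)
        where
        w1 : d w z + 1 ≤ h
        w1 = subst (λ q → d w z + q ≤ h) pz (w-low (subst (_≤ h) (sym pz) (<⇒≤ 2≤h)))
        s1 : suc h ≤ 1 + d s z
        s1 = subst (λ q → suc h ≤ q + d s z) pz (s-front (≤-reflexive (sym pz)) (subst (_≤ h) (sym pz) (<⇒≤ 2≤h)))
        v1 : 1 ≤ d v z
        v1 = d-pos (differ pz pv λ ())
        on-1 : z ≡ u ⊎ z ≢ u → d u z + d w z + spike u z ≤ d v z + d s z + spike s z
        on-1 (inj₁ z≡u) = linear 7 (λ h u w v s i j →
              (u := con 0) ∷ (w :+ con 1 :≤ h) ∷ (con 1 :≤ v) ∷ (con 1 :+ h :≤ con 1 :+ s) ∷ (i := con 2) ∷ []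
              ⊢ u :+ w :+ i ≤ v :+ s :+ j) refl
              h (d u z) (d w z) (d v z) (d s z) (spike u z) (spike s z)
              (trans (cong (d u) z≡u) (d-refl u)) w1 v1 s1 (spike-same z≡u)
        on-1 (inj₂ z≢u) = linear 7 (λ h u w v s i j →
              (u :≤ con 2) ∷ (w :+ con 1 :≤ h) ∷ (con 1 :≤ v) ∷ (con 1 :+ h :≤ con 1 :+ s) ∷ (i := con 0) ∷ []
              ⊢ u :+ w :+ i ≤ v :+ s :+ j) refl
              h (d u z) (d w z) (d v z) (d s z) (spike u z) (spike s z)
              (one-one pu pz) w1 v1 s1 (spike-diff z≢u)
      ... | at-1+h pz = on-1+h (same? z s)
        where
        h≤q : h ≤ pos z
        h≤q = subst (h ≤_) (sym pz) (n≤1+n h)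
        u1 : d u z + suc h ≤ 1 + N
        u1 = subst (λ q → d u z + q ≤ 1 + N) pz (one-back pu h≤q)
        w1 : d w z + h ≤ suc h
        w1 = subst (d w z + h ≤_) pz (w-high h≤q)
        z≢u : z ≢ u
        z≢u refl = contradiction (≤-trans 2≤h (subst (h ≤_) pu h≤q)) 1+n≰n
        on-1+h : z ≡ s ⊎ z ≢ s → d u z + d w z + spike u z ≤ d v z + d s z + spike s z
        on-1+h (inj₁ z≡s) = linear 7 (λ h u w v s i j →
              (u :+ (con 1 :+ h) :≤ con 1 :+ (h :+ h)) ∷ (w :+ h :≤ con 1 :+ h) ∷ (h :≤ con 1 :+ v) ∷ (con 2 := j) ∷ (i := con 0) ∷ []
              ⊢ u :+ w :+ i ≤ v :+ s :+ j) refl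
              h (d u z) (d w z) (d v z) (d s z) (spike u z) (spike s z)
              u1 w1 (v-1+h pz) (sym (spike-same z≡s)) (spike-diff z≢u)
        on-1+h (inj₂ z≢s) = linear 7 (λ h u w v s i j →
              (u :+ (con 1 :+ h) :≤ con 1 :+ (h :+ h)) ∷ (w :+ h :≤ con 1 :+ h) ∷ (h :≤ con 1 :+ v) ∷ (con 2 :≤ s) ∷ (i := con 0) ∷ []
              ⊢ u :+ w :+ i ≤ v :+ s :+ j) refl
              h (d u z) (d w z) (d v z) (d s z) (spike u z) (spike s z)
              u1 w1 (v-1+h pz) (apart (trans ps (sym pz)) (z≢s ∘ sym)) (spike-diff z≢u)

      tight : ∀ z → d v z + d s z + spike s z ≤ d u z + d w z + spike u z
      tight = squeeze u w v s {spike u} {spike s} (trans (sum-spike u) (sym (sum-spike s))) pointwise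

      -- In layer 1, `d s z` exceeds `d w z` by at least 1 and `d u z` is at most 2, so tightness
      -- leaves at most 1 for `d v z`.
      joined : ∀ {z} → pos z ≡ 1 → z ~ v
      joined {z} pz with same? z u
      ... | inj₁ refl = u~v
      ... | inj₂ z≢u  = ~-sym (d≤1⇒~ (differ pz pv λ ())
              (linear 7 (λ h u w v s i j →
                    (v :+ s :+ j :≤ u :+ w :+ i) ∷ (u :≤ con 2) ∷ (w :+ con 1 :≤ h) ∷ (con 1 :+ h :≤ con 1 :+ s) ∷ (i := con 0) ∷ []
                    ⊢ v ≤ con 1) refl
                h (d u z) (d w z) (d v z) (d s z) (spike u z) (spike s z) (tight z)
                (one-one pu pz) (subst (λ q → d w z + q ≤ h) pz (w-low q≤h))
                (subst (λ q → suc h ≤ q + d s z) pz (s-front (≤-reflexive (sym pz)) q≤h)) (spike-diff z≢u)))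
        where
        q≤h : pos z ≤ h
        q≤h = subst (_≤ h) (sym pz) (<⇒≤ 2≤h)

      -- Once `u` is joined to all of layer 2, tightness at any z there leaves 0 for `d v z`. The
      -- premise is met by `joined` for all choices of `v`.
      lone : (∀ {z} → pos z ≡ 2 → u ~ z) → ∀ {z} → pos z ≡ 2 → v ≡ z
      lone u~ {z} pz with same? v z
      ... | inj₁ v≡z = v≡z
      ... | inj₂ v≢z = contradiction
              (linear 7 (λ h u w v s i j →
                    (v :+ s :+ j :≤ u :+ w :+ i) ∷ (u :≤ con 1) ∷ (w :+ con 2 :≤ h) ∷ (con 1 :+ h :≤ con 2 :+ s) ∷ (i := con 0) ∷ (con 2 :≤ v) ∷ []
                    ⊢ con 1 ≤ con 0) refl
                h (d u z) (d w z) (d v z) (d s z) (spike u z) (spike s z) (tight z)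
                (~⇒d≤1 (u~ pz)) (subst (λ q → d w z + q ≤ h) pz (w-low q≤h))
                (subst (λ q → suc h ≤ q + d s z) pz (s-front (subst (1 ≤_) (sym pz) (s≤s z≤n)) q≤h))
                (spike-diff (differ pu pz λ ())) (apart (trans pv (sym pz)) v≢z))
              λ ()
        where
        q≤h : pos z ≤ h
        q≤h = subst (_≤ h) (sym pz) 2≤h

      -- An upper bound for a distance without any path: tightness converts the lower bound for `v`
      -- into it.
      s-rear-exact : ∀ {z} → 2 + h ≤ pos z → suc h + d s z ≤ pos z
      s-rear-exact {z} le =
        linear 8 (λ h u w v s i j q →
              (v :+ s :+ j :≤ u :+ w :+ i) ∷ (u :+ q :≤ con 1 :+ (h :+ h)) ∷ (w :+ h :≤ q) ∷ (h :+ h :+ con 2 :≤ q :+ v) ∷ (i := con 0) ∷ []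
              ⊢ con 1 :+ h :+ s ≤ q) refl
          h (d u z) (d w z) (d v z) (d s z) (spike u z) (spike s z) (pos z) (tight z)
          (one-back pu h≤q) (w-high h≤q) (v-rear le)
          (spike-diff {u = u} {z} (λ { refl → contradiction (≤-trans 2≤h (subst (h ≤_) pu h≤q)) 1+n≰n }))
        where
        h≤q : h ≤ pos z
        h≤q = <⇒≤ (<⇒≤ le)

      s-zero-exact : ∀ {z} → pos z ≡ 0 → 1 + d s z ≤ h
      s-zero-exact {z} pz =
        linear 7 (λ h u w v s i j →
              (v :+ s :+ j :≤ u :+ w :+ i) ∷ (u :≤ con 1) ∷ (w :+ con 0 :≤ h) ∷ (con 2 :≤ v) ∷ (i := con 0) ∷ []
              ⊢ con 1 :+ s ≤ h) refl
          h (d u z) (d w z) (d v z) (d s z) (spike u z) (spike s z) (tight z)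
          (one-zero pu pz) (subst (λ q → d w z + q ≤ h) pz (w-low (subst (_≤ h) (sym pz) z≤n)))
          (v-zero pz) (spike-diff (differ pu pz λ ()))

    opposite : ∀ {v} → pos v ≡ 2 → ∃[ w ] ∃[ s ] (pos w ≡ h × pos s ≡ suc h)
    opposite {v} pv = let w , pw , _ = climb-to h v (subst (_≤ h) (sym pv) 2≤h) h<N
                          s , ps , _ = climb-to (suc h) v (subst (_≤ suc h) (sym pv) (m≤n⇒m≤1+n 2≤h)) 1+h<N
                      in w , s , pw , ps

    complete : ∀ {u v} → pos u ≡ 1 → pos v ≡ 2 → u ~ v
    complete pu pv = let u′ , v~u′ , pu′ = prev-at pv
                         w , s , pw , ps = opposite pv
                     in Compare.joined pu′ pv (~-sym v~u′) pw ps pu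

    single-2 : Single pos 2
    single-2 pv pz = let u , v~u , pu = prev-at pv
                         w , s , pw , ps = opposite pv
                     in Compare.lone pu pv (~-sym v~u) pw ps (complete pu) pz

    -- Going ahead, a descent from z to layer 2 ends at a vertex adjacent to `u` by `complete`;
    -- going back, the path runs through layer 0.
    flat-1 : Flat (rot N ∘ pos)
    flat-1 = record
      { same  = λ pu pz → one-one (at-one pu) (at-one pz)
      ; ahead = λ {u} {z} pu → ahead′ (at-one pu) (pos z) refl
      ; back  = λ {u} {z} pu → back′ (at-one pu) (pos z) refl
      }
      where
      at-one : ∀ {u} → rot N (pos u) ≡ 0 → pos u ≡ 1
      at-one = rot-zero 2≤N
      ahead′ : ∀ {u z} → pos u ≡ 1 → ∀ q → pos z ≡ q → 1 ≤ rot N q → rot N q ≤ h → d u z ≤ rot N q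
      -- Layer 0 is now numbered N - 1, which exceeds h.
      ahead′ pu zero pz _ le = contradiction le (<⇒≱ (∸-monoˡ-≤ 1 1+h<N))
      ahead′ {u} {z} pu (suc q) pz 1≤q _ with descend-to 2 z (subst (2 ≤_) (sym pz) (s≤s 1≤q))
      ... | v , pv , le = linear 4 (λ uz vz q q′ →
            (vz :+ con 2 :≤ q′) ∷ (q′ := con 1 :+ q) ∷ (uz :≤ con 1 :+ vz) ∷ [] ⊢ uz ≤ q) refl
              (d u z) (d z v) q (pos z) le pz (subst (λ k → d u z ≤ suc k) (d-sym v z) (d-step (complete pu pv) z))
      back′ : ∀ {u z} → pos u ≡ 1 → ∀ q → pos z ≡ q → h ≤ rot N q → d u z + rot N q ≤ N
      back′ {u} {z} pu zero pz _ = ≤-trans (+-mono-≤ (one-zero pu pz) ≤-refl) (≤-reflexive (m+[n∸m]≡n (<⇒≤ 2≤N)))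
      back′ {u} {z} pu (suc q) pz le = ≤-pred (≤-trans (≤-reflexive (sym (+-suc (d u z) q)))
        (subst (λ k → d u z + k ≤ 1 + N) pz (one-back pu (subst (h ≤_) (sym pz) (m≤n⇒m≤1+n le)))))

    -- Within the layer of `s` and backwards, paths run through the single vertex of layer h. Ahead
    -- of `s`, in layers h + 2 to N - 1 and in layer 0, the bounds come from tightness.
    flat-1+h : Flat (rots N (suc h) ∘ pos)
    flat-1+h = record
      { same  = λ {u} {z} pu pz → same′ (at-s u pu) (at-s z pz)
      ; ahead = λ {u} {z} pu → ahead′ (at-s u pu) z
      ; back  = λ {u} {z} pu → back′ (at-s u pu) z
      }
      where
      offset : ∀ z → (pos z ≡ suc h + rots N (suc h) (pos z)) ⊎ (pos z < suc h × N + pos z ≡ suc h + rots N (suc h) (pos z))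
      offset z = rots-value N (suc h) (pos z) (pos<N z) (<⇒≤ 1+h<N)

      at-s : ∀ u → rots N (suc h) (pos u) ≡ 0 → pos u ≡ suc h
      at-s u e with offset u
      ... | inj₁ v       = trans v (trans (cong (suc h +_) e) (+-identityʳ _))
      ... | inj₂ (_ , v) = contradiction
        (linear 3 (λ h q r →
              (h :+ h :+ q := con 1 :+ h :+ r) ∷ (r := con 0) ∷ (con 2 :≤ h) ∷ [] ⊢ con 1 ≤ con 0) refl
                h (pos u) (rots N (suc h) (pos u)) v e 2≤h) λ ()

      module _ {s} (ps : pos s ≡ suc h) where
        w,s~w : ∃[ w ] (s ~ w × pos w ≡ h)
        w,s~w = prev-at ps
        w = proj₁ w,s~w
        s~w : s ~ w
        s~w = proj₁ (proj₂ w,s~w)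
        pw : pos w ≡ h
        pw = proj₂ (proj₂ w,s~w)

        v,pv : ∃[ v ] (pos v ≡ 2 × d s v + 2 ≤ pos s)
        v,pv = descend-to 2 s (subst (2 ≤_) (sym ps) (m≤n⇒m≤1+n 2≤h))
        pv : pos (proj₁ v,pv) ≡ 2
        pv = proj₁ (proj₂ v,pv)
        u,pu : ∃[ u ] (proj₁ v,pv ~ u × pos u ≡ 1)
        u,pu = prev-at pv
        open Compare (proj₂ (proj₂ u,pu)) pv (~-sym (proj₁ (proj₂ u,pu))) pw ps

        same′ : ∀ {z} → pos z ≡ suc h → d s z ≤ 2
        same′ {z} pz = linear 3 (λ h x y → (x :≤ con 1 :+ y) ∷ (y :+ h :≤ con 1 :+ h) ∷ [] ⊢ x ≤ con 2) refl
          h (d s z) (d w z) (d-step s~w z) (subst (d w z + h ≤_) pz (w-high (subst (h ≤_) (sym pz) (n≤1+n h))))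

        low : ∀ z → pos z ≤ h → d s z + pos z ≤ suc h
        low z le = ≤-trans (+-mono-≤ (d-step s~w z) ≤-refl) (s≤s (w-low le))

        ahead′ : ∀ z → 1 ≤ rots N (suc h) (pos z) → rots N (suc h) (pos z) ≤ h → d s z ≤ rots N (suc h) (pos z)
        ahead′ z 1≤r r≤h with offset z
        ... | inj₁ v = linear 4 (λ h x q r →
              (con 1 :+ h :+ x :≤ q) ∷ (q := con 1 :+ h :+ r) ∷ [] ⊢ x ≤ r) refl
                h (d s z) (pos z) (rots N (suc h) (pos z))
                (s-rear-exact (subst (2 + h ≤_) (sym v) (≤-trans (≤-reflexive (sym (+-comm (suc h) 1))) (+-mono-≤ (≤-refl {suc h}) 1≤r)))) v
        ... | inj₂ (q≤h , v) with same-or-pos (pos z)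
          where
          same-or-pos : ∀ q → q ≡ 0 ⊎ 1 ≤ q
          same-or-pos zero    = inj₁ refl
          same-or-pos (suc q) = inj₂ (s≤s z≤n)
        ...   | inj₁ q≡0 = linear 4 (λ h x q r →
              (con 1 :+ x :≤ h) ∷ (h :+ h :+ q := con 1 :+ h :+ r) ∷ [] ⊢ x ≤ r) refl
                h (d s z) (pos z) (rots N (suc h) (pos z)) (s-zero-exact q≡0) v
        ...   | inj₂ 1≤q = linear 4 (λ h x q r →
              (x :+ q :≤ con 1 :+ h) ∷ (h :+ h :+ q := con 1 :+ h :+ r) ∷ (con 1 :≤ q) ∷ (con 1 :≤ q) ∷ []
              ⊢ x ≤ r) refl
                h (d s z) (pos z) (rots N (suc h) (pos z)) (low z (≤-pred q≤h)) v 1≤q 1≤q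

        back′ : ∀ z → h ≤ rots N (suc h) (pos z) → d s z + rots N (suc h) (pos z) ≤ N
        back′ z h≤r with offset z
        ... | inj₁ v = contradiction
          (linear 3 (λ h q r →
                (con 1 :+ h :+ r := q) ∷ (con 1 :+ q :≤ h :+ h) ∷ (h :≤ r) ∷ [] ⊢ con 1 ≤ con 0) refl
                  h (pos z) (rots N (suc h) (pos z)) (sym v) (pos<N z) h≤r) λ ()
        ... | inj₂ (q≤h , v) = linear 4 (λ h x q r →
              (x :+ q :≤ con 1 :+ h) ∷ (con 1 :+ h :+ r := h :+ h :+ q) ∷ [] ⊢ x :+ r ≤ h :+ h) refl
                h (d s z) (pos z) (rots N (suc h) (pos z)) (low z (≤-pred q≤h)) (sym v)

≡ᵇ-true : ∀ i j → (i ≡ᵇ j) ≡ true → i ≡ j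
≡ᵇ-true i j e = ≡ᵇ⇒≡ i j (Equivalence.from T-≡ e)

≡ᵇ-intro : ∀ i j → i ≡ j → (i ≡ᵇ j) ≡ true
≡ᵇ-intro i j e = Equivalence.to T-≡ (≡⇒≡ᵇ i j e)

≡ᵇ-false : ∀ i j → i ≢ j → (i ≡ᵇ j) ≡ false
≡ᵇ-false i j ne = ¬true⇒false (ne ∘ ≡ᵇ-true i j)

count-unique : ∀ {n} (p : Fin n → Bool) w → p w ≡ true → (∀ z → p z ≡ true → z ≡ w) → count p ≡ 1
count-unique p w pw uniq = trans (sum-cong-≗ pointwise) (sum-δ w)
  where
  pointwise : ∀ z → 𝟙 (p z) ≡ δ w z
  pointwise z with same? z w
  ... | inj₁ refl = trans (cong 𝟙 pw) (sym (δ-same z))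
  ... | inj₂ z≢w  = trans (cong 𝟙 (¬true⇒false (z≢w ∘ uniq z))) (sym (δ-diff z≢w))

count-pos : ∀ {n} (p : Fin n → Bool) w → p w ≡ true → 1 ≤ count p
count-pos p w pw = subst (_≤ count p) (sum-δ w) (sum-mono pointwise)
  where
  pointwise : ∀ z → δ w z ≤ 𝟙 (p z)
  pointwise z with same? z w
  ... | inj₁ refl = ≤-reflexive (trans (δ-same z) (sym (cong 𝟙 pw)))
  ... | inj₂ z≢w  = subst (_≤ 𝟙 (p z)) (sym (δ-diff z≢w)) z≤n

fW-cong : ∀ m i j → i % 4 ≡ j % 4 → fW m i ≡ fW m j
fW-cong m i j e rewrite e with j % 4
... | 0 = refl
... | 1 = refl
... | 2 = refl
... | 3 = refl
... | suc (suc (suc (suc _))) = refl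

fW-shift : ∀ m r i → fW m (r + i * 4) ≡ fW m r
fW-shift m r i = fW-cong m (r + i * 4) r ([m+kn]%n≡m%n r i 4)

-- Induction around the cycle and the sizes of the layers

module Chains {n : ℕ} {_~_ : Fin n → Fin n → Set} (R : Regular n _~_) (h : ℕ) (2≤h : 2 ≤ h) where
  open Regular R
  open Layers R h 2≤h
  open Steps R h 2≤h

  exact-ahead : ∀ L → Flat (Layering.pos L) → ∀ {u z} → Layering.pos L u ≡ 0 →
                1 ≤ Layering.pos L z → Layering.pos L z ≤ h → d u z ≡ Layering.pos L z
  exact-ahead L flat {u} {z} pu 1≤q q≤h = ≤-antisym (Flat.ahead flat pu 1≤q q≤h) lower
    where
    open Layering L
    lower : pos z ≤ d u z
    lower with Positions.far L u z
    ... | far rewrite pu with far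
    ...   | inj₁ (p , _)  = p
    ...   | inj₂ (inj₁ p) = linear 3 (λ h q k →
          (h :+ h :+ con 0 :≤ q :+ k) ∷ (q :≤ h) ∷ (q :≤ h) ∷ [] ⊢ q ≤ k) refl
            h (pos z) (d u z) p q≤h q≤h
    ...   | inj₂ (inj₂ p) = linear 3 (λ h q k → (h :+ h :+ q :≤ k) ∷ [] ⊢ q ≤ k) refl h (pos z) (d u z) p

  exact-back : ∀ L → Flat (Layering.pos L) → ∀ {u z} → Layering.pos L u ≡ 0 →
               h ≤ Layering.pos L z → d u z + Layering.pos L z ≡ N
  exact-back L flat {u} {z} pu h≤q = ≤-antisym (Flat.back flat pu h≤q) lower
    where
    open Layering L
    lower : N ≤ d u z + pos z
    lower with Positions.far L u z
    ... | far rewrite pu with far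
    ...   | inj₁ (p , _)  = linear 3 (λ h q k →
          (h :≤ q) ∷ (h :≤ q) ∷ (q :≤ k) ∷ [] ⊢ h :+ h ≤ k :+ q) refl
            h (pos z) (d u z) h≤q h≤q p
    ...   | inj₂ (inj₁ p) = linear 3 (λ h q k →
          (h :+ h :+ con 0 :≤ q :+ k) ∷ [] ⊢ h :+ h ≤ k :+ q) refl
            h (pos z) (d u z) p
    ...   | inj₂ (inj₂ p) = linear 3 (λ h q k →
          (h :+ h :+ q :≤ k) ∷ [] ⊢ h :+ h ≤ k :+ q) refl
            h (pos z) (d u z) p

  exact-same : ∀ L → Flat (Layering.pos L) → ∀ {u z} → Layering.pos L u ≡ 0 →
               Layering.pos L z ≡ 0 → z ≢ u → d u z ≡ 2
  exact-same L flat pu pz z≢u =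
    ≤-antisym (Flat.same flat pu pz) (Positions.apart L (trans pu (sym pz)) (z≢u ∘ sym))

  module Chain (L : Layering) (v₀ : Fin n) where

    -- `p k` numbers the layers so that layer k comes first. Here k is any natural number, and
    -- `period` replaces arithmetic modulo N.
    p : ℕ → Fin n → ℕ
    p k = Layering.pos (rotated k L)

    p<N : ∀ k z → p k z < N
    p<N k = Layering.pos<N (rotated k L)

    p-+ : ∀ j k z → p (j + k) z ≡ rots N j (p k z)
    p-+ zero    k z = refl
    p-+ (suc j) k z = cong (rot N) (p-+ j k z)

    layer-intro : ∀ j k z → j < N → p k z ≡ j → p (j + k) z ≡ 0
    layer-intro j k z j<N e with rots-value N j (p k z) (p<N k z) (<⇒≤ j<N)
    ... | inj₁ v        = trans (p-+ j k z) (+-cancelˡ-≡ j _ _ (trans (sym v) (trans e (sym (+-identityʳ j)))))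
    ... | inj₂ (lt , _) = contradiction (subst (_< j) e lt) 1+n≰n

    layer-elim : ∀ j k z → j < N → p (j + k) z ≡ 0 → p k z ≡ j
    layer-elim j k z j<N e with rots-value N j (p k z) (p<N k z) (<⇒≤ j<N)
    ... | inj₁ v       = trans v (trans (cong (j +_) (trans (sym (p-+ j k z)) e)) (+-identityʳ j))
    ... | inj₂ (_ , v) = contradiction
      (linear 4 (λ N q j r →
            (N :+ q := j :+ r) ∷ (r := con 0) ∷ (con 1 :+ j :≤ N) ∷ [] ⊢ con 1 ≤ con 0) refl
              N (p k z) j (rots N j (p k z)) v (trans (sym (p-+ j k z)) e) j<N) λ ()

    period : ∀ k z → p (N + k) z ≡ p k z
    period k z with rots-value N N (p k z) (p<N k z) ≤-refl
    ... | inj₁ v       = contradiction (subst (_< N) v (p<N k z)) (<⇒≱ (s≤s (m≤m+n N _)))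
    ... | inj₂ (_ , v) = trans (p-+ N k z) (sym (+-cancelˡ-≡ N _ _ v))

    occupied : ∀ k → ∃[ z ] p k z ≡ 0
    occupied k = let z , pz , _ = Positions.descend-to (rotated k L) 0 v₀ z≤n in z , pz

    flat-cong : ∀ {q r : Fin n → ℕ} → (∀ z → q z ≡ r z) → Flat q → Flat r
    flat-cong {q} {r} e flat = record
      { same  = λ {u} {z} pu pz → Flat.same flat (trans (e u) pu) (trans (e z) pz)
      ; ahead = λ {u} {z} pu 1≤ ≤h → subst (d u z ≤_) (e z) (Flat.ahead flat (trans (e u) pu) (subst (1 ≤_) (sym (e z)) 1≤) (subst (_≤ h) (sym (e z)) ≤h))
      ; back  = λ {u} {z} pu h≤ → subst (λ k → d u z + k ≤ N) (e z) (Flat.back flat (trans (e u) pu) (subst (h ≤_) (sym (e z)) h≤))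
      }

    -- `single₀` allows a comparison at layer k, and `single₁` allows the following one at layer k +
    -- 1.
    record Inv (k : ℕ) : Set where
      field
        flat    : Flat (p k)
        single₀ : Single (p k) h
        single₁ : Single (p k) (suc h)

    Inv-period : ∀ {k} → Inv (N + k) → Inv k
    Inv-period {k} inv = record
      { flat    = flat-cong (period k) flat
      ; single₀ = λ {z} {z′} e e′ → single₀ (trans (period k z) e) (trans (period k z′) e′)
      ; single₁ = λ {z} {z′} e e′ → single₁ (trans (period k z) e) (trans (period k z′) e′)
      }
      where open Inv inv

    Opposite : ℕ → Set
    Opposite k = Flat (p k) × Flat (p (h + k))

    Opposite-period : ∀ {k} → Opposite (N + k) → Opposite k
    Opposite-period {k} (f , g) = flat-cong (period k) f ,
      flat-cong (λ z → trans (cong (λ j → p j z) (lemma h k)) (period (h + k) z)) g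
      where
      lemma : ∀ h k → h + (h + h + k) ≡ h + h + (h + k)
      lemma = solve-∀

    Opposite-shift : ∀ {k} → Opposite (h + k) → Opposite k
    Opposite-shift {k} (f , g) = flat-cong (λ z → trans (cong (λ j → p j z) (sym (+-assoc h h k))) (period k z)) g , f

    module Advance {k} (inv : Inv k) where
      open Inv inv

      module S₁ = Step (rotated k L) flat single₀

      single-h : Single (p (suc k)) h
      single-h {z} {z′} e e′ = single₁ (back-1 z e) (back-1 z′ e′)
        where
        back-1 : ∀ z → p (suc k) z ≡ h → p k z ≡ suc h
        back-1 z e with p k z
        ... | zero  = contradiction (≤-reflexive e) (<⇒≱ (∸-monoˡ-≤ 1 S₁.1+h<N))
        ... | suc q = cong suc e

      module S₂ = Step (rotated (suc k) L) S₁.flat-1 single-h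

      single-2 : Single (p k) 2
      single-2 = S₁.single-2

      single-3 : Single (p k) 3
      single-3 e e′ = S₂.single-2 (cong (rot N) e) (cong (rot N) e′)

      opposite-1 : Opposite (suc k)
      opposite-1 = S₁.flat-1 , flat-cong (λ z → trans (sym (p-+ (suc h) k z)) (cong (λ j → p j z) (sym (+-suc h k)))) S₁.flat-1+h

      opposite-2 : Opposite (2 + k)
      opposite-2 = S₂.flat-1 , flat-cong (λ z → trans (sym (p-+ (suc h) (suc k) z)) (cong (λ j → p j z) (sym (+-suc h (suc k))))) S₂.flat-1+h

      -- Seen from layer h + 2 + k, the layers k + 2 and k + 3 just found to be single are the ones
      -- at h and h + 1.
      advance : Inv (h + (2 + k))
      advance = record
        { flat    = proj₂ opposite-2
        ; single₀ = λ {z} {z′} e e′ → single-2 (seen z 0 e) (seen z′ 0 e′)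
        ; single₁ = λ {z} {z′} e e′ → single-3 (seen z 1 e) (seen z′ 1 e′)
        }
        where
        reorder : ∀ h k → h + (2 + k) ≡ 2 + h + k
        reorder = solve-∀

        seen : ∀ z i → p (h + (2 + k)) z ≡ i + h → p k z ≡ 2 + i
        seen z i e with rots-value N (2 + h) (p k z) (p<N k z) (+-mono-≤ 2≤h (≤-refl {h}))
                      | trans (sym (p-+ (2 + h) k z)) (trans (cong (λ j → p j z) (sym (reorder h k))) e)
        ... | inj₁ v | e′ = contradiction
          (linear 4 (λ h q i r →
                (con 1 :+ q :≤ h :+ h) ∷ (con 2 :+ h :+ r := q) ∷ (i :+ h := r) ∷ []
                ⊢ con 1 ≤ con 0) refl
            h (p k z) i (rots N (2 + h) (p k z)) (p<N k z) (sym v) (sym e′)) λ ()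
        ... | inj₂ (_ , v) | e′ = +-cancelˡ-≡ N _ _ (trans v (trans (cong (2 + h +_) e′) (twice h i)))
          where
          twice : ∀ h i → 2 + h + (i + h) ≡ h + h + (2 + i)
          twice = solve-∀

    -- Two advances change sides twice, a total of N + 4.
    next-inv : ∀ {k} → Inv k → Inv (4 + k)
    next-inv {k} inv = Inv-period (subst Inv (four h k) (Advance.advance (Advance.advance inv)))
      where
      four : ∀ h k → h + (2 + (h + (2 + k))) ≡ h + h + (4 + k)
      four = solve-∀

    module Sizes (inv₁ : Inv 1) where

      inv : ∀ i → Inv (1 + i * 4)
      inv zero    = inv₁
      inv (suc i) = next-inv (inv i)

      -- Residues 0 and 1 come from the comparisons at `inv i`. Residues 2 and 3 come from those
      -- after one advance, made on the other side of the cycle and carried back by the symmetry of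
      -- `Opposite`.
      opposite-from-1 : ∀ k → Opposite (2 + k)
      opposite-from-1 k = subst (λ j → Opposite (2 + j)) (sym (m≡m%n+[m/n]*n k 4)) (go (k % 4) (m%n<n k 4))
        where
        i = k / 4
        module A = Advance (inv i)
        module B = Advance A.advance
        shift : ∀ {j} → Opposite (j + (h + (2 + (1 + i * 4)))) → Opposite (j + (2 + (1 + i * 4)))
        shift {j} o = Opposite-shift (subst Opposite (lemma j h (2 + (1 + i * 4))) o)
          where
          lemma : ∀ j h k → j + (h + k) ≡ h + (j + k)
          lemma = solve-∀
        go : ∀ r → r < 4 → Opposite (2 + (r + i * 4))
        go 0 _ = A.opposite-1
        go 1 _ = A.opposite-2
        go 2 _ = shift {1} B.opposite-1
        go 3 _ = shift {2} B.opposite-2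
        go (suc (suc (suc (suc _)))) (s≤s (s≤s (s≤s (s≤s ()))))

      -- Adding N brings layers 0 and 1 into the range of `opposite-from-1`.
      opposite : ∀ k → Opposite k
      opposite k with m≤n⇒∃[o]m+o≡n 2≤N
      ... | j , e = Opposite-period (subst Opposite (trans (sym (+-assoc 2 j k)) (cong (_+ k) e)) (opposite-from-1 (j + k)))

      flat-at : ∀ k → Flat (p k)
      flat-at k = proj₁ (opposite k)

      inLayer : ℕ → Fin n → Bool
      inLayer k z = p k z ≡ᵇ 0

      size : ℕ → ℕ
      size k = count (inLayer k)

      size-period : ∀ k → size (N + k) ≡ size k
      size-period k = sum-cong-≗ (λ z → cong (λ q → 𝟙 (q ≡ᵇ 0)) (period k z))

      size-single : ∀ j k → j < N → Single (p k) j → size (j + k) ≡ 1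
      size-single j k j<N single = let w , pw = occupied (j + k) in
        count-unique (inLayer (j + k)) w (≡ᵇ-intro _ 0 pw)
          (λ z e → single (layer-elim j k z j<N (≡ᵇ-true _ 0 e)) (layer-elim j k w j<N pw))

      size-pos : ∀ k → 1 ≤ size k
      size-pos k = let w , pw = occupied k in count-pos (inLayer k) w (≡ᵇ-intro _ 0 pw)

      -- Opposite vertices u, v have d(u,z) + d(v,z) = h, apart from corrections in their own layers.
      module Pair (k : ℕ) {u v} (pu : p k u ≡ 0) (pv : p (h + k) v ≡ 0) where
        Lᵤ = rotated k L
        Lᵥ = rotated (h + k) L

        own : Fin n → ℕ
        own z = 𝟙 (inLayer k z) + 𝟙 (inLayer k z) + (𝟙 (inLayer (h + k) z) + 𝟙 (inLayer (h + k) z))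

        own-at : ∀ z {q r} → p k z ≡ q → p (h + k) z ≡ r →
                 own z ≡ 𝟙 (q ≡ᵇ 0) + 𝟙 (q ≡ᵇ 0) + (𝟙 (r ≡ᵇ 0) + 𝟙 (r ≡ᵇ 0))
        own-at z refl refl = refl

        h<N : h < N
        h<N = S₁.h<N
          where open Advance inv₁

        pkv : p k v ≡ h
        pkv = layer-elim h k v h<N pv

        1≤h : 1 ≤ h
        1≤h = <⇒≤ 2≤h

        0≢h : 0 ≢ h
        0≢h e = contradiction (subst (1 ≤_) (sym e) 1≤h) λ ()

        offset : ∀ z → (p k z ≡ h + p (h + k) z) ⊎ (p k z < h × p (h + k) z ≡ h + p k z)
        offset z with rots-value N h (p k z) (p<N k z) (<⇒≤ h<N)
        ... | inj₁ e        = inj₁ (trans e (cong (h +_) (sym (p-+ h k z))))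
        ... | inj₂ (lt , e) = inj₂ (lt , +-cancelˡ-≡ h _ _ (trans (cong (h +_) (p-+ h k z)) (trans (sym e) (+-assoc h h (p k z)))))

        own-layer : ∀ z {x y i j} → d u z ≡ x → d v z ≡ y → spike u z ≡ i → spike v z ≡ j → x + y + (i + j) ≡ h + 2 →
                    own z ≡ 2 → d u z + d v z + (spike u z + spike v z) ≡ h + own z
        own-layer z refl refl refl refl e o = trans e (cong (h +_) (sym o))

        at-u : ∀ z → p k z ≡ 0 → p (h + k) z ≡ h → d u z + d v z + (spike u z + spike v z) ≡ h + own z
        at-u z pz pz′ = go (same? z u)
          where
          dv : d v z ≡ h
          dv = trans (exact-ahead Lᵥ (proj₂ (opposite k)) pv (subst (1 ≤_) (sym pz′) 1≤h) (≤-reflexive pz′)) pz′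
          z≢v : z ≢ v
          z≢v z≡v = 0≢h (trans (sym pz) (trans (cong (p k) z≡v) pkv))
          own≡2 : own z ≡ 2
          own≡2 rewrite own-at z pz pz′ | ≡ᵇ-false h 0 (0≢h ∘ sym) = refl
          go : z ≡ u ⊎ z ≢ u → d u z + d v z + (spike u z + spike v z) ≡ h + own z
          go (inj₁ z≡u) = own-layer z (trans (cong (d u) z≡u) (d-refl u)) dv (spike-same z≡u) (spike-diff z≢v) refl own≡2
          go (inj₂ z≢u) = own-layer z (exact-same Lᵤ (flat-at k) pu pz z≢u) dv (spike-diff z≢u) (spike-diff z≢v)
                            (trans (+-identityʳ (2 + h)) (+-comm 2 h)) own≡2

        at-v : ∀ z → p k z ≡ h → p (h + k) z ≡ 0 → d u z + d v z + (spike u z + spike v z) ≡ h + own z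
        at-v z pz pz′ = go (same? z v)
          where
          du : d u z ≡ h
          du = trans (exact-ahead Lᵤ (flat-at k) pu (subst (1 ≤_) (sym pz) 1≤h) (≤-reflexive pz)) pz
          z≢u : z ≢ u
          z≢u z≡u = 0≢h (trans (sym pu) (trans (cong (p k) (sym z≡u)) pz))
          own≡2 : own z ≡ 2
          own≡2 rewrite own-at z pz pz′ | ≡ᵇ-false h 0 (0≢h ∘ sym) = refl
          go : z ≡ v ⊎ z ≢ v → d u z + d v z + (spike u z + spike v z) ≡ h + own z
          go (inj₁ z≡v) = own-layer z du (trans (cong (d v) z≡v) (d-refl v)) (spike-diff z≢u) (spike-same z≡v) (cong (_+ 2) (+-identityʳ h)) own≡2
          go (inj₂ z≢v) = own-layer z du (exact-same Lᵥ (proj₂ (opposite k)) pv pz′ z≢v) (spike-diff z≢u) (spike-diff z≢v)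
                            (+-identityʳ (h + 2)) own≡2

        elsewhere : ∀ z → p k z ≢ 0 → p (h + k) z ≢ 0 → d u z + d v z ≡ h →
                    d u z + d v z + (spike u z + spike v z) ≡ h + own z
        elsewhere z ne ne′ e = cong₂ _+_ e (trans spikes (sym owns))
          where
          spikes : spike u z + spike v z ≡ 0
          spikes = cong₂ _+_ (spike-diff (λ z≡u → ne (trans (cong (p k) z≡u) pu))) (spike-diff (λ z≡v → ne′ (trans (cong (p (h + k)) z≡v) pv)))
          owns : own z ≡ 0
          owns rewrite ≡ᵇ-false (p k z) 0 ne | ≡ᵇ-false (p (h + k) z) 0 ne′ = refl

        pointwise : ∀ z → d u z + d v z + (spike u z + spike v z) ≡ h + own z
        pointwise z with offset z | p k z ≟ℕ 0 | p (h + k) z ≟ℕ 0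
        ... | inj₂ (lt , e) | yes q0 | _     = at-u z q0 (trans e (trans (cong (h +_) q0) (+-identityʳ h)))
        ... | inj₁ e        | _      | yes r0 = at-v z (trans e (trans (cong (h +_) r0) (+-identityʳ h))) r0
        ... | inj₁ e        | yes q0 | no r≢0 = contradiction (subst (1 ≤_) (trans (sym e) q0) (≤-trans 1≤h (m≤m+n h _))) λ ()
        ... | inj₂ (lt , e) | no q≢0 | yes r0 = contradiction (subst (1 ≤_) (trans (sym e) r0) (≤-trans 1≤h (m≤m+n h _))) λ ()
        ... | inj₂ (lt , e) | no q≢0 | no r≢0 = elsewhere z q≢0 r≢0 (≤-antisym
              (linear 5 (λ h x y q r →
                    (x := q) ∷ (y :+ r := h :+ h) ∷ (h :+ q := r) ∷ [] ⊢ x :+ y ≤ h) refl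
                      h (d u z) (d v z) (p k z) (p (h + k) z) du dv (sym e))
              (linear 5 (λ h x y q r →
                    (q := x) ∷ (h :+ h := y :+ r) ∷ (r := h :+ q) ∷ [] ⊢ h ≤ x :+ y) refl
                      h (d u z) (d v z) (p k z) (p (h + k) z) (sym du) (sym dv) e))
          where
          du : d u z ≡ p k z
          du = exact-ahead Lᵤ (flat-at k) pu (n≢0⇒n>0 q≢0) (<⇒≤ lt)
          dv : d v z + p (h + k) z ≡ N
          dv = exact-back Lᵥ (proj₂ (opposite k)) pv (subst (h ≤_) (sym e) (m≤m+n h _))
        ... | inj₁ e        | no q≢0 | no r≢0 = elsewhere z q≢0 r≢0 (≤-antisym
              (linear 5 (λ h x y q r →
                    (x :+ q := h :+ h) ∷ (y := r) ∷ (h :+ r := q) ∷ [] ⊢ x :+ y ≤ h) refl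
                      h (d u z) (d v z) (p k z) (p (h + k) z) du dv (sym e))
              (linear 5 (λ h x y q r →
                    (h :+ h := x :+ q) ∷ (r := y) ∷ (q := h :+ r) ∷ [] ⊢ h ≤ x :+ y) refl
                      h (d u z) (d v z) (p k z) (p (h + k) z) (sym du) (sym dv) e))
          where
          du : d u z + p k z ≡ N
          du = exact-back Lᵤ (flat-at k) pu (subst (h ≤_) (sym e) (m≤m+n h _))
          dv : d v z ≡ p (h + k) z
          dv = exact-ahead Lᵥ (proj₂ (opposite k)) pv (n≢0⇒n>0 r≢0)
                 (linear 3 (λ h q r →
                       (h :+ r := q) ∷ (con 1 :+ q :≤ h :+ h) ∷ [] ⊢ r ≤ h) refl
                         h (p k z) (p (h + k) z) (sym e) (p<N k z))

        total : sum (d u) + sum (d v) + 4 ≡ n * h + (size k + size k + (size (h + k) + size (h + k)))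
        total = begin
          sum (d u) + sum (d v) + 4
            ≡⟨ cong₂ _+_ (sym (∑-distrib-+ (d u) (d v))) (sym (trans (∑-distrib-+ (spike u) (spike v)) (cong₂ _+_ (sum-spike u) (sum-spike v)))) ⟩
          sum (λ z → d u z + d v z) + sum (λ z → spike u z + spike v z)
            ≡⟨ sym (∑-distrib-+ (λ z → d u z + d v z) (λ z → spike u z + spike v z)) ⟩
          sum (λ z → d u z + d v z + (spike u z + spike v z))
            ≡⟨ sum-cong-≗ pointwise ⟩
          sum (λ z → h + own z)
            ≡⟨ ∑-distrib-+ (λ _ → h) own ⟩
          sum {n} (λ _ → h) + sum own
            ≡⟨ cong₂ _+_ (sum-const n h) (trans (∑-distrib-+ (λ z → 𝟙 (inLayer k z) + 𝟙 (inLayer k z)) _)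
                 (cong₂ _+_ (∑-distrib-+ (𝟙 ∘ inLayer k) _) (∑-distrib-+ (𝟙 ∘ inLayer (h + k)) _))) ⟩
          n * h + (size k + size k + (size (h + k) + size (h + k))) ∎
          where open ≡-Reasoning

      double-injective : ∀ {i j} → i + i ≡ j + j → i ≡ j
      double-injective {zero}  {zero}  e = refl
      double-injective {suc i} {suc j} e = cong suc (double-injective
        (suc-injective (suc-injective (trans (cong suc (sym (+-suc i i))) (trans e (cong suc (+-suc j j)))))))

      -- The left side of `Pair.total` does not depend on k, because transmissions are constant.
      size-opposite : ∀ k l → size k + size (h + k) ≡ size l + size (h + l)
      size-opposite k l = double-injective (trans (lemma (size k) (size (h + k))) (trans middle (sym (lemma (size l) (size (h + l))))))
        where
        lemma : ∀ i j → i + j + (i + j) ≡ i + i + (j + j)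
        lemma = solve-∀
        uk = occupied k
        vk = occupied (h + k)
        ul = occupied l
        vl = occupied (h + l)
        middle : size k + size k + (size (h + k) + size (h + k)) ≡ size l + size l + (size (h + l) + size (h + l))
        middle = +-cancelˡ-≡ (n * h) _ _ (trans (sym (Pair.total k (proj₂ uk) (proj₂ vk)))
          (trans (cong (_+ 4) (cong₂ _+_ (regular _ _) (regular _ _))) (Pair.total l (proj₂ ul) (proj₂ vl))))

      m : ℕ
      m = size 1

      1+h<N : suc h < N
      1+h<N = Advance.S₁.1+h<N inv₁

      size-3 : ∀ i → size (3 + i * 4) ≡ 1
      size-3 i = size-single 2 (1 + i * 4) (≤-trans (s≤s 2≤h) (<⇒≤ 1+h<N)) (Advance.single-2 (inv i))

      size-4 : 3 ≤ h → ∀ i → size (4 + i * 4) ≡ 1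
      size-4 3≤h i = size-single 3 (1 + i * 4) (≤-trans (s≤s 3≤h) (<⇒≤ 1+h<N)) (Advance.single-3 (inv i))

      size-1+h : ∀ i → size (h + (1 + i * 4)) ≡ 1
      size-1+h i = size-single h (1 + i * 4) (<⇒≤ 1+h<N) (Inv.single₀ (inv i))

      size-2+h : ∀ i → size (h + (2 + i * 4)) ≡ 1
      size-2+h i = trans (cong size (+-suc h (1 + i * 4))) (size-single (suc h) (1 + i * 4) 1+h<N (Inv.single₁ (inv i)))

      size-from-opposite : ∀ k → size (h + k) ≡ 1 → size k ≡ m
      size-from-opposite k e = +-cancelʳ-≡ 1 _ _ (begin
        size k + 1             ≡⟨ cong (size k +_) (sym e) ⟩
        size k + size (h + k)  ≡⟨ size-opposite k 1 ⟩
        m + size (h + 1)       ≡⟨ cong (m +_) (size-1+h 0) ⟩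
        m + 1                  ∎)
        where open ≡-Reasoning

      -- `inv i` makes layers 3 + 4i and 4 + 4i single, and also layers h + 1 + 4i and h + 2 + 4i.
      -- Opposite sizes add up to m + 1, so layers 1 + 4i and 2 + 4i have size m.
      sizes : 3 ≤ h → ∀ k → size (suc k) ≡ fW m (suc k)
      sizes 3≤h k = subst (λ j → size (suc j) ≡ fW m (suc j)) (sym (m≡m%n+[m/n]*n k 4)) (go (k % 4) (m%n<n k 4))
        where
        i = k / 4
        go : ∀ r → r < 4 → size (suc r + i * 4) ≡ fW m (suc r + i * 4)
        go 0 _ = trans (size-from-opposite (1 + i * 4) (size-1+h i)) (sym (fW-shift m 1 i))
        go 1 _ = trans (size-from-opposite (2 + i * 4) (size-2+h i)) (sym (fW-shift m 2 i))
        go 2 _ = trans (size-3 i) (sym (fW-shift m 3 i))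
        go 3 _ = trans (size-4 3≤h i) (sym (fW-shift m 4 i))
        go (suc (suc (suc (suc _)))) (s≤s (s≤s (s≤s (s≤s ()))))

∸-suc : ∀ {m n} → suc m ≤ n → n ∸ m ≡ suc (n ∸ suc m)
∸-suc (s≤s m≤n) = +-∸-assoc 1 m≤n

-- The layering obtained from the cut

module Build {n : ℕ} {_~_ : Fin n → Fin n → Set} (R : Regular n _~_) where
  open Regular R
  open Cuts R
  open Halves R

  module FromCut {a b} (cut : Cut a b) {c e} (crossing : Core.Crossing cut c e) where
    open Core cut
    open Crossing crossing
    open Balance cut crossing using (complete)
    module A-half = Half cut crossing
    module B-half = Half (flip cut) (flip-crossing cut crossing)
    open A-half using (stay; enter; cross)
    module B = Core (flip cut)

    -- The cycle consists of t steps from `c` to `a`, 3 through `A`, t from `b` to `e`, and the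
    -- crossing: N = 2t + 4.
    t h : ℕ
    t = α c
    h = 2 + t

    2≤h : 2 ≤ h
    2≤h = s≤s (s≤s z≤n)

    3≤h : 3 ≤ h
    3≤h = s≤s (s≤s (d-pos (A-half.c≢a ∘ sym)))

    open Layers R h 2≤h

    -- Positions increase from c (position 0) along geodesics to a, through A to b, and
    -- along geodesics to e (position N - 1).
    data Kind (z : Fin n) : Set where
      inA   : A z ≡ true → Kind z
      nearA : NearA z → Kind z
      nearB : B.NearA z → Kind z

    kind : ∀ z → Kind z
    kind z with bool-cases (A z)
    ... | inj₁ z∈A = inA z∈A
    ... | inj₂ z∉A = [ (λ lt → nearA (z∉A , lt)) , (λ gt → nearB (z∉A , gt)) ]′ (gap z)

    place : ∀ {z} → Kind z → ℕ
    place {z} (inA _)   = t + α z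
    place {z} (nearA _) = t ∸ α z
    place {z} (nearB _) = t + (3 + β z)

    pos : Fin n → ℕ
    pos z = place (kind z)

    -- The three kinds exclude one another and `place` ignores their proofs, so any known kind
    -- computes `pos`.
    pos-kind : ∀ {z} (k : Kind z) → pos z ≡ place k
    pos-kind {z} k = go (kind z) k
      where
      go : ∀ (k k′ : Kind z) → place k ≡ place k′
      go (inA _)         (inA _)         = refl
      go (nearA _)       (nearA _)       = refl
      go (nearB _)       (nearB _)       = refl
      go (inA p)         (nearA (q , _)) = contradiction q (true≢false p)
      go (inA p)         (nearB (q , _)) = contradiction q (true≢false p)
      go (nearA (q , _)) (inA p)         = contradiction q (true≢false p)
      go (nearB (q , _)) (inA p)         = contradiction q (true≢false p)
      go (nearA (_ , p)) (nearB (_ , q)) = contradiction q (<-asym p)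
      go (nearB (_ , p)) (nearA (_ , q)) = contradiction q (<-asym p)

    α≤t : ∀ {z} → NearA z → α z ≤ t
    α≤t = A-half.α≤t

    β≤t : ∀ {z} → B.NearA z → β z ≤ t
    β≤t {z} near = subst (β z ≤_) β-e (B-half.α≤t near)

    A-α≤2 : ∀ {z} → A z ≡ true → α z ≤ 2
    A-α≤2 z∈A with A-side z∈A
    ... | inj₁ (e , _) = ≤-trans (≤-reflexive e) (s≤s z≤n)
    ... | inj₂ (e , _) = ≤-reflexive e

    pos<N : ∀ z → pos z < N
    pos<N z with kind z
    ... | inA z∈A   = linear 2 (λ t q →
          (q :≤ con 2) ∷ [] ⊢ con 1 :+ (t :+ q) ≤ con 2 :+ t :+ (con 2 :+ t)) refl
            t (α z) (A-α≤2 z∈A)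
    ... | nearA near = linear 2 (λ t q →
          (q :≤ t) ∷ [] ⊢ con 1 :+ q ≤ con 2 :+ t :+ (con 2 :+ t)) refl
            t (t ∸ α z) (m∸n≤m t (α z))
    ... | nearB near = linear 2 (λ t q →
          (q :≤ t) ∷ [] ⊢ con 1 :+ (t :+ (con 3 :+ q)) ≤ con 2 :+ t :+ (con 2 :+ t)) refl
            t (β z) (β≤t near)

    nearB-b : B.NearA b
    nearB-b = B.nearA-a

    pos-a : pos a ≡ t
    pos-a = trans (pos-kind (nearA nearA-a)) (cong (t ∸_) (d-refl a))

    pos-b : pos b ≡ t + 3
    pos-b = trans (pos-kind (nearB nearB-b)) (cong (λ k → t + (3 + k)) (d-refl b))

    pos-c : pos c ≡ 0
    pos-c = trans (pos-kind (nearA A-half.nearA-c)) (n∸n≡0 t)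

    pos-e : suc (pos e) ≡ N
    pos-e = trans (cong suc (trans (pos-kind (nearB (e∉A , e-b))) (cong (λ k → t + (3 + k)) β-e)))
              (≤-antisym (linear 1 (λ t →
                    [] ⊢ con 1 :+ (t :+ (con 3 :+ t)) ≤ con 2 :+ t :+ (con 2 :+ t)) refl
                      t)
                         (linear 1 (λ t →
                               [] ⊢ con 2 :+ t :+ (con 2 :+ t) ≤ con 1 :+ (t :+ (con 3 :+ t))) refl
                                 t))

    up-A : ∀ {u v} → A u ≡ true → A v ≡ true → α v ≡ suc (α u) → Next N (pos u) (pos v)
    up-A u∈A v∈A e = inj₁ (trans (pos-kind (inA v∈A)) (trans (cong (t +_) e) (trans (+-suc t _) (cong suc (sym (pos-kind (inA u∈A)))))))

    up-nearA : ∀ {u v} → NearA u → NearA v → α u ≡ suc (α v) → Next N (pos u) (pos v)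
    up-nearA {u} {v} nu nv e = inj₁ (trans (pos-kind (nearA nv))
      (trans (∸-suc (subst (_≤ t) e (α≤t nu))) (cong suc (trans (cong (t ∸_) (sym e)) (sym (pos-kind (nearA nu)))))))

    up-nearB : ∀ {u v} → B.NearA u → B.NearA v → β v ≡ suc (β u) → Next N (pos u) (pos v)
    up-nearB nu nv e = inj₁ (trans (pos-kind (nearB nv)) (trans (cong (λ k → t + (3 + k)) e) (trans (+-suc t _) (cong suc (sym (pos-kind (nearB nu)))))))

    up-a : ∀ {v} → A v ≡ true → α v ≡ 1 → Next N (pos a) (pos v)
    up-a v∈A e = inj₁ (trans (pos-kind (inA v∈A)) (trans (cong (t +_) e) (trans (+-comm t 1) (cong suc (sym pos-a)))))

    up-b : ∀ {u} → A u ≡ true → α u ≡ 2 → Next N (pos u) (pos b)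
    up-b u∈A e = inj₁ (trans pos-b (trans (+-suc t 2) (cong suc (sym (trans (pos-kind (inA u∈A)) (cong (t +_) e))))))

    wrap : ∀ {u v} → v ≡ c → B.NearA u → β u ≡ t → Next N (pos u) (pos v)
    wrap {u} refl near e′ = inj₂ (trans (cong suc (trans (pos-kind (nearB near)) (trans (cong (λ k → t + (3 + k)) (trans e′ (sym β-e))) (sym (pos-kind (nearB (e∉A , e-b))))))) pos-e , pos-c)

    α-of-a : ∀ {u} → A u ≡ true → a ~ u → α u ≡ 1
    α-of-a u∈A a~u = ≤-antisym (~⇒d≤1 a~u) (d-pos λ { refl → true≢false u∈A a∉A })

    α-of-b : ∀ {u} → A u ≡ true → b ~ u → α u ≡ 2
    α-of-b {u} u∈A b~u with A-side u∈A
    ... | inj₁ (_ , e) = contradiction (subst (_≤ 1) e (~⇒d≤1 b~u)) 1+n≰n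
    ... | inj₂ (e , _) = e

    consecutive : ∀ {u v} → u ~ v → Next N (pos u) (pos v) ⊎ Next N (pos v) (pos u)
    consecutive {u} {v} u~v = go (kind u) (kind v) u~v
      where
      A-nearA : ∀ {u v} → A u ≡ true → NearA v → u ~ v → Next N (pos v) (pos u)
      A-nearA u∈A near u~v with A-half.neighbour near (~-sym u~v)
      ... | stay (u∉A , _)      = contradiction u∉A (true≢false u∈A)
      ... | cross _ cr          = contradiction (Crossing.e∉A cr) (true≢false u∈A)
      ... | enter _ refl        = up-a u∈A (α-of-a u∈A (~-sym u~v))
      A-nearB : ∀ {u v} → A u ≡ true → B.NearA v → u ~ v → Next N (pos u) (pos v)
      A-nearB u∈A near u~v with B-half.neighbour near (~-sym u~v)
      ... | B-half.stay (u∉A , _) = contradiction u∉A (true≢false u∈A)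
      ... | B-half.cross _ cr     = contradiction (B.Crossing.e∉A cr) (true≢false u∈A)
      ... | B-half.enter _ refl   = up-b u∈A (α-of-b u∈A (~-sym u~v))
      across : ∀ {u v} → NearA u → B.NearA v → u ~ v → Next N (pos v) (pos u)
      across nu nv u~v with A-half.neighbour nu u~v
      ... | stay (_ , lt) = contradiction (proj₂ nv) (<-asym lt)
      ... | enter v∈A _   = contradiction (proj₁ nv) (true≢false v∈A)
      ... | cross refl cr = wrap refl nv (Crossing.β-e cr)
      go : ∀ {u v} → Kind u → Kind v → u ~ v → Next N (pos u) (pos v) ⊎ Next N (pos v) (pos u)
      go {u} {v} (inA p) (inA q) u~v with d-edgeʳ u~v a
      ... | inj₁ e′ = inj₂ (up-A q p e′)
      ... | inj₂ e′ = inj₁ (up-A p q e′)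
      go (inA p) (nearA q) u~v = inj₂ (A-nearA p q u~v)
      go (nearA q) (inA p) u~v = inj₁ (A-nearA p q (~-sym u~v))
      go (inA p) (nearB q) u~v = inj₁ (A-nearB p q u~v)
      go (nearB q) (inA p) u~v = inj₂ (A-nearB p q (~-sym u~v))
      go (nearA p) (nearB q) u~v = inj₂ (across p q u~v)
      go (nearB q) (nearA p) u~v = inj₁ (across p q (~-sym u~v))
      go (nearA p) (nearA q) u~v with d-edgeʳ u~v a
      ... | inj₁ e′ = inj₁ (up-nearA p q e′)
      ... | inj₂ e′ = inj₂ (up-nearA q p e′)
      go (nearB p) (nearB q) u~v with d-edgeʳ u~v b
      ... | inj₁ e′ = inj₂ (up-nearB q p e′)
      ... | inj₂ e′ = inj₁ (up-nearB p q e′)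

    next : ∀ u → ∃[ v ] (u ~ v × Next N (pos u) (pos v))
    next u = go u (kind u)
      where
      go : ∀ u → Kind u → ∃[ v ] (u ~ v × Next N (pos u) (pos v))
      go u (inA u∈A) with A-side u∈A
      ... | inj₁ (αu , _) =
        let y , rung = rung-from u∈A αu
            open Rung rung
        in
              y , x~y , up-A u∈A y∈A (trans αy (cong suc (sym αu)))
      ... | inj₂ (αu , βu) = b , ~-sym (d≤1⇒~ (λ { refl → true≢false u∈A b∉A }) (≤-reflexive βu)) , up-b u∈A αu
      go u (nearA near) with same? u a
      ... | inj₁ refl =
        let x , y , rung = rung-exists
            open Rung rung
        in x , a~x , up-a x∈A αx
      ... | inj₂ u≢a  = let w , u~w , nw , e′ = A-half.toward-a near u≢a in w , u~w , up-nearA near nw e′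
      go u (nearB near) with same? u e
      ... | inj₁ refl = c , ~-sym c~e , wrap refl near β-e
      ... | inj₂ u≢e  = let w , u~w , nw , e′ = B-half.toward-c near u≢e in w , u~w , up-nearB near nw e′

    prev : ∀ u → ∃[ v ] (u ~ v × Next N (pos v) (pos u))
    prev u = go u (kind u)
      where
      go : ∀ u → Kind u → ∃[ v ] (u ~ v × Next N (pos v) (pos u))
      go u (inA u∈A) with A-side u∈A
      ... | inj₁ (αu , _) = a , ~-sym (d≤1⇒~ (λ { refl → true≢false u∈A a∉A }) (≤-reflexive αu)) , up-a u∈A αu
      ... | inj₂ (αu , βu) =
        let x , rung = B.rung-from u∈A βu
            open B.Rung rung
        in
              x , x~y , up-A y∈A u∈A (trans αu (cong suc (sym βy)))
      go u (nearA near) with same? u c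
      ... | inj₁ refl = e , c~e , wrap refl (e∉A , e-b) β-e
      ... | inj₂ u≢c  = let w , u~w , nw , e′ = A-half.toward-c near u≢c in w , u~w , up-nearA nw near e′
      go u (nearB near) with same? u b
      ... | inj₁ refl =
        let x , y , rung = rung-exists
            open Rung rung
        in y , b~y , up-b y∈A αy
      ... | inj₂ u≢b  = let w , u~w , nw , e′ = B-half.toward-a near u≢b in w , u~w , up-nearB nw near e′

    layering₀ : Layering
    layering₀ = record { pos = pos ; pos<N = pos<N ; consecutive = consecutive ; next = next ; prev = prev }

    -- layer 0 is {a} and layer 1 consists of the neighbours of a in A
    layering : Layering
    layering = rotated t layering₀

    open Chains R h 2≤h
    open Chain layering a

    p1 : ∀ z → p 1 z ≡ rots N (suc t) (pos z)
    p1 z = cong (rot N) (rotated-pos t)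
      where
      rotated-pos : ∀ k → Layering.pos (rotated k layering₀) z ≡ rots N k (pos z)
      rotated-pos zero    = refl
      rotated-pos (suc k) = cong (rot N) (rotated-pos k)

    p1-value : ∀ z → (pos z ≡ suc t + p 1 z) ⊎ (pos z < suc t × N + pos z ≡ suc t + p 1 z)
    p1-value z = subst (λ r → (pos z ≡ suc t + r) ⊎ (pos z < suc t × N + pos z ≡ suc t + r)) (sym (p1 z))
      (rots-value N (suc t) (pos z) (pos<N z) (linear 1 (λ t →
            [] ⊢ con 1 :+ t ≤ con 2 :+ t :+ (con 2 :+ t)) refl
              t))

    p1-A : ∀ {z} → A z ≡ true → suc (p 1 z) ≡ α z
    p1-A {z} z∈A with p1-value z
    ... | inj₁ v = +-cancelˡ-≡ t _ _ (trans (+-suc t (p 1 z)) (trans (sym v) (pos-kind (inA z∈A))))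
    ... | inj₂ (lt , _) = contradiction
      (linear 3 (λ t q r →
            (con 1 :+ r :≤ con 1 :+ t) ∷ (t :+ q := r) ∷ (con 1 :≤ q) ∷ [] ⊢ con 1 ≤ con 0) refl
        t (α z) (pos z) lt (sym (pos-kind (inA z∈A))) (d-pos λ { refl → true≢false z∈A a∉A })) λ ()

    p1-B : ∀ {z} → B.NearA z → p 1 z ≡ 2 + β z
    p1-B {z} near with p1-value z
    ... | inj₁ v = +-cancelˡ-≡ (suc t) _ _ (trans (sym v) (trans (pos-kind (nearB near)) (+-suc t (2 + β z))))
    ... | inj₂ (lt , _) = contradiction
      (linear 3 (λ t q r → (con 1 :+ r :≤ con 1 :+ t) ∷ (t :+ (con 3 :+ q) := r) ∷ [] ⊢ con 1 ≤ con 0) refl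
        t (β z) (pos z) lt (sym (pos-kind (nearB near)))) λ ()

    p1-nearA : ∀ {z} → NearA z → p 1 z + α z ≡ 3 + (t + t)
    p1-nearA {z} near with p1-value z
    ... | inj₁ v = contradiction
      (linear 4 (λ t q r s → (con 1 :+ t :+ s := r) ∷ (r := q) ∷ (q :≤ t) ∷ [] ⊢ con 1 ≤ con 0) refl
        t (t ∸ α z) (pos z) (p 1 z) (sym v) (pos-kind (nearA near)) (m∸n≤m t (α z))) λ ()
    ... | inj₂ (_ , v) = ≤-antisym
      (linear 5 (λ t q a r s →
            (con 1 :+ t :+ s := con 2 :+ t :+ (con 2 :+ t) :+ r) ∷ (r := q) ∷ (q :+ a := t) ∷ []
            ⊢ s :+ a ≤ con 3 :+ (t :+ t)) refl
        t (t ∸ α z) (α z) (pos z) (p 1 z) (sym v) (pos-kind (nearA near)) (m∸n+n≡m (α≤t near)))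
      (linear 5 (λ t q a r s →
            (con 2 :+ t :+ (con 2 :+ t) :+ r := con 1 :+ t :+ s) ∷ (q := r) ∷ (t := q :+ a) ∷ []
            ⊢ con 3 :+ (t :+ t) ≤ s :+ a) refl
        t (t ∸ α z) (α z) (pos z) (p 1 z) v (sym (pos-kind (nearA near))) (sym (m∸n+n≡m (α≤t near))))

    nearA-far : ∀ {z} → NearA z → 3 + t ≤ p 1 z
    nearA-far {z} near = linear 3 (λ t q s →
          (con 3 :+ (t :+ t) := s :+ q) ∷ (q :≤ t) ∷ [] ⊢ con 3 :+ t ≤ s) refl
      t (α z) (p 1 z) (sym (p1-nearA near)) (α≤t near)

    A-close : ∀ {z} → A z ≡ true → p 1 z ≤ 1
    A-close z∈A = ≤-pred (≤-trans (≤-reflexive (p1-A z∈A)) (A-α≤2 z∈A))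

    -- Layers 1 and 2 are the two parts of `A`, and layers h + 1 and h + 2 are those of `e` and `c`.
    -- From layer 1, layer 2 is reached by the complete join, the vertices nearer to `b` through
    -- `b`, and those nearer to `a` through `a`.
    inv₁ : Inv 1
    inv₁ = record
      { flat    = record { same = same ; ahead = ahead ; back = back }
      ; single₀ = λ {z} {z′} q q′ → trans (only-e z q) (sym (only-e z′ q′))
      ; single₁ = λ {z} {z′} q q′ → trans (only-c z q) (sym (only-c z′ q′))
      }
      where
      first-layer : ∀ {u} → p 1 u ≡ 0 → A u ≡ true × α u ≡ 1
      first-layer {u} e with kind u
      ... | inA u∈A    = u∈A , trans (sym (p1-A u∈A)) (cong suc e)
      ... | nearA near = contradiction (subst (3 + t ≤_) e (nearA-far near)) λ ()
      ... | nearB near = contradiction (trans (sym (p1-B near)) e) λ ()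

      u-a : ∀ {u} → p 1 u ≡ 0 → d u a ≡ 1
      u-a {u} pu = trans (d-sym u a) (proj₂ (first-layer pu))

      u-b : ∀ {u} → p 1 u ≡ 0 → d u b ≡ 2
      u-b {u} pu with A-side (proj₁ (first-layer pu))
      ... | inj₁ (_ , e) = trans (d-sym u b) e
      ... | inj₂ (e , _) = contradiction (trans (sym e) (proj₂ (first-layer pu))) λ ()

      same : ∀ {u z} → p 1 u ≡ 0 → p 1 z ≡ 0 → d u z ≤ 2
      same {u} {z} pu pz = subst₂ (λ i j → d u z ≤ i + j) (u-a pu) (proj₂ (first-layer pz)) (d-triangle u a z)

      ahead : ∀ {u z} → p 1 u ≡ 0 → 1 ≤ p 1 z → p 1 z ≤ h → d u z ≤ p 1 z
      ahead {u} {z} pu 1≤q q≤h with kind z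
      ... | nearA near = contradiction q≤h (<⇒≱ (nearA-far near))
      ... | nearB near = subst (d u z ≤_) (sym (p1-B near)) (subst (λ i → d u z ≤ i + β z) (u-b pu) (d-triangle u b z))
      ... | inA z∈A    = ≤-trans (~⇒d≤1 (complete (proj₁ (first-layer pu)) (proj₂ (first-layer pu)) z∈A
              (trans (sym (p1-A z∈A)) (cong suc (≤-antisym (A-close z∈A) 1≤q))))) 1≤q

      back : ∀ {u z} → p 1 u ≡ 0 → h ≤ p 1 z → d u z + p 1 z ≤ N
      back {u} {z} pu h≤q with kind z
      ... | inA z∈A    = contradiction (≤-trans (s≤s (s≤s z≤n)) (≤-trans h≤q (A-close z∈A))) 1+n≰n
      ... | nearB near = linear 4 (λ t q r x →
            (x :≤ con 2 :+ q) ∷ (r := con 2 :+ q) ∷ (q :≤ t) ∷ (q :≤ t) ∷ []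
            ⊢ x :+ r ≤ con 2 :+ t :+ (con 2 :+ t)) refl
              t (β z) (p 1 z) (d u z) (subst (λ i → d u z ≤ i + β z) (u-b pu) (d-triangle u b z)) (p1-B near) (β≤t near) (β≤t near)
      ... | nearA near = linear 4 (λ t q r x →
            (x :≤ con 1 :+ q) ∷ (r :+ q := con 3 :+ (t :+ t)) ∷ []
            ⊢ x :+ r ≤ con 2 :+ t :+ (con 2 :+ t)) refl
              t (α z) (p 1 z) (d u z) (subst (λ i → d u z ≤ i + α z) (u-a pu) (d-triangle u a z)) (p1-nearA near)

      only-e : ∀ z → p 1 z ≡ h → z ≡ e
      only-e z q with kind z
      ... | inA z∈A    = contradiction (≤-trans (s≤s (s≤s z≤n)) (≤-trans (≤-reflexive (sym q)) (A-close z∈A))) 1+n≰n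
      ... | nearA near = contradiction (≤-trans (nearA-far near) (≤-reflexive q)) 1+n≰n
      ... | nearB near = B-half.α≡t⇒c near (trans (suc-injective (suc-injective (trans (sym (p1-B near)) q))) (sym β-e))

      only-c : ∀ z → p 1 z ≡ suc h → z ≡ c
      only-c z q with kind z
      ... | inA z∈A    = contradiction (≤-trans (s≤s (s≤s z≤n)) (≤-trans (≤-reflexive (sym q)) (A-close z∈A))) 1+n≰n
      ... | nearB near = contradiction (≤-trans (≤-reflexive (suc-injective (suc-injective (trans (sym q) (p1-B near))))) (β≤t near)) 1+n≰n
      ... | nearA near = A-half.α≡t⇒c near (+-cancelˡ-≡ (suc h) _ _ (trans (cong (_+ α z) (sym q)) (p1-nearA near)))

-- From the 2-cut to the classification

-- Each strict increase uses one unit of fuel, and B - f 0 units are enough.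
stabilises : ∀ (f : ℕ → ℕ) B → (∀ k → f k ≤ B) → ∃[ k ] f (suc k) ≤ f k
stabilises f B bound = go B 0 (m≤m+n B _)
  where
  go : ∀ fuel k → B ≤ fuel + f k → ∃[ k ] f (suc k) ≤ f k
  go zero       k le = k , ≤-trans (bound (suc k)) le
  go (suc fuel) k le with f (suc k) ≤? f k
  ... | yes p = k , p
  ... | no ¬p = go fuel (suc k) (≤-trans le (≤-trans (≤-reflexive (sym (+-suc fuel (f k)))) (+-monoʳ-≤ fuel (≰⇒> ¬p))))

count≤n : ∀ {n} (p : Fin n → Bool) → count p ≤ n
count≤n {n} p = subst (count p ≤_) (trans (sum-const n 1) (*-identityʳ n)) (sum-mono (λ z → 𝟙≤1 (p z)))
  where
  𝟙≤1 : ∀ b → 𝟙 b ≤ 1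
  𝟙≤1 true  = ≤-refl
  𝟙≤1 false = z≤n

𝟙-mono : ∀ {b c} → (b ≡ true → c ≡ true) → 𝟙 b ≤ 𝟙 c
𝟙-mono {true}  f rewrite f refl = ≤-refl
𝟙-mono {false} f = z≤n

𝟙-reflects : ∀ {b c} → 𝟙 b ≤ 𝟙 c → b ≡ true → c ≡ true
𝟙-reflects {true} {true} _ _ = refl

count-stable : ∀ {n} (p q : Fin n → Bool) → (∀ z → p z ≡ true → q z ≡ true) → count q ≤ count p →
               ∀ z → q z ≡ true → p z ≡ true
count-stable p q p⇒q le z = 𝟙-reflects (sum-squeeze (λ z → 𝟙-mono (p⇒q z)) le z)

-- The sets of vertices reaching `y` in at most k steps grow with k. At stage `K` the next set is no
-- larger, so this set is closed under steps.
module Component (G : Graph) (A : Fin (n G) → Bool) (y : Fin (n G)) where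
  open Walks G A

  private
    stable = stabilises (λ k → count (λ z → reachIn G A k z y)) (n G) (λ k → count≤n _)

  K : ℕ
  K = proj₁ stable

  member : Fin (n G) → Bool
  member z = reachIn G A K z y

  member-y : member y ≡ true
  member-y = go K
    where
    go : ∀ k → reachIn G A k y y ≡ true
    go zero    = ==-refl y
    go (suc k) = reachIn-mono k (go k)

  member-step : ∀ {u w} → adj G u w ≡ true → A w ≡ true → member w ≡ true → member u ≡ true
  member-step {u} u~w Aw w∈ =
    count-stable _ _ (λ z → reachIn-mono K) (proj₂ stable) u (reachIn-step K u~w Aw w∈)

module CutOf (G : Graph) (connected : Connected G) (bipartite : Bipartite G) (balanced : DistanceBalanced G) where
  private
    R = graphRegular G connected bipartite balanced
    V = Fin (n G)
  open Regular R
  open Interval R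
  open Cuts R

  module _ {a b : V} (two : TwoCut G a b) (ab≡3 : dist G a b ≡ 3) where
    private
      allowed : V → Bool
      allowed z = not ((z == a) ∨ (z == b))

      x y : V
      x = proj₁ (proj₂ two)
      y = proj₁ (proj₂ (proj₂ two))

      x-allowed : allowed x ≡ true
      x-allowed = proj₁ (proj₂ (proj₂ (proj₂ two)))

      y-allowed : allowed y ≡ true
      y-allowed = proj₁ (proj₂ (proj₂ (proj₂ (proj₂ two))))

      apart : ∀ k → reachIn G allowed k x y ≡ false
      apart = proj₂ (proj₂ (proj₂ (proj₂ (proj₂ two))))

      open Component G allowed y

      a-removed : allowed a ≡ false
      a-removed rewrite ==-refl a = refl

      b-removed : allowed b ≡ false
      b-removed rewrite ==-refl b | ∨-zeroʳ (b == a) = refl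

      allowed⇒≢ : ∀ {z} → allowed z ≡ true → z ≢ a × z ≢ b
      allowed⇒≢ e = (λ { refl → true≢false e a-removed }) , (λ { refl → true≢false e b-removed })

      allowed? : ∀ z → allowed z ≡ true ⊎ z ≡ a ⊎ z ≡ b
      allowed? z with same? z a | same? z b
      ... | inj₁ e | _      = inj₂ (inj₁ e)
      ... | inj₂ _ | inj₁ e = inj₂ (inj₂ e)
      ... | inj₂ p | inj₂ q = inj₁ (cong₂ (λ i j → not (i ∨ j)) (≢⇒== p) (≢⇒== q))

      -- `reachIn` does not test its starting vertex, so `member` may hold at `a` or `b`; the factor
      -- `allowed` removes them.
      P Q : V → Bool
      P z = allowed z ∧ member z
      Q z = allowed z ∧ not (member z)

      P-intro : ∀ {z} → allowed z ≡ true → member z ≡ true → P z ≡ true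
      P-intro p q rewrite p | q = refl

      Q-intro : ∀ {z} → allowed z ≡ true → member z ≡ false → Q z ≡ true
      Q-intro p q rewrite p | q = refl

      P-elim : ∀ {z} → P z ≡ true → allowed z ≡ true × member z ≡ true
      P-elim {z} = ∧-true {allowed z}

      Q-elim : ∀ {z} → Q z ≡ true → allowed z ≡ true × member z ≡ false
      Q-elim {z} e with ∧-true {allowed z} e
      ... | p , q with member z
      ...   | false = p , refl

      P-piece : Piece a b P
      P-piece = record
        { a∉P = cong (_∧ member a) a-removed
        ; c∉P = cong (_∧ member b) b-removed
        ; separated = λ {u} {v} Pu u~v → sep (P-elim Pu) u~v (allowed? v)
        }
        where
        sep : ∀ {u v} → allowed u ≡ true × member u ≡ true → adj G u v ≡ true →
              allowed v ≡ true ⊎ v ≡ a ⊎ v ≡ b → P v ≡ true ⊎ v ≡ a ⊎ v ≡ b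
        sep (p , q) u~v (inj₂ r) = inj₂ r
        sep (p , q) u~v (inj₁ r) = inj₁ (P-intro r (member-step (~-sym u~v) p q))

      Q-piece : Piece a b Q
      Q-piece = record
        { a∉P = cong (_∧ not (member a)) a-removed
        ; c∉P = cong (_∧ not (member b)) b-removed
        ; separated = λ {u} {v} Qu u~v → sep (Q-elim Qu) u~v (allowed? v)
        }
        where
        sep : ∀ {u v} → allowed u ≡ true × member u ≡ false → adj G u v ≡ true →
              allowed v ≡ true ⊎ v ≡ a ⊎ v ≡ b → Q v ≡ true ⊎ v ≡ a ⊎ v ≡ b
        sep (p , q) u~v (inj₂ r) = inj₂ r
        sep (p , q) u~v (inj₁ r) = inj₁ (Q-intro r (¬true⇒false λ v∈ → true≢false (member-step u~v r v∈) q))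

      x∉ : member x ≡ false
      x∉ = apart K

      P-x : P x ≡ false
      P-x = trans (cong (allowed x ∧_) x∉) (∧-zeroʳ (allowed x))

      Q-y : Q y ≡ false
      Q-y = trans (cong (λ m → allowed y ∧ not m) member-y) (∧-zeroʳ (allowed y))

      -- The vertex `a` lies on neither side; counting it makes `Q` strictly smaller than the
      -- complement of `P`.
      Q-below : ∀ z → 𝟙 (Q z) + δ a z ≤ 𝟙 (not (P z))
      Q-below z with same? z a
      ... | inj₁ refl rewrite δ-same z | a-removed = ≤-refl
      ... | inj₂ z≢a rewrite δ-diff z≢a with allowed z | member z
      ...   | true  | true  = z≤n
      ...   | true  | false = ≤-refl
      ...   | false | _     = z≤n

      P⇒¬Q : ∀ z → P z ≡ true → not (Q z) ≡ true
      P⇒¬Q z e with allowed z | member z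
      ... | true | true = refl

    cut : Cut a b
    cut with count P <? count (not ∘ P)
    ... | yes small = record
      { A = P ; piece = P-piece ; small = small ; ab≡3 = ab≡3
      ; inside = y , P-intro y-allowed member-y
      ; outside = x , P-x , allowed⇒≢ x-allowed }
    ... | no ¬small = record
      { A = Q ; piece = Q-piece ; small = Q-small ; ab≡3 = ab≡3
      ; inside = x , Q-intro x-allowed x∉
      ; outside = y , Q-y , allowed⇒≢ y-allowed }
      where
      Q-small : count Q < count (not ∘ Q)
      Q-small = ≤-trans (≤-trans (≤-reflexive (sym (trans (∑-distrib-+ (𝟙 ∘ Q) (δ a)) (trans (cong (count Q +_) (sum-δ a)) (+-comm (count Q) 1)))))
                                 (sum-mono Q-below))
                        (≤-trans (≮⇒≥ ¬small) (sum-mono (λ z → 𝟙-mono (P⇒¬Q z))))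

-- From layers to an explicit isomorphism

true-irrelevant : ∀ {b} (e e′ : b ≡ true) → e ≡ e′
true-irrelevant refl refl = refl

bool-ext : ∀ {b c} → (b ≡ true → c ≡ true) → (c ≡ true → b ≡ true) → b ≡ c
bool-ext {true}  f g = sym (f refl)
bool-ext {false} {true}  f g = g refl
bool-ext {false} {false} f g = refl

module Fibres {n N : ℕ} (π : Fin n → Fin N) (F : Fin N → ℕ)
              (fibre-size : ∀ i → count (λ z → π z == i) ≡ F i) where

  private
    index : ∀ i z → (π z == i) ≡ true → Fin (F i)
    index i z e = cast (fibre-size i) (rank (λ z → π z == i) z e)

    point : ∀ i → Fin (F i) → ∃[ z ] (π z == i) ≡ true
    point i j = select (λ z → π z == i) (cast (sym (fibre-size i)) j)

    to : Fin n → Σ (Fin N) (Fin ∘ F)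
    to z = π z , index (π z) z (==-refl (π z))

    from : Σ (Fin N) (Fin ∘ F) → Fin n
    from (i , j) = proj₁ (point i j)

    -- `to` computes its index over `π z`, whereas a point of the fibre over i carries only a proof
    -- that `π z` is i; this transports one to the other.
    to-index : ∀ i z (e : (π z == i) ≡ true) → to z ≡ (i , index i z e)
    to-index i z e with ==⇒≡ {u = π z} {i} e
    ... | refl = cong (λ e → π z , index (π z) z e) (true-irrelevant _ _)

    index-point : ∀ i j → index i (proj₁ (point i j)) (proj₂ (point i j)) ≡ j
    index-point i j = trans (cong (cast (fibre-size i)) (rank-select (λ z → π z == i) _))
                            (trans (cast-trans (sym (fibre-size i)) (fibre-size i) j) (cast-is-id _ j))

    to-from : ∀ x → to (from x) ≡ x
    to-from (i , j) = trans (to-index i _ (proj₂ (point i j))) (cong (i ,_) (index-point i j))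

    from-to : ∀ z → from (to z) ≡ z
    from-to z = trans (cong (proj₁ ∘ select (λ w → π w == π z)) (trans (cast-trans (fibre-size (π z)) (sym (fibre-size (π z))) _) (cast-is-id _ _)))
                      (select-rank (λ w → π w == π z) z (==-refl (π z)))

  bijection : Fin n ↔ Σ (Fin N) (Fin ∘ F)
  bijection = mk↔ₛ′ to from to-from from-to

succMod-sound : ∀ N i j → succMod N i j ≡ true → Next N i j
succMod-sound N i j e with suc i ≡ᵇ j in eq
... | true  = inj₁ (sym (≡ᵇ-true (suc i) j eq))
... | false = let p , q = ∧-true {suc i ≡ᵇ N} e in inj₂ (≡ᵇ-true (suc i) N p , ≡ᵇ-true j 0 q)

succMod-complete : ∀ N i j → Next N i j → succMod N i j ≡ true
succMod-complete N i j (inj₁ e) rewrite ≡ᵇ-intro (suc i) j (sym e) = refl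
succMod-complete N i j (inj₂ (e , e′)) rewrite ≡ᵇ-intro (suc i) N e | ≡ᵇ-intro j 0 e′ = ∨-zeroʳ _

∨-true : ∀ {b c} → b ∨ c ≡ true → b ≡ true ⊎ c ≡ true
∨-true {true}  _ = inj₁ refl
∨-true {false} e = inj₂ e

module Conclusion (G : Graph) (R : Regular (n G) (λ u v → adj G u v ≡ true)) (h : ℕ) (2≤h : 2 ≤ h) (3≤h : 3 ≤ h)
                  (layering : Layers.Layering R h 2≤h) (v₀ : Fin (n G)) (inv₁ : Chains.Chain.Inv R h 2≤h layering v₀ 1) where
  open Regular R
  open Layers R h 2≤h
  open Chains R h 2≤h
  open Chain layering v₀
  open Sizes inv₁

  -- Flatness of the layer of `u` puts all of the next layer at distance at most 1.
  cyclic-~ : ∀ {u v} → Next N (p 0 u) (p 0 v) → adj G u v ≡ true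
  cyclic-~ {u} {v} nx = d≤1⇒~ u≢v (subst (d u v ≤_) one (Flat.ahead (flat-at (p 0 u + 0)) zero′ (≤-reflexive (sym one)) (subst (_≤ h) (sym one) (<⇒≤ 2≤h))))
    where
    zero′ : p (p 0 u + 0) u ≡ 0
    zero′ = layer-intro (p 0 u) 0 u (p<N 0 u) refl
    one-step : Next N (p 0 u) (p 0 v) → p (p 0 u + 0) v ≡ 1
    one-step nx with rots-value N (p 0 u) (p 0 v) (p<N 0 v) (<⇒≤ (p<N 0 u)) | nx
    ... | inj₁ e | inj₁ s = trans (p-+ (p 0 u) 0 v) (+-cancelˡ-≡ (p 0 u) _ _ (trans (sym e) (trans s (+-comm 1 (p 0 u)))))
    ... | inj₂ (lt , _) | inj₁ s = contradiction (≤-trans (n≤1+n _) (subst (_< p 0 u) s lt)) 1+n≰n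
    ... | inj₂ (_ , e) | inj₂ (s , s′) = trans (p-+ (p 0 u) 0 v) (+-cancelˡ-≡ (p 0 u) _ _ (trans (sym e) (trans (cong₂ _+_ (sym s) s′) (trans (+-identityʳ _) (+-comm 1 (p 0 u))))))
    ... | inj₁ e | inj₂ (s , s′) = contradiction
      (linear 4 (λ N q q′ r →
            (q :+ r := q′) ∷ (q′ := con 0) ∷ (con 2 :≤ N) ∷ (N := con 1 :+ q) ∷ [] ⊢ con 1 ≤ con 0) refl
        N (p 0 u) (p 0 v) _ (sym e) s′ 2≤N (sym s)) λ ()
    one : p (p 0 u + 0) v ≡ 1
    one = one-step nx
    u≢v : u ≢ v
    u≢v u≡v = contradiction (trans (sym zero′) (trans (cong (p (p 0 u + 0)) u≡v) one)) λ ()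

  adj-cyclic : ∀ u v → adj G u v ≡ cycAdjℕ N (p 0 u) (p 0 v)
  adj-cyclic u v = bool-ext forward backward
    where
    forward : adj G u v ≡ true → cycAdjℕ N (p 0 u) (p 0 v) ≡ true
    forward u~v with Layering.consecutive layering u~v
    ... | inj₁ nx rewrite succMod-complete N (p 0 u) (p 0 v) nx = refl
    ... | inj₂ nx rewrite succMod-complete N (p 0 v) (p 0 u) nx = ∨-zeroʳ _
    backward : cycAdjℕ N (p 0 u) (p 0 v) ≡ true → adj G u v ≡ true
    backward e with ∨-true {succMod N (p 0 u) (p 0 v)} e
    ... | inj₁ s = cyclic-~ (succMod-sound N _ _ s)
    ... | inj₂ s = ~-sym (cyclic-~ (succMod-sound N _ _ s))

  π : Fin (n G) → Fin N
  π z = fromℕ< (p<N 0 z)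

  π-value : ∀ z → toℕ (π z) ≡ p 0 z
  π-value z = toℕ-fromℕ< (p<N 0 z)

  fibre-size : ∀ i → count (λ z → π z == i) ≡ size (toℕ i)
  fibre-size i = trans (sum-cong-≗ (λ z → cong 𝟙 (bool-ext (forward z) (backward z)))) (cong size (+-identityʳ (toℕ i)))
    where
    forward : ∀ z → (π z == i) ≡ true → inLayer (toℕ i + 0) z ≡ true
    forward z e = ≡ᵇ-intro _ 0 (layer-intro (toℕ i) 0 z (toℕ<n i) (trans (sym (π-value z)) (cong toℕ (==⇒≡ {u = π z} e))))
    backward : ∀ z → inLayer (toℕ i + 0) z ≡ true → (π z == i) ≡ true
    backward z e = subst (λ j → (π z == j) ≡ true)
      (toℕ-injective (trans (π-value z) (layer-elim (toℕ i) 0 z (toℕ<n i) (≡ᵇ-true _ 0 e)))) (==-refl (π z))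

  Σ-adj : ∀ N {F : Fin N → ℕ} → Σ (Fin N) (Fin ∘ F) → Σ (Fin N) (Fin ∘ F) → Bool
  Σ-adj N (i , _) (j , _) = cycAdjℕ N (toℕ i) (toℕ j)

  isoΣ : (F : Fin N → ℕ) → (∀ i → size (toℕ i) ≡ F i) → IsoTo G (Σ (Fin N) (Fin ∘ F)) (Σ-adj N)
  isoΣ F sizeF = Fibres.bijection π F (λ i → trans (fibre-size i) (sizeF i)) , λ u v →
    trans (adj-cyclic u v) (sym (cong₂ (cycAdjℕ N) (π-value u) (π-value v)))

  -- `sizes` starts at layer 1, so layer 0 is read as layer N.
  size-0 : size 0 ≡ fW m N
  size-0 with m≤n⇒∃[o]m+o≡n 2≤N
  ... | j , e = trans (sym (trans (cong size (sym (+-identityʳ N))) (size-period 0)))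
                      (subst (λ k → size k ≡ fW m k) e (sizes 3≤h (suc j)))

  cycle : m ≡ 1 → IsCycle G
  cycle m≡1 = subst (3 ≤_) (sym n≡N) (≤-trans 3≤h (m≤m+n h h)) ,
              subst (λ k → IsoTo G (Fin k) (cycAdj k)) (sym n≡N) isoN
    where
    fW-1 : ∀ k → fW 1 k ≡ 1
    fW-1 k with k % 4
    ... | 0 = refl
    ... | 1 = refl
    ... | 2 = refl
    ... | 3 = refl
    ... | suc (suc (suc (suc _))) = refl
    fW-m : ∀ k → fW m k ≡ 1
    fW-m k = trans (cong (λ m → fW m k) m≡1) (fW-1 k)
    size-1 : ∀ k → size k ≡ 1
    size-1 zero    = trans (size-0) (fW-m N)
    size-1 (suc k) = trans (sizes 3≤h k) (fW-m (suc k))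
    iso = isoΣ (λ _ → 1) (size-1 ∘ toℕ)
    drop : Σ (Fin N) (λ _ → Fin 1) ↔ Fin N
    drop = mk↔ₛ′ proj₁ (_, zero) (λ _ → refl) (λ { (i , zero) → refl })
    isoN : IsoTo G (Fin N) (cycAdj N)
    isoN = drop ↔-∘ proj₁ iso , proj₂ iso
    n≡N : n G ≡ N
    n≡N = ↔⇒≡ (proj₁ isoN)

  -- Layers h + 1 and h + 2 have size 1. Residues 0 and 1 of h would give layer h + 1 the size m,
  -- and residue 3 would give it to layer h + 2.
  h-mod-4 : 2 ≤ m → ∃[ i ] h ≡ 2 + i * 4
  h-mod-4 2≤m = i , trans (m≡m%n+[m/n]*n h 4) (cong (_+ i * 4) (go (h % 4) (m%n<n h 4) (m≡m%n+[m/n]*n h 4)))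
    where
    i = h / 4
    m≢1 : m ≢ 1
    m≢1 e = contradiction (subst (2 ≤_) e 2≤m) 1+n≰n
    at : ∀ k r j → size k ≡ 1 → k ≡ suc r + j * 4 → fW m (suc r) ≡ 1
    at k r j e refl = trans (sym (fW-shift m (suc r) j)) (trans (sym (sizes 3≤h (r + j * 4))) e)
    1+ : size (suc h) ≡ 1
    1+ = trans (cong size (+-comm 1 h)) (size-1+h 0)
    2+ : size (2 + h) ≡ 1
    2+ = trans (cong size (+-comm 2 h)) (size-2+h 0)
    go : ∀ r → r < 4 → h ≡ r + i * 4 → r ≡ 2
    go 0 _ e = contradiction (at (suc h) 0 i 1+ (cong suc e)) m≢1
    go 1 _ e = contradiction (at (suc h) 1 i 1+ (cong suc e)) m≢1
    go 2 _ e = refl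
    go 3 _ e = contradiction (at (2 + h) 0 (suc i) 2+ (cong (2 +_) e)) m≢1
    go (suc (suc (suc (suc _)))) (s≤s (s≤s (s≤s (s≤s ())))) _

  isoW : 2 ≤ m → ∃[ ℓ ] (3 ≤ ℓ × ℓ % 2 ≡ 1 × IsoTo G (WV m ℓ) (Wadj m ℓ))
  isoW 2≤m = ℓ , 3≤ℓ i (subst (3 ≤_) h≡ 3≤h) , [m+kn]%n≡m%n 1 i 2 ,
               subst (λ k → IsoTo G (Σ (Fin k) (λ j → Fin (fW m (toℕ j)))) (Σ-adj k)) N≡4ℓ (isoΣ (fW m ∘ toℕ) (all ∘ toℕ))
    where
    i  = proj₁ (h-mod-4 2≤m)
    h≡ = proj₂ (h-mod-4 2≤m)
    ℓ = 1 + i * 2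
    -- The case i = 0 would mean h = 2, which `3 ≤ h` excludes.
    3≤ℓ : ∀ i → 3 ≤ 2 + i * 4 → 3 ≤ 1 + i * 2
    3≤ℓ zero    le = contradiction le 1+n≰n
    3≤ℓ (suc i) le = s≤s (s≤s (s≤s z≤n))
    lemma : ∀ i → 2 + i * 4 + (2 + i * 4) ≡ 4 * (1 + i * 2)
    lemma = solve-∀
    N≡4ℓ : N ≡ 4 * ℓ
    N≡4ℓ = trans (cong₂ _+_ h≡ h≡) (lemma i)
    all : ∀ k → size k ≡ fW m k
    all zero    = trans (size-0) (trans (cong (fW m) (trans N≡4ℓ (*-comm 4 ℓ))) (fW-shift m 0 ℓ))
    all (suc k) = sizes 3≤h k

  result : IsCycle G ⊎ (∃[ m ] ∃[ ℓ ] (2 ≤ m × 3 ≤ ℓ × ℓ % 2 ≡ 1 × IsoTo G (WV m ℓ) (Wadj m ℓ)))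
  result with m ≟ℕ 1
  ... | yes m≡1 = inj₁ (cycle m≡1)
  ... | no  m≢1 = let 2≤m = ≤∧≢⇒< (size-pos 1) (m≢1 ∘ sym)
                      ℓ , 3≤ℓ , odd , iso = isoW 2≤m
                  in inj₂ (m , ℓ , 2≤m , 3≤ℓ , odd , iso)

classify : (G : Graph) (R : Regular (n G) (λ u v → adj G u v ≡ true)) → ∀ {a b} → Cuts.Cut R a b →
           IsCycle G ⊎ (∃[ m ] ∃[ ℓ ] (2 ≤ m × 3 ≤ ℓ × ℓ % 2 ≡ 1 × IsoTo G (WV m ℓ) (Wadj m ℓ)))
classify G R {a} cut = Conclusion.result G R h 2≤h 3≤h layering a inv₁
  where open Build.FromCut R cut (proj₂ (proj₂ (Cuts.crossing-exists R cut)))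

theorem3p7 : (G : Graph) → Connected G → Bipartite G → DistanceBalanced G →
    (∃[ a ] ∃[ b ] (TwoCut G a b × dist G a b ≡ 3)) →
    IsCycle G ⊎
    (∃[ m ] ∃[ ℓ ] (2 ≤ m × 3 ≤ ℓ × ℓ % 2 ≡ 1 × IsoTo G (WV m ℓ) (Wadj m ℓ)))
theorem3p7 G connected bipartite balanced (a , b , two , ab≡3) =
  classify G (graphRegular G connected bipartite balanced) (CutOf.cut G connected bipartite balanced two ab≡3)
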